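{- There is a randomized algorithm for the 0-1 knapsack problem that runs in $\widetilde{O}(n^{3/2}w_{\max})$ time and outputs the optimal value $\mathrm{OPT}$ correctly with high probability.
   Context: In the 0-1 knapsack problem, the input is a capacity $W\in\mathbb{Z}^+$ and $n$ items $(w_1,p_1),\dots,(w_n,p_n)$ with weights $w_i\in\mathbb{Z}^+$ and profits $p_i\in\mathbb{Z}^+$. The goal is to compute $\mathrm{OPT}=\max\{\sum_{i\in S}p_i : S\subseteq\{1,\dots,n\},\ \sum_{i\in S}w_i\le W\}$. Here $w_{\max}=\max_i w_i$. The notation $\widetilde{O}(\cdot)$ hides polylogarithmic factors, and "with high probability" means with probability at least $1-1/\mathrm{poly}(n)$. -}

module Defs where

open import Algebra.Properties.Monoid.Sum using (sum)
open import Data.Bool using (Bool; true; false; if_then_else_)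
open import Data.Fin using (Fin; toℕ)
open import Data.Fin.Subset using (Subset)
open import Data.Integer using (+_)
open import Data.List using (List; []; _∷_; _++_; allFin; cartesianProductWith; drop; filter; foldr; head; length; map; tabulate)
open import Data.Maybe using (fromMaybe)
open import Data.Nat using (ℕ; zero; suc; _+_; _*_; _∸_; _^_; _/_; _%_; _⊔_; _≤_; _<_; _<ᵇ_; _≤?_; NonZero)
open import Data.Nat.DivMod using (_mod_)
open import Data.Nat.Logarithm using (⌊log₂_⌋)
open import Data.Nat.Properties using (+-0-monoid; m^n≢0)
open import Data.Rational.Unnormalised as ℚᵘ using (ℚᵘ)
open import Data.Vec as Vec using (Vec; []; _∷_)
open import Data.Vec.Functional as Vector using (Vector; updateAt)
open import Function using (const)
open import Level using (0ℓ)
open import Relation.Binary.PropositionalEquality using (_≡_)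
open import Relation.Unary using (Pred; Decidable)

vectors : ∀ {A : Set} → List A → (n : ℕ) → List (Vec A n)
vectors xs zero    = [] ∷ []
vectors xs (suc n) = cartesianProductWith _∷_ xs (vectors xs n)

maximum : ∀ {n} → Vector ℕ n → ℕ
maximum = Vector.foldr _⊔_ 0

bitLength : ℕ → ℕ
bitLength n = suc ⌊log₂ n ⌋

record Knapsack (n : ℕ) : Set where
  field
    W   : ℕ
    w p : Vector ℕ n
    W>0 : 0 < W
    w>0 : ∀ i → 0 < w i
    p>0 : ∀ i → 0 < p i

  wmax pmax : ℕ
  wmax = maximum w
  pmax = maximum p

  weight profit : Subset n → ℕ
  weight S = sum +-0-monoid (λ i → if Vec.lookup S i then w i else 0)
  profit S = sum +-0-monoid (λ i → if Vec.lookup S i then p i else 0)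

  feasible : List (Subset n)
  feasible = filter (λ S → weight S ≤? W) (vectors (true ∷ false ∷ []) n)

  -- The empty set is feasible with profit 0, so the base value 0 of the
  -- fold does not change the maximum.
  OPT : ℕ
  OPT = foldr _⊔_ 0 (map profit feasible)

  largestInput : ℕ
  largestInput = n ⊔ W ⊔ wmax ⊔ pmax

  encoding : List ℕ
  encoding = n ∷ W ∷ tabulate w ++ tabulate p

-- Randomized word RAM with b-bit words, R registers and 2 ^ b memory
-- cells.  A program is a fixed finite text, independent of b and of the
-- input.  Structured control flow replaces jumps; every executed
-- instruction, and every test of a loop condition, costs one step.

Word : ℕ → Set
Word b = Fin (2 ^ b)

word : ∀ b → ℕ → Word b
word b x = _mod_ x (2 ^ b) {{m^n≢0 2 b}}

data Op : Set where
  add sub mul div rem lt : Op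

-- Results are reduced modulo 2 ^ b by the machine; sub is truncated at 0,
-- and division by 0 yields 0.
⟦_⟧ : Op → ℕ → ℕ → ℕ
⟦ add ⟧ x y       = x + y
⟦ sub ⟧ x y       = x ∸ y
⟦ mul ⟧ x y       = x * y
⟦ div ⟧ x zero    = 0
⟦ div ⟧ x (suc y) = x / suc y
⟦ rem ⟧ x zero    = 0
⟦ rem ⟧ x (suc y) = x % suc y
⟦ lt  ⟧ x y       = if x <ᵇ y then 1 else 0

data Instr (R : ℕ) : Set where
  set    : (r : Fin R) (c : ℕ) → Instr R                    -- r := c
  arith  : (o : Op) (r s t : Fin R) → Instr R               -- r := s o t
  load   : (r s : Fin R) → Instr R                          -- r := mem[s]
  store  : (r s : Fin R) → Instr R                          -- mem[r] := s
  random : (r : Fin R) → Instr R                            -- r := uniform word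
  ifnz   : (r : Fin R) (then else : List (Instr R)) → Instr R
  while  : (r : Fin R) (body : List (Instr R)) → Instr R    -- while r ≠ 0

Program : ℕ → Set
Program R = List (Instr R)

record Config (R b : ℕ) : Set where
  constructor config
  field
    code : Program R            -- what remains to be executed
    regs : Vector (Word b) R
    mem  : Vector (Word b) (2 ^ b)

open Config public

Halted : ∀ {R b} → Config R b → Set
Halted s = code s ≡ []

isZero : ∀ {n} → Fin n → Bool
isZero x = toℕ x <ᵇ 1

-- One step; ω is a fresh random word, which only `random` looks at.
step : ∀ {R b} → Word b → Config R b → Config R b
step         ω (config []                  ρ m) = config [] ρ m
step {b = b} ω (config (set r c      ∷ is) ρ m) = config is (updateAt ρ r (const (word b c))) m
step {b = b} ω (config (arith o r s t ∷ is) ρ m) =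
  config is (updateAt ρ r (const (word b (⟦ o ⟧ (toℕ (ρ s)) (toℕ (ρ t)))))) m
step         ω (config (load r s     ∷ is) ρ m) = config is (updateAt ρ r (const (m (ρ s)))) m
step         ω (config (store r s    ∷ is) ρ m) = config is ρ (updateAt m (ρ r) (const (ρ s)))
step         ω (config (random r     ∷ is) ρ m) = config is (updateAt ρ r (const ω)) m
step         ω (config (ifnz r P Q   ∷ is) ρ m) =
  config ((if isZero (ρ r) then Q else P) ++ is) ρ m
step         ω (config (while r P    ∷ is) ρ m) =
  config (if isZero (ρ r) then is else P ++ while r P ∷ is) ρ m

-- T steps, using one word of the random tape per step.
run : ∀ {R b T} → Vec (Word b) T → Config R b → Config R b
run []       s = s
run (ω ∷ ωs) s = run ωs (step ω s)

-- The input occupies the cells 0, 1, 2, …; all other cells and all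
-- registers are 0.
initial : ∀ {R} b → Program R → List ℕ → Config R b
initial b P xs = config P (const (word b 0)) (λ a → word b (fromMaybe 0 (head (drop (toℕ a) xs))))

output : ∀ {R b} → Config R b → ℕ
output {b = b} s = toℕ (mem s (word b 0))

-- Probability under a uniformly random tape of T words.
Pr : (b T : ℕ) {E : Pred (Vec (Word b) T) 0ℓ} → Decidable E → ℚᵘ
Pr b T E? =
  ℚᵘ._/_ (+ length (filter E? (vectors (allFin (2 ^ b)) T)))
         ((2 ^ b) ^ T) {{m^n≢0 (2 ^ b) T {{m^n≢0 2 b}}}}

inversePower : (n c : ℕ) .{{_ : NonZero n}} → ℚᵘ
inversePower n c = ℚᵘ._/_ (+ 1) (n ^ c) {{m^n≢0 n c}}

-- T ≤ C · n^{3/2} · wmax · polylog(n · wmax), squared so as to stay in ℕ.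
TimeBound : (C d n wmax T : ℕ) → Set
TimeBound C d n wmax T = T ^ 2 ≤ (C * wmax * bitLength (n * wmax) ^ d) ^ 2 * n ^ 3

{-# OPTIONS --safe #-}

-- Throw each item into one of M = 2^m ≈ √n buckets, chosen by a random word
-- modulo M, and run the textbook dynamic program bucket by bucket.  For a
-- fixed optimal solution, the weight A of its items in the first t buckets is
-- a sum of independent terms with mean t/M of the total, so up to a
-- probability 2^-L it deviates by at most D = O(M wmax L).  Hence only table
-- entries in a window of width O(W/M + D) need updating per item.  Entries
-- outside the windows are merely stale: every entry is always the profit of
-- some set that fits, so the answer is never too large.
--
-- The tail bound is Markov's inequality for ((K+1)/K)^(M A) with
-- K = M² wmax, cleared of denominators; only (1 + 1/K)^j ≤ 1 + j/K + (j/K)²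
-- for j ≤ K and Bernoulli's inequality are needed.

module Submission where

open import Defs
open import Algebra.Properties.Monoid.Sum using (sum-cong-≗) renaming (sum to vsum)
open import Data.Bool as Bool using (Bool; true; false; if_then_else_; _∧_; _∨_; not)
open import Data.Bool.Properties using (∧-zeroʳ; ∧-identityʳ; ∨-identityʳ)
open import Data.Fin using (Fin; zero; suc; toℕ; fromℕ<; #_)
import Data.Fin.Properties as Fin
open import Data.Fin.Subset using (Subset)
open import Data.Integer as ℤ using (-[1+_])
import Data.Integer.Properties as ℤ
open import Data.List as List using (List; []; _∷_; _++_; map; tabulate; allFin; cartesianProductWith; foldr; filter; length; drop; head)
open import Data.List.Membership.Propositional using (_∈_)
open import Data.List.Membership.Propositional.Properties using (∈-cartesianProductWith⁺; ∈-filter⁺; ∈-filter⁻; ∈-map⁺; ∈-map⁻)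
open import Data.List.Properties using (map-∘; map-++; map-cong; map-tabulate; length-++; length-tabulate; ++-identityʳ)
open import Data.List.Relation.Unary.All using (All; []; _∷_)
import Data.List.Relation.Unary.All.Properties as All
open import Data.List.Relation.Unary.Any using (here; there)
open import Data.Maybe using (fromMaybe)
open import Data.Nat
open import Data.Nat.DivMod using ([m+kn]%n≡m%n; m<n⇒m%n≡m; m%n≤m; m/n≤m; m%n<n; /-monoˡ-≤; m*n/n≡m; m≡m%n+[m/n]*n)
open import Data.Nat.ListAction using (sum)
open import Data.Nat.ListAction.Properties using (sum-++)
open import Data.Nat.Logarithm using (⌊log₂_⌋; ⌊log₂⌋-mono-≤; ⌊log₂[2^n]⌋≡n)
open import Data.Nat.Properties
open import Data.Nat.Tactic.RingSolver using (solve-∀)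
open import Data.Product using (∃-syntax; _×_; _,_; proj₁; proj₂)
open import Data.Rational.Unnormalised as ℚᵘ using (1ℚᵘ; *≤*)
open import Data.Sum using (_⊎_; inj₁; inj₂)
open import Data.Unit using (tt)
open import Data.Vec as Vec using (Vec; []; _∷_; lookup; _[_]≔_)
open import Data.Vec.Functional using (Vector; updateAt)
open import Data.Vec.Functional.Properties using (updateAt-updates; updateAt-minimal)
open import Data.Vec.Properties using (lookup∘tabulate; lookup-replicate)
open import Function using (_∘_; _$_; id; const)
open import Relation.Binary.PropositionalEquality
open import Relation.Nullary using (Dec; yes; no; contradiction)

-- Executions on natural numbers

-- The capacity enters the cost through the windows and the final scan, so it is first replaced by
-- its minimum with the total weight, which is at most n wmax. A bucket then advances the expected
-- weight by at most n wmax / M, while the fluctuation of A is of order wmax √n up to a logarithm; M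
-- ≈ √n balances the two. The weight of the optimal solution is unknown to the program, whose
-- windows are centred on multiples of W / M instead. This is harmless: an item outside an optimal
-- set no longer fits, so the optimal weight is within wmax of the capped capacity. K is scaled so
-- that one item contributes x ≤ 1 / M to the exponent; the second-order errors 1 + 1 / M² of n ≤ M²
-- items then multiply to at most 3. Only upper tails are estimated: a lower deviation inside the
-- first t buckets is an upper deviation outside them. M is a power of two, so a word modulo M is
-- exactly uniform. Halting, the time bound and the absence of overflow hold on every tape; only
-- completeness along the fixed optimal solution uses the good event.

toℕ-word : ∀ b {x} → x < 2 ^ b → toℕ (word b x) ≡ x
toℕ-word b {x} x<2^b = trans (Fin.toℕ-fromℕ< _) (m<n⇒m%n≡m {{m^n≢0 2 b}} x<2^b)

Memory : Set
Memory = ℕ → ℕ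

_[_↦_] : Memory → ℕ → ℕ → Memory
(μ [ a ↦ x ]) c with c ≟ a
... | yes _ = x
... | no  _ = μ c

↦-same : ∀ μ a {x} → (μ [ a ↦ x ]) a ≡ x
↦-same μ a with a ≟ a
... | yes _ = refl
... | no ¬p = contradiction refl ¬p

↦-other : ∀ μ {a x c} → c ≢ a → (μ [ a ↦ x ]) c ≡ μ c
↦-other μ {a} {x} {c} c≢a with c ≟ a
... | yes p = contradiction p c≢a
... | no  _ = refl

record State (R : ℕ) : Set where
  constructor ⟨_,_,_⟩
  field
    program   : Program R
    registers : Vec ℕ R
    memory    : Memory

-- Named so that unevaluated register files stay linear in the number of steps.
assign : ∀ {R} → Op → (r s t : Fin R) → Vec ℕ R → Vec ℕ R
assign o r s t v = v [ r ]≔ ⟦ o ⟧ (lookup v s) (lookup v t)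

fetch : ∀ {R} → (r s : Fin R) → Memory → Vec ℕ R → Vec ℕ R
fetch r s μ v = v [ r ]≔ μ (lookup v s)

save : ∀ {R} → (r s : Fin R) → Vec ℕ R → Memory → Memory
save r s v μ = μ [ lookup v r ↦ lookup v s ]

-- Memory is unbounded and no word may overflow; k counts the steps made so
-- far and τ is the random tape.
data Step {R : ℕ} (b : ℕ) (τ : ℕ → ℕ) (k : ℕ) : State R → State R → Set where
  set    : ∀ {r c is v μ} → c < 2 ^ b →
           Step b τ k ⟨ set r c ∷ is , v , μ ⟩ ⟨ is , v [ r ]≔ c , μ ⟩
  arith  : ∀ {o r s t is v μ} → ⟦ o ⟧ (lookup v s) (lookup v t) < 2 ^ b →
           Step b τ k ⟨ arith o r s t ∷ is , v , μ ⟩ ⟨ is , assign o r s t v , μ ⟩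
  shrink : ∀ {o r s t is v μ} → ⟦ o ⟧ (lookup v s) (lookup v t) ≤ lookup v s →
           Step b τ k ⟨ arith o r s t ∷ is , v , μ ⟩ ⟨ is , assign o r s t v , μ ⟩
  load   : ∀ {r s is v μ} →
           Step b τ k ⟨ load r s ∷ is , v , μ ⟩ ⟨ is , fetch r s μ v , μ ⟩
  store  : ∀ {r s is v μ} →
           Step b τ k ⟨ store r s ∷ is , v , μ ⟩ ⟨ is , v , save r s v μ ⟩
  random : ∀ {r is v μ} →
           Step b τ k ⟨ random r ∷ is , v , μ ⟩ ⟨ is , v [ r ]≔ τ k , μ ⟩
  ifnz⁰  : ∀ {r P P′ is v μ} → lookup v r ≡ 0 →
           Step b τ k ⟨ ifnz r P P′ ∷ is , v , μ ⟩ ⟨ P′ ++ is , v , μ ⟩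
  ifnz⁺  : ∀ {r P P′ is v μ j} → lookup v r ≡ suc j →
           Step b τ k ⟨ ifnz r P P′ ∷ is , v , μ ⟩ ⟨ P ++ is , v , μ ⟩
  while⁰ : ∀ {r P is v μ} → lookup v r ≡ 0 →
           Step b τ k ⟨ while r P ∷ is , v , μ ⟩ ⟨ is , v , μ ⟩
  while⁺ : ∀ {r P is v μ j} → lookup v r ≡ suc j →
           Step b τ k ⟨ while r P ∷ is , v , μ ⟩ ⟨ P ++ while r P ∷ is , v , μ ⟩

infixr 5 _▹_

-- The postcondition belongs to the whole remaining program. Lemmas about loops therefore take the
-- run of the code after the loop as a continuation `next`, and executions are composed by nesting
-- instead of by a sequencing rule.
data Run {R : ℕ} (b : ℕ) (τ : ℕ → ℕ) (Q : ℕ → Memory → Set) (k : ℕ) : State R → Set where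
  halt : ∀ {v μ} → Q k μ → Run b τ Q k ⟨ [] , v , μ ⟩
  _▹_  : ∀ {s s′} → Step b τ k s s′ → Run b τ Q (suc k) s′ → Run b τ Q k s

at : ∀ {N T} → Vec (Fin N) T → ℕ → ℕ
at []      k       = 0
at (x ∷ ω) zero    = toℕ x
at (x ∷ ω) (suc k) = at ω k

run-halted : ∀ {R b T} (ω : Vec (Word b) T) {s : Config R b} → Halted s → run ω s ≡ s
run-halted         []      halted                = refl
run-halted {b = b} (x ∷ ω) {config [] ρ m} refl = run-halted {b = b} ω refl

module _ {R b : ℕ} {τ : ℕ → ℕ} {Q : ℕ → Memory → Set} where

  private
    _~ᵣ_ : Vector (Word b) R → Vec ℕ R → Set
    ρ ~ᵣ v = ∀ r → toℕ (ρ r) ≡ lookup v r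

    _~ₘ_ : Vector (Word b) (2 ^ b) → Memory → Set
    m ~ₘ μ = ∀ a → toℕ (m a) ≡ μ (toℕ a)

    update-~ᵣ : ∀ {R} {ρ : Vector (Word b) R} (v : Vec ℕ R) r {y x} → toℕ y ≡ x →
                (∀ r → toℕ (ρ r) ≡ lookup v r) →
                ∀ r′ → toℕ (updateAt ρ r (const y) r′) ≡ lookup (v [ r ]≔ x) r′
    update-~ᵣ (_ ∷ v) zero    y~x ρ~v zero     = y~x
    update-~ᵣ (_ ∷ v) zero    y~x ρ~v (suc r′) = ρ~v (suc r′)
    update-~ᵣ (_ ∷ v) (suc r) y~x ρ~v zero     = ρ~v zero
    update-~ᵣ (_ ∷ v) (suc r) y~x ρ~v (suc r′) = update-~ᵣ v r y~x (ρ~v ∘ suc) r′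

    load-~ₘ : ∀ {m μ a c} → m ~ₘ μ → toℕ a ≡ c → toℕ (m a) ≡ μ c
    load-~ₘ m~μ refl = m~μ _

    store-~ₘ : ∀ {m μ a c y x} → m ~ₘ μ → toℕ a ≡ c → toℕ y ≡ x →
               updateAt m a (const y) ~ₘ (μ [ c ↦ x ])
    store-~ₘ {m} {μ} {a} m~μ refl refl a′ with a′ Fin.≟ a
    ... | yes refl = trans (cong toℕ (updateAt-updates a m)) (sym (↦-same μ (toℕ a)))
    ... | no a′≢a  = trans (cong toℕ (updateAt-minimal a′ a m a′≢a))
                       (trans (m~μ a′) (sym (↦-other μ (a′≢a ∘ Fin.toℕ-injective))))

    isZero⁰ : ∀ {N} {x : Fin N} {y} → toℕ x ≡ y → y ≡ 0 → isZero x ≡ true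
    isZero⁰ e refl rewrite e = refl

    isZero⁺ : ∀ {N} {x : Fin N} {y j} → toℕ x ≡ y → y ≡ suc j → isZero x ≡ false
    isZero⁺ e refl rewrite e = refl

    arith-word : ∀ o {x y x′ y′} → x ≡ x′ → y ≡ y′ → ⟦ o ⟧ x′ y′ < 2 ^ b →
                 toℕ (word b (⟦ o ⟧ x y)) ≡ ⟦ o ⟧ x′ y′
    arith-word o refl refl = toℕ-word b

  clock-≤ : ∀ {k} {s : State R} → Run b τ Q k s → ∃[ k′ ] ∃[ μ ] k ≤ k′ × Q k′ μ
  clock-≤ (halt q) = _ , _ , ≤-refl , q
  clock-≤ (_ ▹ r) with k′ , μ , k<k′ , q ← clock-≤ r = k′ , μ , <⇒≤ k<k′ , q

  private
    _~_ : Config R b → State R → Set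
    config is ρ m ~ ⟨ is′ , v , μ ⟩ = is ≡ is′ × ρ ~ᵣ v × m ~ₘ μ

    simulate : ∀ {k ω s s′} {c : Config R b} → τ k ≡ toℕ ω → c ~ s → Step b τ k s s′ → step ω c ~ s′
    simulate τₖ (refl , ρ~v , m~μ) (set {r} {v = v} c<) = refl , update-~ᵣ v r (toℕ-word b c<) ρ~v , m~μ
    simulate τₖ (refl , ρ~v , m~μ) (arith {o} {r} {s} {t} {v = v} o<) =
      refl , update-~ᵣ v r (arith-word o (ρ~v s) (ρ~v t) o<) ρ~v , m~μ
    -- The state on natural numbers does not record that its registers are words. The bound on
    -- register `s` comes from the machine, where it is an element of `Fin (2 ^ b)`.
    simulate τₖ (refl , ρ~v , m~μ) (shrink {o} {r} {s} {t} {v = v} o≤) =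
      refl , update-~ᵣ v r (arith-word o (ρ~v s) (ρ~v t)
        (≤-<-trans o≤ (subst (_< 2 ^ b) (ρ~v s) (Fin.toℕ<n _)))) ρ~v , m~μ
    simulate τₖ (refl , ρ~v , m~μ) (load {r} {s} {v = v} {μ}) =
      refl , update-~ᵣ v r (load-~ₘ {μ = μ} m~μ (ρ~v s)) ρ~v , m~μ
    simulate τₖ (refl , ρ~v , m~μ) (store {r} {s} {μ = μ}) =
      refl , ρ~v , store-~ₘ {μ = μ} m~μ (ρ~v r) (ρ~v s)
    simulate τₖ (refl , ρ~v , m~μ) (random {r} {v = v}) = refl , update-~ᵣ v r (sym τₖ) ρ~v , m~μ
    simulate τₖ (refl , ρ~v , m~μ) (ifnz⁰ {r} {P} {P′} {is} r≡0) =
      cong (λ z → (if z then P′ else P) ++ is) (isZero⁰ (ρ~v r) r≡0) , ρ~v , m~μ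
    simulate τₖ (refl , ρ~v , m~μ) (ifnz⁺ {r} {P} {P′} {is} r≡s) =
      cong (λ z → (if z then P′ else P) ++ is) (isZero⁺ (ρ~v r) r≡s) , ρ~v , m~μ
    simulate τₖ (refl , ρ~v , m~μ) (while⁰ {r} {P} {is} r≡0) =
      cong (λ z → if z then is else P ++ while r P ∷ is) (isZero⁰ (ρ~v r) r≡0) , ρ~v , m~μ
    simulate τₖ (refl , ρ~v , m~μ) (while⁺ {r} {P} {is} r≡s) =
      cong (λ z → if z then is else P ++ while r P ∷ is) (isZero⁺ (ρ~v r) r≡s) , ρ~v , m~μ

  -- The postcondition itself carries the time bound: the clock advances with every step, so the
  -- tape cannot run out before the run ends, and the halted machine idles on the words that are
  -- left.
  adequate : ∀ {T} (ω : Vec (Word b) T) {k s} {c : Config R b} →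
             (∀ i → τ (i + k) ≡ at ω i) → (∀ {k′ μ} → Q k′ μ → k′ ≤ T + k) →
             c ~ s → Run b τ Q k s →
             Halted (run ω c) × ∃[ k′ ] ∃[ μ ] Q k′ μ × mem (run ω c) ~ₘ μ
  adequate ω tape bound (refl , ρ~v , m~μ) (halt q) =
    subst (λ c → Halted c × ∃[ k′ ] ∃[ μ ] Q k′ μ × mem c ~ₘ μ) (sym (run-halted {b = b} ω refl))
      (refl , _ , _ , q , m~μ)
  adequate [] tape bound c~s (_ ▹ r) with k′ , _ , k<k′ , q ← clock-≤ r = contradiction (bound q) (<⇒≱ k<k′)
  adequate {suc T} (w ∷ ω) {k} tape bound c~s (s↝s′ ▹ r) =
    adequate ω (λ i → trans (cong τ (+-suc i k)) (tape (suc i)))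
      (λ {k′} q → subst (k′ ≤_) (sym (+-suc T k)) (bound q))
      (simulate (tape 0) c~s s↝s′) r

-- Random tapes and the tail bound

sumBelow prodBelow : ℕ → (ℕ → ℕ) → ℕ
sumBelow  zero    f = 0
sumBelow  (suc n) f = f n + sumBelow n f
prodBelow zero    f = 1
prodBelow (suc n) f = f n * prodBelow n f

sumBelow-cong : ∀ n {f g} → (∀ {i} → i < n → f i ≡ g i) → sumBelow n f ≡ sumBelow n g
sumBelow-cong zero    f≗g = refl
sumBelow-cong (suc n) f≗g = cong₂ _+_ (f≗g ≤-refl) (sumBelow-cong n (f≗g ∘ m<n⇒m<1+n))

sumBelow-mono : ∀ n {f g} → (∀ {i} → i < n → f i ≤ g i) → sumBelow n f ≤ sumBelow n g
sumBelow-mono zero    f≤g = z≤n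
sumBelow-mono (suc n) f≤g = +-mono-≤ (f≤g ≤-refl) (sumBelow-mono n (f≤g ∘ m<n⇒m<1+n))

sumBelow-+ : ∀ m n f → sumBelow (m + n) f ≡ sumBelow m (λ i → f (i + n)) + sumBelow n f
sumBelow-+ zero    n f = refl
sumBelow-+ (suc m) n f = trans (cong (f (m + n) +_) (sumBelow-+ m n f)) (sym (+-assoc (f (m + n)) _ _))

sumBelow-suc : ∀ n f → sumBelow (suc n) f ≡ f 0 + sumBelow n (f ∘ suc)
sumBelow-suc n f = trans (cong (λ k → sumBelow k f) (sym (+-comm n 1)))
  (trans (sumBelow-+ n 1 f) (trans (cong₂ _+_ (sumBelow-cong n (λ {i} _ → cong f (+-comm i 1))) (+-identityʳ (f 0))) (+-comm _ (f 0))))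

prodBelow-cong : ∀ n {f g} → (∀ {i} → i < n → f i ≡ g i) → prodBelow n f ≡ prodBelow n g
prodBelow-cong zero    f≗g = refl
prodBelow-cong (suc n) f≗g = cong₂ _*_ (f≗g ≤-refl) (prodBelow-cong n (f≗g ∘ m<n⇒m<1+n))

∑ : ∀ {A : Set} → List A → (A → ℕ) → ℕ
∑ xs f = sum (map f xs)

module _ {A : Set} where

  ∑-cong : ∀ (xs : List A) {f g : A → ℕ} → (∀ x → f x ≡ g x) → ∑ xs f ≡ ∑ xs g
  ∑-cong xs f≗g = cong sum (map-cong f≗g xs)

  ∑-mono : ∀ (xs : List A) {f g : A → ℕ} → (∀ x → f x ≤ g x) → ∑ xs f ≤ ∑ xs g
  ∑-mono []       f≤g = z≤n
  ∑-mono (x ∷ xs) f≤g = +-mono-≤ (f≤g x) (∑-mono xs f≤g)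

  ∑-+ : ∀ (xs : List A) (f g : A → ℕ) → ∑ xs (λ x → f x + g x) ≡ ∑ xs f + ∑ xs g
  ∑-+ []       f g = refl
  ∑-+ (x ∷ xs) f g rewrite ∑-+ xs f g = lemma (f x) (g x) (∑ xs f) (∑ xs g)
    where
    lemma : ∀ a b c d → a + b + (c + d) ≡ a + c + (b + d)
    lemma = solve-∀

  ∑-*ˡ : ∀ (xs : List A) c (f : A → ℕ) → ∑ xs (λ x → c * f x) ≡ c * ∑ xs f
  ∑-*ˡ []       c f = sym (*-zeroʳ c)
  ∑-*ˡ (x ∷ xs) c f rewrite ∑-*ˡ xs c f = sym (*-distribˡ-+ c (f x) _)

  ∑-sumBelow : ∀ (xs : List A) n (f : A → ℕ → ℕ) →
               ∑ xs (λ x → sumBelow n (f x)) ≡ sumBelow n (λ i → ∑ xs (λ x → f x i))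
  ∑-sumBelow xs zero    f = ∑-*ˡ xs 0 (λ _ → 0)
  ∑-sumBelow xs (suc n) f = trans (∑-+ xs (λ x → f x n) _) (cong (∑ xs (λ x → f x n) +_) (∑-sumBelow xs n f))

  ∑-++ : ∀ (xs ys : List A) (f : A → ℕ) → ∑ (xs ++ ys) f ≡ ∑ xs f + ∑ ys f
  ∑-++ xs ys f = trans (cong sum (map-++ f xs ys)) (sum-++ (map f xs) (map f ys))

∑-cartesianProductWith : ∀ {A B C : Set} (c : A → B → C) xs ys (f : C → ℕ) →
  ∑ (cartesianProductWith c xs ys) f ≡ ∑ xs (λ x → ∑ ys (λ y → f (c x y)))
∑-cartesianProductWith c []       ys f = refl
∑-cartesianProductWith c (x ∷ xs) ys f =
  trans (∑-++ (map (c x) ys) _ f)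
    (cong₂ _+_ (cong sum (sym (map-∘ ys))) (∑-cartesianProductWith c xs ys f))

∑-allFin : ∀ N f → ∑ (allFin N) (f ∘ toℕ) ≡ sumBelow N f
∑-allFin N f = trans (cong sum (map-tabulate {n = N} id (f ∘ toℕ))) (go N f)
  where
  go : ∀ N f → sum (tabulate {n = N} (f ∘ toℕ)) ≡ sumBelow N f
  go zero    f = refl
  go (suc N) f = trans (cong (f 0 +_) (go N (f ∘ suc))) (sym (sumBelow-suc N f))

sumBelow-const : ∀ n c → sumBelow n (λ _ → c) ≡ n * c
sumBelow-const zero    c = refl
sumBelow-const (suc n) c = cong (c +_) (sumBelow-const n c)

-- A round of the drawing loop takes 10 steps, so the words for the items
-- n-1, …, 0 are drawn at the times k, k + 10, k + 20, ….
sample : (ℕ → ℕ) → (n k : ℕ) → ℕ → ℕ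
sample τ zero    k j = 0
sample τ (suc n) k j with j ≟ n
... | yes _ = τ k
... | no  _ = sample τ n (10 + k) j

sample-top : ∀ τ n k → sample τ (suc n) k n ≡ τ k
sample-top τ n k with n ≟ n
... | yes _  = refl
... | no n≢n = contradiction refl n≢n

sample-below : ∀ τ n k {j} → j < n → sample τ (suc n) k j ≡ sample τ n (10 + k) j
sample-below τ n k {j} j<n with j ≟ n
... | yes refl = contradiction j<n (<-irrefl refl)
... | no  _    = refl

sample-∷ : ∀ {N T} (x : Fin N) (ω : Vec (Fin N) T) n k j →
           sample (at (x ∷ ω)) n (suc k) j ≡ sample (at ω) n k j
sample-∷ x ω zero    k j = refl
sample-∷ x ω (suc n) k j with j ≟ n
... | yes _ = refl
... | no  _ = sample-∷ x ω n (10 + k) j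

module _ (N : ℕ) where

  ∑-words-≤ : ∀ {T} (f : Vec (Fin N) (suc T) → ℕ) {B} →
              (∀ x → ∑ (vectors (allFin N) T) (λ ω → f (x ∷ ω)) ≤ B) →
              ∑ (vectors (allFin N) (suc T)) f ≤ N * B
  ∑-words-≤ {T} f {B} f≤B = begin
    ∑ (vectors (allFin N) (suc T)) f
      ≡⟨ ∑-cartesianProductWith _∷_ (allFin N) _ f ⟩
    ∑ (allFin N) (λ x → ∑ (vectors (allFin N) T) (λ ω → f (x ∷ ω)))
      ≤⟨ ∑-mono (allFin N) f≤B ⟩
    ∑ (allFin N) (λ _ → B)
      ≡⟨ ∑-allFin N (λ _ → B) ⟩
    sumBelow N (λ _ → B)
      ≡⟨ sumBelow-const N B ⟩
    N * B ∎
    where open ≤-Reasoning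

  -- Independence is the distribution of a product over a sum, peeling words off the front of the
  -- tape. A word before the first draw is averaged away; a word at time 0 affects only the factor
  -- of the highest item, and once it is removed the next draw is 9 words ahead.
  independent : ∀ T n k (g : ℕ → ℕ → ℕ) (h : ℕ → ℕ) → n * 10 + k ≤ T →
    (∀ {j} → j < n → sumBelow N (g j) ≤ N * h j) →
    ∑ (vectors (allFin N) T) (λ ω → prodBelow n (λ j → g j (sample (at ω) n k j))) ≤ N ^ T * prodBelow n h
  independent zero    zero    k g h k≤T g≤h = ≤-refl
  independent (suc T) zero    k g h k≤T g≤h =
    ≤-trans (∑-words-≤ {T} (λ _ → 1) (λ _ → independent T zero 0 g h z≤n (λ ())))
      (≤-reflexive (sym (*-assoc N (N ^ T) 1)))
  independent (suc T) (suc n) (suc k) g h k≤T g≤h =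
    ≤-trans (∑-words-≤ {T} _ λ x →
      ≤-trans (≤-reflexive (∑-cong (vectors (allFin N) T) λ ω → prodBelow-cong (suc n) λ {j} _ →
          cong (g j) (sample-∷ x ω (suc n) k j)))
        (independent T (suc n) k g h (s≤s⁻¹ (subst (_≤ suc T) (+-suc (suc n * 10) k) k≤T)) g≤h))
      (≤-reflexive (sym (*-assoc N (N ^ T) _)))
  independent (suc T) (suc n) zero g h k≤T g≤h = begin
    ∑ (vectors (allFin N) (suc T)) F
      ≡⟨ ∑-cartesianProductWith _∷_ (allFin N) _ F ⟩
    ∑ (allFin N) (λ x → ∑ (vectors (allFin N) T) (λ ω → F (x ∷ ω)))
      ≡⟨ ∑-cong (allFin N) (λ x → trans (∑-cong (vectors (allFin N) T) (split x))
           (trans (∑-*ˡ (vectors (allFin N) T) (g n (toℕ x)) G) (*-comm (g n (toℕ x)) _))) ⟩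
    ∑ (allFin N) (λ x → ∑ (vectors (allFin N) T) G * g n (toℕ x))
      ≡⟨ ∑-*ˡ (allFin N) (∑ (vectors (allFin N) T) G) (g n ∘ toℕ) ⟩
    ∑ (vectors (allFin N) T) G * ∑ (allFin N) (g n ∘ toℕ)
      ≡⟨ cong (∑ (vectors (allFin N) T) G *_) (∑-allFin N (g n)) ⟩
    ∑ (vectors (allFin N) T) G * sumBelow N (g n)
      ≤⟨ *-mono-≤ (independent T n 9 g h n*10+9≤T (g≤h ∘ m<n⇒m<1+n)) (g≤h ≤-refl) ⟩
    N ^ T * prodBelow n h * (N * h n)
      ≡⟨ rearrange N (N ^ T) (prodBelow n h) (h n) ⟩
    N * N ^ T * (h n * prodBelow n h) ∎
    where
    open ≤-Reasoning
    F : Vec (Fin N) (suc T) → ℕ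
    F ω = prodBelow (suc n) (λ j → g j (sample (at ω) (suc n) zero j))
    G : Vec (Fin N) T → ℕ
    G ω = prodBelow n (λ j → g j (sample (at ω) n 9 j))
    split : ∀ x ω → F (x ∷ ω) ≡ g n (toℕ x) * G ω
    split x ω = cong₂ _*_ (cong (g n) (sample-top (at (x ∷ ω)) n 0))
      (prodBelow-cong n λ {j} j<n → cong (g j)
        (trans (sample-below (at (x ∷ ω)) n 0 j<n) (sample-∷ x ω n 9 j)))
    n*10+9≤T : n * 10 + 9 ≤ T
    n*10+9≤T = ≤-trans (≤-reflexive (+-comm (n * 10) 9)) (s≤s⁻¹ (subst (_≤ suc T) (+-identityʳ _) k≤T))
    rearrange : ∀ N A P h → A * P * (N * h) ≡ N * A * (h * P)
    rearrange = solve-∀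

-- Since `M` divides the length of the range, every residue occurs equally often. This is where it
-- matters that the number of buckets is a power of two.
sumBelow-rem : ∀ M .{{_ : NonZero M}} q φ → sumBelow (q * M) (φ ∘ (_% M)) ≡ q * sumBelow M φ
sumBelow-rem M zero    φ = refl
sumBelow-rem M (suc q) φ = trans (sumBelow-+ M (q * M) _) (cong₂ _+_
  (sumBelow-cong M (λ {i} i<M → cong φ (trans ([m+kn]%n≡m%n i q M) (m<n⇒m%n≡m i<M))))
  (sumBelow-rem M q φ))

sumBelow-*ˡ : ∀ n c f → sumBelow n (λ i → c * f i) ≡ c * sumBelow n f
sumBelow-*ˡ zero    c f = sym (*-zeroʳ c)
sumBelow-*ˡ (suc n) c f = trans (cong (c * f n +_) (sumBelow-*ˡ n c f)) (sym (*-distribˡ-+ c (f n) _))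

prodBelow-* : ∀ n f g → prodBelow n (λ i → f i * g i) ≡ prodBelow n f * prodBelow n g
prodBelow-* zero    f g = refl
prodBelow-* (suc n) f g rewrite prodBelow-* n f g = lemma (f n) (g n) (prodBelow n f) (prodBelow n g)
  where
  lemma : ∀ a b c d → a * b * (c * d) ≡ a * c * (b * d)
  lemma = solve-∀

prodBelow-const : ∀ n c → prodBelow n (λ _ → c) ≡ c ^ n
prodBelow-const zero    c = refl
prodBelow-const (suc n) c = cong (c *_) (prodBelow-const n c)

prodBelow-^ : ∀ n c f → prodBelow n (λ i → c ^ f i) ≡ c ^ sumBelow n f
prodBelow-^ zero    c f = refl
prodBelow-^ (suc n) c f = trans (cong (c ^ f n *_) (prodBelow-^ n c f)) (sym (^-distribˡ-+-* c (f n) _))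

^-distribʳ-* : ∀ n a c → (a * c) ^ n ≡ a ^ n * c ^ n
^-distribʳ-* n a c = begin
  (a * c) ^ n                               ≡⟨ prodBelow-const n (a * c) ⟨
  prodBelow n (λ _ → a * c)                 ≡⟨ prodBelow-* n (λ _ → a) (λ _ → c) ⟩
  prodBelow n (λ _ → a) * prodBelow n (λ _ → c) ≡⟨ cong₂ _*_ (prodBelow-const n a) (prodBelow-const n c) ⟩
  a ^ n * c ^ n                             ∎
  where open ≡-Reasoning

sumOver : ℕ → (ℕ → Bool) → (ℕ → ℕ) → ℕ
sumOver n χ f = sumBelow n (λ i → if χ i then f i else 0)

sumOver-compl : ∀ n χ f → sumOver n χ f + sumBelow n (λ i → if χ i then 0 else f i) ≡ sumBelow n f
sumOver-compl zero    χ f = refl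
sumOver-compl (suc n) χ f with χ n
... | true  = trans (+-assoc (f n) _ _) (cong (f n +_) (sumOver-compl n χ f))
... | false = trans (lemma (sumOver n χ f) (f n) _) (cong (f n +_) (sumOver-compl n χ f))
  where
  lemma : ∀ a b c → a + (b + c) ≡ b + (a + c)
  lemma = solve-∀

-- With s members of `χ` below `n` the sum is `s * A` plus `n - s` times `B`; adding `s * B` on both
-- sides avoids the subtraction.
sumBelow-if : ∀ n χ A B → sumBelow n (λ i → if χ i then A else B) + sumOver n χ (λ _ → 1) * B
                        ≡ sumOver n χ (λ _ → 1) * A + n * B
sumBelow-if zero    χ A B = refl
sumBelow-if (suc n) χ A B with χ n
... | true  = trans (lemma A B _ _) (trans (cong ((A + B) +_) (sumBelow-if n χ A B)) (sym (lemma A B _ _)))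
  where
  lemma : ∀ A B X Y → A + X + (B + Y) ≡ A + B + (X + Y)
  lemma = solve-∀
... | false = trans (+-assoc B _ _) (trans (cong (B +_) (sumBelow-if n χ A B)) (lemma B (sumOver n χ (λ _ → 1) * A) _))
  where
  lemma : ∀ B X Y → B + (X + Y) ≡ X + (B + Y)
  lemma = solve-∀

-- Elementary bounds on powers of 1 + 1 / K

^-suc-upper : ∀ K m → m ≤ K → suc K ^ m * (K * K) ≤ K ^ m * (K * K + m * K + m * m)
^-suc-upper K zero    m≤K = ≤-reflexive (lemma K)
  where
  lemma : ∀ K → 1 * (K * K) ≡ 1 * (K * K + 0 * K + 0 * 0)
  lemma = solve-∀
^-suc-upper K (suc m) m<K = begin
  suc K ^ suc m * (K * K)                          ≡⟨ *-assoc (suc K) (suc K ^ m) _ ⟩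
  suc K * (suc K ^ m * (K * K))                    ≤⟨ *-monoʳ-≤ (suc K) (^-suc-upper K m (<⇒≤ m<K)) ⟩
  suc K * (K ^ m * (K * K + m * K + m * m))        ≡⟨ lemma₁ K m (K ^ m) ⟩
  K ^ m * (suc K * (K * K + m * K + m * m))        ≤⟨ *-monoʳ-≤ (K ^ m) lemma₂ ⟩
  K ^ m * (K * (K * K + suc m * K + suc m * suc m)) ≡⟨ lemma₃ K (K ^ m) _ ⟩
  K ^ suc m * (K * K + suc m * K + suc m * suc m)  ∎
  where
  open ≤-Reasoning
  lemma₁ : ∀ K m A → (1 + K) * (A * (K * K + m * K + m * m)) ≡ A * ((1 + K) * (K * K + m * K + m * m))
  lemma₁ = solve-∀
  lemma₃ : ∀ K A B → A * (K * B) ≡ K * A * B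
  lemma₃ = solve-∀
  left : ∀ K m → (1 + K) * (K * K + m * K + m * m)
               ≡ K * K + K * K * K + m * K * K + m * m * K + m * K + m * m
  left = solve-∀
  right : ∀ K m → K * (K * K + (1 + m) * K + (1 + m) * (1 + m))
                ≡ K * K + K * K * K + m * K * K + m * m * K + m * K + m * K + K
  right = solve-∀
  lemma₂ : suc K * (K * K + m * K + m * m) ≤ K * (K * K + suc m * K + suc m * suc m)
  lemma₂ = begin
    suc K * (K * K + m * K + m * m)                                       ≡⟨ left K m ⟩
    -- The only real estimate is `m * m ≤ m * K`; a term `K` is even left over.
    K * K + K * K * K + m * K * K + m * m * K + m * K + m * m             ≤⟨ +-monoʳ-≤ (K * K + K * K * K + m * K * K + m * m * K + m * K) (*-monoʳ-≤ m (<⇒≤ m<K)) ⟩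
    K * K + K * K * K + m * K * K + m * m * K + m * K + m * K             ≤⟨ m≤m+n _ K ⟩
    K * K + K * K * K + m * K * K + m * m * K + m * K + m * K + K         ≡⟨ right K m ⟨
    K * (K * K + suc m * K + suc m * suc m) ∎

^-suc-lower : ∀ K m → K ^ m * (K + m) ≤ suc K ^ m * K
^-suc-lower K zero    = ≤-reflexive (cong (1 *_) (+-identityʳ K))
^-suc-lower K (suc m) = begin
  K ^ suc m * (K + suc m)       ≡⟨ left K m (K ^ m) ⟩
  K ^ m * (K * (K + suc m))     ≤⟨ *-monoʳ-≤ (K ^ m) (≤-trans (m≤m+n _ m) (≤-reflexive (right K m))) ⟩
  K ^ m * (suc K * (K + m))     ≡⟨ swap K m (K ^ m) ⟩
  suc K * (K ^ m * (K + m))     ≤⟨ *-monoʳ-≤ (suc K) (^-suc-lower K m) ⟩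
  suc K * (suc K ^ m * K)       ≡⟨ *-assoc (suc K) (suc K ^ m) K ⟨
  suc K ^ suc m * K             ∎
  where
  open ≤-Reasoning
  left : ∀ K m A → K * A * (K + (1 + m)) ≡ A * (K * (K + (1 + m)))
  left = solve-∀
  right : ∀ K m → K * (K + (1 + m)) + m ≡ (1 + K) * (K + m)
  right = solve-∀
  swap : ∀ K m A → A * ((1 + K) * (K + m)) ≡ (1 + K) * (A * (K + m))
  swap = solve-∀

-- Collects the errors 1 + 1 / M² of at most M² items: each of the three terms in the quadratic
-- bound is at most `X * X`.
^-suc-3 : ∀ X n .{{_ : NonZero X}} → n ≤ X → suc X ^ n ≤ 3 * X ^ n
^-suc-3 X n n≤X = *-cancelʳ-≤ _ _ (X * X) {{m*n≢0 X X}} $ begin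
  suc X ^ n * (X * X)                   ≤⟨ ^-suc-upper X n n≤X ⟩
  X ^ n * (X * X + n * X + n * n)       ≤⟨ *-monoʳ-≤ (X ^ n) (+-mono-≤ (+-monoʳ-≤ (X * X) (*-monoˡ-≤ X n≤X)) (*-mono-≤ n≤X n≤X)) ⟩
  X ^ n * (X * X + X * X + X * X)       ≡⟨ lemma X (X ^ n) ⟩
  3 * X ^ n * (X * X)                   ∎
  where
  open ≤-Reasoning
  lemma : ∀ X A → A * (X * X + X * X + X * X) ≡ 3 * A * (X * X)
  lemma = solve-∀

2*K^K≤ : ∀ K .{{_ : NonZero K}} → 2 * K ^ K ≤ suc K ^ K
2*K^K≤ K = *-cancelʳ-≤ _ _ K (≤-trans (≤-reflexive (lemma K (K ^ K))) (^-suc-lower K K))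
  where
  lemma : ∀ K A → 2 * A * K ≡ A * (K + K)
  lemma = solve-∀

-- s / M is the probability of a residue in χ and s′ / M that of one outside.
-- With x = M v / K ≤ 1 / M, the left side divided by M³ K^(M v) is at most
-- 1 + (s / M) (x + x²) ≤ (1 + 1 / M²) (1 + (s / M) x).
moment : ∀ M V v s s′ → .{{_ : NonZero M}} .{{_ : NonZero V}} → v ≤ V → s + s′ ≡ M →
         let K = M * M * V in
         M * M * (s * suc K ^ (M * v) + s′ * K ^ (M * v))
         ≤ M * (suc (M * M) * (suc K ^ (s * v) * K ^ (s′ * v)))
moment M V v s s′ v≤V s+s′≡M = *-cancelʳ-≤ _ _ (K * K) {{m*n≢0 K K}} $ begin
  M * M * (s * suc K ^ m + s′ * K ^ m) * (K * K)
    ≡⟨ step₁ M s s′ (suc K ^ m) (K ^ m) (K * K) ⟩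
  M * M * (s * (suc K ^ m * (K * K)) + s′ * (K ^ m * (K * K)))
    ≤⟨ *-monoʳ-≤ (M * M) (+-monoˡ-≤ _ (*-monoʳ-≤ s (^-suc-upper K m m≤K))) ⟩
  M * M * (s * (K ^ m * (K * K + m * K + m * m)) + s′ * (K ^ m * (K * K)))
    ≡⟨ step₂ M s s′ (K ^ m) K m ⟩
  M * M * K ^ m * ((s + s′) * (K * K) + s * (m * K + m * m))
    ≡⟨ cong (λ z → M * M * K ^ m * (z * (K * K) + s * (m * K + m * m))) s+s′≡M ⟩
  M * M * K ^ m * (M * (K * K) + s * (m * K + m * m))
    ≡⟨ step₃ M s v K (K ^ m) ⟩
  M * K ^ m * (M * M * (K * K + s * v * K) + M * M * (M * v * (s * v)))
    ≤⟨ *-monoʳ-≤ (M * K ^ m) (+-monoʳ-≤ (M * M * (K * K + s * v * K)) error) ⟩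
  M * K ^ m * (M * M * (K * K + s * v * K) + (K * K + s * v * K))
    ≡⟨ cong (λ z → M * z * (M * M * (K * K + s * v * K) + (K * K + s * v * K))) K^m ⟩
  M * (K ^ (s * v) * K ^ (s′ * v)) * (M * M * (K * K + s * v * K) + (K * K + s * v * K))
    ≡⟨ step₄ M (K ^ (s * v)) (K ^ (s′ * v)) K (s * v) ⟩
  M * (suc (M * M) * (K ^ (s * v) * (K + s * v) * K ^ (s′ * v))) * K
    ≤⟨ *-monoˡ-≤ K (*-monoʳ-≤ M (*-monoʳ-≤ (suc (M * M)) (*-monoˡ-≤ (K ^ (s′ * v)) (^-suc-lower K (s * v))))) ⟩
  M * (suc (M * M) * (suc K ^ (s * v) * K * K ^ (s′ * v))) * K
    ≡⟨ step₅ M (suc K ^ (s * v)) (K ^ (s′ * v)) K ⟩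
  M * (suc (M * M) * (suc K ^ (s * v) * K ^ (s′ * v))) * (K * K) ∎
  where
  open ≤-Reasoning
  K m : ℕ
  K = M * M * V
  m = M * v
  instance
    K≢0 : NonZero K
    K≢0 = m*n≢0 (M * M) V {{m*n≢0 M M}}
  m≤K : m ≤ K
  m≤K = *-mono-≤ (m≤m*n M M) v≤V
  s≤M : s ≤ M
  s≤M = subst (s ≤_) s+s′≡M (m≤m+n s s′)
  K^m : K ^ m ≡ K ^ (s * v) * K ^ (s′ * v)
  K^m = trans (cong (K ^_) (trans (cong (_* v) (sym s+s′≡M)) (*-distribʳ-+ v s s′)))
          (^-distribˡ-+-* K (s * v) (s′ * v))
  square : ∀ M V → M * M * (M * V * (M * V)) ≡ M * M * V * (M * M * V)
  square = solve-∀
  error : M * M * (M * v * (s * v)) ≤ K * K + s * v * K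
  error = ≤-trans (*-monoʳ-≤ (M * M) (*-mono-≤ (*-monoʳ-≤ M v≤V) (*-mono-≤ s≤M v≤V)))
    (≤-trans (≤-reflexive (square M V)) (m≤m+n (K * K) _))
  step₁ : ∀ M s s′ A B C → M * M * (s * A + s′ * B) * C ≡ M * M * (s * (A * C) + s′ * (B * C))
  step₁ = solve-∀
  step₂ : ∀ M s s′ B K m → M * M * (s * (B * (K * K + m * K + m * m)) + s′ * (B * (K * K)))
                         ≡ M * M * B * ((s + s′) * (K * K) + s * (m * K + m * m))
  step₂ = solve-∀
  step₃ : ∀ M s v K B → M * M * B * (M * (K * K) + s * (M * v * K + M * v * (M * v)))
                      ≡ M * B * (M * M * (K * K + s * v * K) + M * M * (M * v * (s * v)))
  step₃ = solve-∀
  step₄ : ∀ M A B K y → M * (A * B) * (M * M * (K * K + y * K) + (K * K + y * K))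
                      ≡ M * ((1 + M * M) * (A * (K + y) * B)) * K
  step₄ = solve-∀
  step₅ : ∀ M A B K → M * ((1 + M * M) * (A * K * B)) * K ≡ M * ((1 + M * M) * (A * B)) * (K * K)
  step₅ = solve-∀

-- Exponential moments and Markov's inequality

module _ (N T q M V n k L : ℕ) (v : ℕ → ℕ) .{{_ : NonZero M}} .{{_ : NonZero V}}
         (N≡q*M : N ≡ q * M) (v≤V : ∀ {j} → j < n → v j ≤ V) (n≤M² : n ≤ M * M)
         (tape : n * 10 + k ≤ T) where

  hits : (ℕ → Bool) → Vec (Fin N) T → ℕ
  hits χ ω = sumOver n (λ j → χ (sample (at ω) n k j % M)) v

  private
    K w : ℕ
    K = M * M * V
    w = sumBelow n v

    instance
      M²≢0 : NonZero (M * M)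
      M²≢0 = m*n≢0 M M
      K≢0 : NonZero K
      K≢0 = m*n≢0 (M * M) V

    module _ (χ : ℕ → Bool) where

      -- The moment factor of an item, which is ((K + 1) / K)^(M v) for a hit and 1 for a miss,
      -- multiplied by K^(M v) to stay within the naturals.
      potential : ℕ → ℕ → ℕ
      potential j x = if χ (x % M) then suc K ^ (M * v j) else K ^ (M * v j)

      misses : Vec (Fin N) T → ℕ
      misses ω = sumBelow n (λ j → if χ (sample (at ω) n k j % M) then 0 else v j)

      potential-prod : ∀ ω → prodBelow n (λ j → M * M * potential j (sample (at ω) n k j))
                           ≡ (M * M) ^ n * (suc K ^ (M * hits χ ω) * K ^ (M * misses ω))
      potential-prod ω = begin
        prodBelow n (λ j → M * M * potential j (r j))
          ≡⟨ prodBelow-* n (λ _ → M * M) _ ⟩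
        prodBelow n (λ _ → M * M) * prodBelow n (λ j → potential j (r j))
          ≡⟨ cong₂ _*_ (prodBelow-const n (M * M)) (prodBelow-cong n λ {j} _ → split j (χ (r j % M))) ⟩
        (M * M) ^ n * prodBelow n (λ j → suc K ^ (M * hit j) * K ^ (M * miss j))
          ≡⟨ cong ((M * M) ^ n *_) (trans (prodBelow-* n (λ j → suc K ^ (M * hit j)) _)
               (cong₂ _*_ (exponent (suc K) hit) (exponent K miss))) ⟩
        (M * M) ^ n * (suc K ^ (M * hits χ ω) * K ^ (M * misses ω)) ∎
        where
        open ≡-Reasoning
        r hit miss : ℕ → ℕ
        r j = sample (at ω) n k j
        hit j  = if χ (r j % M) then v j else 0
        miss j = if χ (r j % M) then 0 else v j
        split : ∀ j c → (if c then suc K ^ (M * v j) else K ^ (M * v j))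
              ≡ suc K ^ (M * (if c then v j else 0)) * K ^ (M * (if c then 0 else v j))
        split j true  rewrite *-zeroʳ M = sym (*-identityʳ _)
        split j false rewrite *-zeroʳ M = sym (*-identityˡ _)
        exponent : ∀ c f → prodBelow n (λ j → c ^ (M * f j)) ≡ c ^ (M * sumBelow n f)
        exponent c f = trans (prodBelow-^ n c (λ j → M * f j)) (cong (c ^_) (sumBelow-*ˡ n M f))

    module _ (s s′ : ℕ) where

      -- The potential of an item whose weight is split between hits and misses in the mean
      -- proportion `s` to `s′`.
      bound : ℕ → ℕ
      bound j = suc K ^ (s * v j) * K ^ (s′ * v j)

      bound-prod : prodBelow n (λ j → suc (M * M) * bound j) ≡ suc (M * M) ^ n * (suc K ^ (s * w) * K ^ (s′ * w))
      bound-prod = begin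
        prodBelow n (λ j → suc (M * M) * bound j)
          ≡⟨ prodBelow-* n (λ _ → suc (M * M)) bound ⟩
        prodBelow n (λ _ → suc (M * M)) * prodBelow n bound
          ≡⟨ cong₂ _*_ (prodBelow-const n (suc (M * M))) (prodBelow-* n (λ j → suc K ^ (s * v j)) _) ⟩
        suc (M * M) ^ n * (prodBelow n (λ j → suc K ^ (s * v j)) * prodBelow n (λ j → K ^ (s′ * v j)))
          ≡⟨ cong (suc (M * M) ^ n *_) (cong₂ _*_ (exponent (suc K) s) (exponent K s′)) ⟩
        suc (M * M) ^ n * (suc K ^ (s * w) * K ^ (s′ * w)) ∎
        where
        open ≡-Reasoning
        exponent : ∀ c s → prodBelow n (λ j → c ^ (s * v j)) ≡ c ^ (s * w)
        exponent c s = trans (prodBelow-^ n c (λ j → s * v j)) (cong (c ^_) (sumBelow-*ˡ n s v))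

      -- `e` and `f` stand for `M` times the hit and the missed weight, whose sum is fixed. An
      -- excess of more than `K * L` moves at least that many factors from base `K` to base `suc K`,
      -- and ((K + 1) / K)^(K L) is at least 2^L.
      markov : ∀ e f → e + f ≡ s * w + s′ * w →
               2 ^ L * (suc K ^ (s * w) * K ^ (s′ * w)) * ⟦ lt ⟧ (s * w + K * L) e ≤ suc K ^ e * K ^ f
      markov e f e+f with s * w + K * L <ᵇ e in lt
      ... | false = ≤-trans (≤-reflexive (*-zeroʳ (2 ^ L * (suc K ^ (s * w) * K ^ (s′ * w))))) z≤n
      ... | true with r , refl ← m≤n⇒∃[o]m+o≡n (<⇒≤ (<ᵇ⇒< _ e (subst Bool.T (sym lt) tt))) = begin
        2 ^ L * (suc K ^ (s * w) * K ^ (s′ * w)) * 1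
          ≡⟨ cong (λ z → 2 ^ L * (suc K ^ (s * w) * K ^ z) * 1) s′w ⟩
        2 ^ L * (suc K ^ (s * w) * K ^ (K * L + r + f)) * 1
          ≡⟨ cong (λ z → 2 ^ L * (suc K ^ (s * w) * z) * 1) (split K) ⟩
        2 ^ L * (suc K ^ (s * w) * ((K ^ K) ^ L * K ^ r * K ^ f)) * 1
          ≡⟨ rearrange (2 ^ L) (suc K ^ (s * w)) ((K ^ K) ^ L) (K ^ r) (K ^ f) ⟩
        suc K ^ (s * w) * (2 ^ L * (K ^ K) ^ L * K ^ r) * K ^ f
          ≡⟨ cong (λ z → suc K ^ (s * w) * (z * K ^ r) * K ^ f) (^-distribʳ-* L 2 (K ^ K)) ⟨
        suc K ^ (s * w) * ((2 * K ^ K) ^ L * K ^ r) * K ^ f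
          ≤⟨ *-monoˡ-≤ (K ^ f) (*-monoʳ-≤ (suc K ^ (s * w)) (*-mono-≤ (^-monoˡ-≤ L (2*K^K≤ K)) (^-monoˡ-≤ r (n≤1+n K)))) ⟩
        suc K ^ (s * w) * ((suc K ^ K) ^ L * suc K ^ r) * K ^ f
          ≡⟨ cong (λ z → suc K ^ (s * w) * (z * suc K ^ r) * K ^ f) (^-*-assoc (suc K) K L) ⟩
        suc K ^ (s * w) * (suc K ^ (K * L) * suc K ^ r) * K ^ f
          ≡⟨ cong (_* K ^ f) (*-assoc (suc K ^ (s * w)) _ _) ⟨
        suc K ^ (s * w) * suc K ^ (K * L) * suc K ^ r * K ^ f
          ≡⟨ cong (_* K ^ f) (trans (^-distribˡ-+-* (suc K) (s * w + K * L) r) (cong (_* suc K ^ r) (^-distribˡ-+-* (suc K) (s * w) (K * L)))) ⟨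
        suc K ^ (s * w + K * L + r) * K ^ f ∎
        where
        open ≤-Reasoning
        rearrange : ∀ a b c d e → a * (b * (c * d * e)) * 1 ≡ b * (a * c * d) * e
        rearrange = solve-∀
        assoc : ∀ a b c d → a + b + c + d ≡ a + (b + c + d)
        assoc = solve-∀
        s′w : s′ * w ≡ K * L + r + f
        s′w = +-cancelˡ-≡ (s * w) _ _ (trans (sym e+f) (assoc (s * w) (K * L) r f))
        split : ∀ c → c ^ (K * L + r + f) ≡ (c ^ K) ^ L * c ^ r * c ^ f
        split c = trans (^-distribˡ-+-* c (K * L + r) f) (cong (_* c ^ f)
          (trans (^-distribˡ-+-* c (K * L) r) (cong (_* c ^ r) (sym (^-*-assoc c K L)))))

    module _ (χ : ℕ → Bool) (s s′ : ℕ) (count : sumOver M χ (λ _ → 1) ≡ s) (s+s′≡M : s + s′ ≡ M) where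

      potential-sum : ∀ {j} → j < n → sumBelow N (λ x → M * M * potential χ j x) ≤ N * (suc (M * M) * bound s s′ j)
      potential-sum {j} j<n = begin
        sumBelow N (λ x → M * M * potential χ j x)      ≡⟨ sumBelow-*ˡ N (M * M) (potential χ j) ⟩
        M * M * sumBelow N (potential χ j)              ≡⟨ cong (λ z → M * M * sumBelow z (potential χ j)) N≡q*M ⟩
        M * M * sumBelow (q * M) (potential χ j)        ≡⟨ cong (M * M *_) (sumBelow-rem M q (λ r → if χ r then A else B)) ⟩
        M * M * (q * sumBelow M (λ r → if χ r then A else B)) ≡⟨ cong (λ z → M * M * (q * z)) residues ⟩
        M * M * (q * (s * A + s′ * B))                ≡⟨ swap (M * M) q _ ⟩
        q * (M * M * (s * A + s′ * B))                ≤⟨ *-monoʳ-≤ q (moment M V (v j) s s′ (v≤V j<n) s+s′≡M) ⟩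
        q * (M * (suc (M * M) * bound s s′ j))             ≡⟨ *-assoc q M _ ⟨
        q * M * (suc (M * M) * bound s s′ j)               ≡⟨ cong (_* (suc (M * M) * bound s s′ j)) N≡q*M ⟨
        N * (suc (M * M) * bound s s′ j)                   ∎
        where
        open ≤-Reasoning
        A B : ℕ
        A = suc K ^ (M * v j)
        B = K ^ (M * v j)
        swap : ∀ a b c → a * (b * c) ≡ b * (a * c)
        swap = solve-∀
        expand : ∀ s s′ A B → s * A + (s + s′) * B ≡ s * A + s′ * B + s * B
        expand = solve-∀
        residues : sumBelow M (λ r → if χ r then A else B) ≡ s * A + s′ * B
        residues = +-cancelʳ-≡ (s * B) _ _ (trans
          (subst (λ z → sumBelow M (λ r → if χ r then A else B) + z * B ≡ z * A + M * B) count (sumBelow-if M χ A B))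
          (trans (cong (λ z → s * A + z * B) (sym s+s′≡M)) (expand s s′ A B)))

      total : ∀ ω → M * hits χ ω + M * misses χ ω ≡ s * w + s′ * w
      total ω = begin
        M * hits χ ω + M * misses χ ω ≡⟨ *-distribˡ-+ M (hits χ ω) _ ⟨
        M * (hits χ ω + misses χ ω)   ≡⟨ cong (M *_) (sumOver-compl n _ v) ⟩
        M * w                       ≡⟨ cong (_* w) s+s′≡M ⟨
        (s + s′) * w                ≡⟨ *-distribʳ-+ w s s′ ⟩
        s * w + s′ * w              ∎
        where open ≡-Reasoning

  -- Compare with the potential `Y` of the mean split: the average potential exceeds it by a factor
  -- of at most 3, the potential of a bad tape by a factor of at least `2 ^ L`. The powers of
  -- `M * M` only clear the denominators of 1 + 1 / M².
  tail-bound : ∀ χ s s′ → sumOver M χ (λ _ → 1) ≡ s → s + s′ ≡ M →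
    2 ^ L * ∑ (vectors (allFin N) T) (λ ω → ⟦ lt ⟧ (s * w + K * L) (M * hits χ ω)) ≤ 3 * N ^ T
  tail-bound χ s s′ count s+s′≡M = *-cancelˡ-≤ ((M * M) ^ n * Y) {{m*n≢0 _ Y {{m^n≢0 (M * M) n}}}} $ begin
    (M * M) ^ n * Y * (2 ^ L * ∑ tapes bad)
      ≡⟨ rearrange₁ ((M * M) ^ n) Y (2 ^ L) (∑ tapes bad) ⟩
    (M * M) ^ n * (2 ^ L * Y * ∑ tapes bad)
      ≡⟨ cong ((M * M) ^ n *_) (∑-*ˡ tapes (2 ^ L * Y) bad) ⟨
    (M * M) ^ n * ∑ tapes (λ ω → 2 ^ L * Y * bad ω)
      ≤⟨ *-monoʳ-≤ ((M * M) ^ n) (∑-mono tapes λ ω →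
           markov s s′ (M * hits χ ω) (M * m ω) (total χ s s′ count s+s′≡M ω)) ⟩
    (M * M) ^ n * ∑ tapes (λ ω → suc K ^ (M * hits χ ω) * K ^ (M * m ω))
      ≡⟨ ∑-*ˡ tapes ((M * M) ^ n) _ ⟨
    ∑ tapes (λ ω → (M * M) ^ n * (suc K ^ (M * hits χ ω) * K ^ (M * m ω)))
      ≡⟨ ∑-cong tapes (potential-prod χ) ⟨
    ∑ tapes (λ ω → prodBelow n (λ j → M * M * potential χ j (sample (at ω) n k j)))
      ≤⟨ independent N T n k (λ j x → M * M * potential χ j x) _ tape (potential-sum χ s s′ count s+s′≡M) ⟩
    N ^ T * prodBelow n (λ j → suc (M * M) * bound s s′ j)
      ≡⟨ cong (N ^ T *_) (bound-prod s s′) ⟩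
    N ^ T * (suc (M * M) ^ n * Y)
      ≤⟨ *-monoʳ-≤ (N ^ T) (*-monoˡ-≤ Y (^-suc-3 (M * M) n n≤M²)) ⟩
    N ^ T * (3 * (M * M) ^ n * Y)
      ≡⟨ rearrange₂ (N ^ T) ((M * M) ^ n) Y ⟩
    (M * M) ^ n * Y * (3 * N ^ T) ∎
    where
    open ≤-Reasoning
    tapes = vectors (allFin N) T
    bad : Vec (Fin N) T → ℕ
    bad ω = ⟦ lt ⟧ (s * w + K * L) (M * hits χ ω)
    m : Vec (Fin N) T → ℕ
    m = misses χ
    Y : ℕ
    Y = suc K ^ (s * w) * K ^ (s′ * w)
    instance
      Y≢0 : NonZero Y
      Y≢0 = m*n≢0 _ _ {{m^n≢0 (suc K) (s * w)}} {{m^n≢0 K (s′ * w)}}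
    rearrange₁ : ∀ a b c d → a * b * (c * d) ≡ a * (c * b * d)
    rearrange₁ = solve-∀
    rearrange₂ : ∀ a b c → a * (3 * b * c) ≡ b * c * (3 * a)
    rearrange₂ = solve-∀

-- The program

-- The registers r0, …, rF hold 0, 1, n, W and the bases P, B, F: item i has its
-- weight in cell 1 + (i + 1), its profit in P + (i + 1) and its random word in
-- B + (i + 1); entry j of the table is in F + j.
pattern r0   = zero
pattern r1   = suc r0
rN rW rP rB rF rS rV rM rD rI rA rX rY rT rG rL rC rK rWt rPr : Fin 22
rN  = # 2
rW  = # 3
rP  = # 4
rB  = # 5
rF  = # 6
rS  = # 7
rV  = # 8
rM  = # 9
rD  = # 10
rI  = # 11
rA  = # 12
rX  = # 13
rY  = # 14
rT  = # 15
rG  = # 16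
rL  = # 17
rC  = # 18
rK  = # 19
rWt = # 20
rPr = # 21

passBody itemBody bucketBody drawBody sizeBody scanBody : Program 22

-- Maxima are computed as y + (x ∸ y), so that no branching is needed.
passBody =
  arith sub rK rK r1 ∷ arith add rA rL rK ∷ arith add rX rF rA ∷ load rX rX ∷
  arith add rX rX rPr ∷ arith add rA rA rWt ∷ arith add rA rF rA ∷ load rY rA ∷
  arith sub rX rX rY ∷ arith add rY rY rX ∷ store rA rY ∷ []

itemBody =
  arith add rA rB rI ∷ load rX rA ∷ arith rem rX rX rM ∷
  -- `rX` becomes the distance between the item's bucket and the current one. It is 0 exactly for
  -- the items of this bucket, so the work is in the else branch.
  arith sub rY rX rT ∷ arith sub rX rT rX ∷ arith add rX rY rX ∷
  ifnz rX []
    (arith add rA r1 rI ∷ load rWt rA ∷ arith add rA rP rI ∷ load rPr rA ∷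
     arith sub rK rC r0 ∷ while rK passBody ∷ []) ∷
  arith sub rI rI r1 ∷ []

bucketBody =
  -- The window starts at ⌊t W / M⌋ - D, cut off at 0 by the truncated subtraction, and ends before
  -- ⌊(t + 1) W / M⌋ + D + 1.
  arith mul rL rT rW ∷ arith add rC rL rW ∷ arith div rL rL rM ∷ arith div rC rC rM ∷
  arith add rC rC rD ∷ arith add rC rC r1 ∷ arith sub rL rL rD ∷ arith sub rC rC rL ∷
  arith sub rI rN r0 ∷ while rI itemBody ∷
  arith add rT r1 rT ∷ arith sub rG rG r1 ∷ []

drawBody =
  random rX ∷ arith add rA rB rI ∷ store rA rX ∷
  arith add rA r1 rI ∷ load rX rA ∷ arith add rS rS rX ∷
  arith sub rY rX rV ∷ arith add rV rV rY ∷ arith sub rI rI r1 ∷ []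

sizeBody =
  arith add rM rM rM ∷ arith add rD rL rD ∷ arith mul rX rM rM ∷ arith sub rX rN rX ∷ []

scanBody =
  arith sub rK rK r1 ∷ arith add rA rF rK ∷ load rX rA ∷
  arith sub rX rX rY ∷ arith add rY rY rX ∷ []

-- The window half-width is c wmax (m + 1) M for M = 2^m buckets.
program : ℕ → Program 22
program c =
  set r1 1 ∷ load rN r0 ∷ load rW r1 ∷
  arith add rP rN r1 ∷ arith add rB rP rN ∷ arith add rF rB rP ∷
  arith sub rI rN r0 ∷ while rI drawBody ∷
  -- Caps the capacity by the total weight. Without this neither the windows nor the scan could be
  -- bounded in terms of n and wmax.
  arith sub rX rW rS ∷ arith sub rW rW rX ∷
  set rM 1 ∷ set rL c ∷ arith mul rL rV rL ∷ arith sub rD rL r0 ∷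
  arith mul rX rM rM ∷ arith sub rX rN rX ∷ while rX sizeBody ∷
  arith mul rD rD rM ∷ arith sub rG rM r0 ∷ while rG bucketBody ∷
  -- Stale entries may leave the table non-monotone, and the weight of the optimal solution is
  -- unknown, so all `W + 1` entries are compared.
  arith add rK r1 rW ∷ arith sub rY r0 r0 ∷ while rK scanBody ∷ store r0 rY ∷ []

-- `f` is the table before the item and `g` the table after the sources from `lo + k` upwards have
-- been used. Sources are visited downwards, so by `fresh` the next one still holds its old value;
-- hence the item is used at most once, as `sound` says, although the update is in place.
record Partial (lo cnt w p k : ℕ) (f g : ℕ → ℕ) : Set where
  field
    keeps : ∀ j → f j ≤ g j
    gains : ∀ {s} → lo + k ≤ s → s < lo + cnt → f s + p ≤ g (s + w)
    sound : ∀ j → g j ≤ f j ⊎ ∃[ s ] j ≡ s + w × g j ≤ f s + p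
    fresh : ∀ {j} → j < lo + k + w → g j ≡ f j

Partial-start : ∀ lo cnt w p f → Partial lo cnt w p cnt f f
Partial-start lo cnt w p f = record
  { keeps = λ _ → ≤-refl
  ; gains = λ l≤s s<l → contradiction l≤s (<⇒≱ s<l)
  ; sound = λ _ → inj₁ ≤-refl
  ; fresh = λ _ → refl
  }

relax : ∀ {lo cnt w p k f g g′} → 0 < w → Partial lo cnt w p (suc k) f g →
        g′ (lo + k + w) ≡ g (lo + k + w) + (g (lo + k) + p ∸ g (lo + k + w)) →
        (∀ {j} → j ≢ lo + k + w → g′ j ≡ g j) → Partial lo cnt w p k f g′
relax {lo} {cnt} {w} {p} {k} {f} {g} {g′} 0<w part updated elsewhere = record
  { keeps = λ j → ≤-trans (keeps j) (grows j)
  ; gains = λ {s} l≤s s<l → gain l≤s s<l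
  ; sound = sound′
  ; fresh = λ j< → trans (elsewhere (<⇒≢ j<)) (fresh (<-trans j< (+-monoˡ-< w (≤-reflexive (sym (+-suc lo k))))))
  }
  where
  open Partial part
  src : g (lo + k) ≡ f (lo + k)
  src = fresh (≤-trans (≤-reflexive (sym (+-suc lo k))) (m≤m+n (lo + suc k) w))
  grows : ∀ j → g j ≤ g′ j
  grows j with j ≟ lo + k + w
  ... | yes refl = subst (g j ≤_) (sym updated) (m≤m+n (g j) _)
  ... | no j≢    = ≤-reflexive (sym (elsewhere j≢))
  gain : ∀ {s} → lo + k ≤ s → s < lo + cnt → f s + p ≤ g′ (s + w)
  gain {s} l≤s s<l with m≤n⇒m<n∨m≡n l≤s
  ... | inj₁ l<s = ≤-trans (gains (subst (_≤ s) (sym (+-suc lo k)) l<s) s<l) (grows (s + w))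
  ... | inj₂ refl = subst₂ _≤_ (cong (_+ p) src) (sym updated) (m≤n+m∸n (g (lo + k) + p) (g (lo + k + w)))
  sound′ : ∀ j → g′ j ≤ f j ⊎ ∃[ s ] j ≡ s + w × g′ j ≤ f s + p
  sound′ j with j ≟ lo + k + w
  ... | no j≢ rewrite elsewhere j≢ = sound j
  ... | yes refl with ≤-total (g (lo + k) + p) (g (lo + k + w))
  ...   | inj₁ ≤g rewrite updated | m≤n⇒m∸n≡0 ≤g | +-identityʳ (g (lo + k + w)) = sound j
  ...   | inj₂ g≤ = inj₂ (lo + k , refl , ≤-reflexive (trans updated (trans (m+[n∸m]≡n g≤) (cong (_+ p) src))))

-- One pass of the program over a window

module Execution (b : ℕ) (τ : ℕ → ℕ) (Q : ℕ → Memory → Set) (n : ℕ) where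

  F B P : ℕ
  P = n + 1
  B = P + n
  F = B + P

  file : (W S V M D i a x y t g lo cnt k w p : ℕ) → Vec ℕ 22
  file W S V M D i a x y t g lo cnt k w p =
    0 ∷ 1 ∷ n ∷ W ∷ P ∷ B ∷ F ∷ S ∷ V ∷ M ∷ D ∷ i ∷ a ∷ x ∷ y ∷ t ∷ g ∷ lo ∷ cnt ∷ k ∷ w ∷ p ∷ []

  dp : Memory → ℕ → ℕ
  dp μ j = μ (F + j)

  Frame : Memory → Memory → Set
  Frame μ μ′ = ∀ {a} → a < F → μ′ a ≡ μ a

  -- A round takes 12 steps including its test, and the `suc` in the clock is the failing test at
  -- the end.
  pass : ∀ c {k₀ E W S V M D i a x y t g lo cnt w p μ μ₀ f rest} →
    0 < w → F + (lo + cnt + w) < 2 ^ b → (∀ s j → f s + p < 2 ^ b × f j < 2 ^ b) → c ≤ cnt →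
    Frame μ₀ μ → Partial lo cnt w p c f (dp μ) → suc (c * 12 + k₀) ≤ E →
    (∀ {k′ a x y μ′} → k′ ≤ E → Frame μ₀ μ′ → Partial lo cnt w p 0 f (dp μ′) →
      Run b τ Q k′ ⟨ rest , file W S V M D i a x y t g lo cnt 0 w p , μ′ ⟩) →
    Run b τ Q k₀ ⟨ while rK passBody ∷ rest , file W S V M D i a x y t g lo cnt c w p , μ ⟩
  pass zero 0<w addr val c≤ frame part clock next = while⁰ refl ▹ next clock frame part
  pass (suc c) {k₀} {E} {W} {S} {V} {M} {D} {i} {t = t} {g} {lo} {cnt} {w} {p} {μ} {μ₀} {f} {rest} 0<w addr val c≤ frame part clock next =
    while⁺ refl ▹ shrink (m∸n≤m (suc c) 1) ▹ arith lo+c< ▹ arith F+lo+c< ▹ load ▹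
    arith (subst (λ z → z + p < 2 ^ b) (sym src) (proj₁ (val (lo + c) 0))) ▹
    arith lo+c+w< ▹ arith F+lo+c+w< ▹ load ▹ shrink (m∸n≤m _ (dp μ (lo + c + w))) ▹ arith max< ▹ store ▹
    again
    where
    shift : ∀ m k → 12 + m + k ≡ m + (12 + k)
    shift = solve-∀
    gain new : ℕ
    gain = dp μ (lo + c) + p ∸ dp μ (lo + c + w)
    new  = dp μ (lo + c + w) + gain
    lo+c+w≤ : lo + c + w ≤ lo + cnt + w
    lo+c+w≤ = +-monoˡ-≤ w (+-monoʳ-≤ lo (<⇒≤ c≤))
    F+lo+c+w< : F + (lo + c + w) < 2 ^ b
    F+lo+c+w< = ≤-<-trans (+-monoʳ-≤ F lo+c+w≤) addr
    lo+c+w< : lo + c + w < 2 ^ b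
    lo+c+w< = ≤-<-trans (m≤n+m _ F) F+lo+c+w<
    lo+c< : lo + c < 2 ^ b
    lo+c< = ≤-<-trans (m≤m+n _ w) lo+c+w<
    F+lo+c< : F + (lo + c) < 2 ^ b
    F+lo+c< = ≤-<-trans (+-monoʳ-≤ F (m≤m+n (lo + c) w)) F+lo+c+w<
    src : dp μ (lo + c) ≡ f (lo + c)
    src = Partial.fresh part (≤-trans (≤-reflexive (sym (+-suc lo c))) (m≤m+n (lo + suc c) w))
    -- The new entry is either a sum `f s + p` or the present entry, which `sound` traces back to
    -- `f`. Bounds on the table before the pass thus suffice for the whole pass.
    max< : new < 2 ^ b
    max< with ≤-total (dp μ (lo + c) + p) (dp μ (lo + c + w))
    ... | inj₂ g≤ = subst (_< 2 ^ b) (sym (trans (m+[n∸m]≡n g≤) (cong (_+ p) src))) (proj₁ (val (lo + c) 0))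
    ... | inj₁ ≤g = subst (_< 2 ^ b) (sym (trans (cong (dp μ (lo + c + w) +_) (m≤n⇒m∸n≡0 ≤g)) (+-identityʳ _)))
      (old (Partial.sound part (lo + c + w)))
      where
      old : dp μ (lo + c + w) ≤ f (lo + c + w) ⊎ ∃[ s ] lo + c + w ≡ s + w × dp μ (lo + c + w) ≤ f s + p → dp μ (lo + c + w) < 2 ^ b
      old (inj₁ ≤f)           = ≤-<-trans ≤f (proj₂ (val 0 _))
      old (inj₂ (s , _ , ≤f)) = ≤-<-trans ≤f (proj₁ (val s 0))
    frame′ : Frame μ₀ (μ [ F + (lo + c + w) ↦ new ])
    frame′ a<F = trans (↦-other μ (<⇒≢ (≤-trans a<F (m≤m+n F _)))) (frame a<F)
    again : Run b τ Q (12 + k₀) ⟨ while rK passBody ∷ rest , file W S V M D i (F + (lo + c + w)) gain new t g lo cnt c w p ,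
                                  μ [ F + (lo + c + w) ↦ new ] ⟩
    again = pass c 0<w addr val (<⇒≤ c≤) frame′
      (relax 0<w part (↦-same μ (F + (lo + c + w)))
        (λ j≢ → ↦-other μ (j≢ ∘ +-cancelˡ-≡ F _ _)))
      (subst (_≤ E) (cong suc (shift (c * 12) k₀)) clock) next

-- Dynamic programming invariants

sumOver-cong : ∀ n {σ σ′} f → (∀ {i} → i < n → σ i ≡ σ′ i) → sumOver n σ f ≡ sumOver n σ′ f
sumOver-cong n f σ≗σ′ = sumBelow-cong n λ {i} i<n → cong (λ z → if z then f i else 0) (σ≗σ′ i<n)

sumOver-mono : ∀ n {σ σ′} f → (∀ {i} → i < n → σ i ≡ true → σ′ i ≡ true) → sumOver n σ f ≤ sumOver n σ′ f
sumOver-mono n {σ} {σ′} f σ⊆σ′ = sumBelow-mono n λ {i} i<n → go i (σ⊆σ′ i<n)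
  where
  go : ∀ i → (σ i ≡ true → σ′ i ≡ true) → (if σ i then f i else 0) ≤ (if σ′ i then f i else 0)
  go i σᵢ⇒σ′ᵢ with σ i
  ... | false = z≤n
  ... | true rewrite σᵢ⇒σ′ᵢ refl = ≤-refl

sumOver-all : ∀ n {σ} f → (∀ {i} → i < n → σ i ≡ true) → sumOver n σ f ≡ sumBelow n f
sumOver-all n f σ≡⊤ = sumBelow-cong n λ {i} i<n → cong (λ z → if z then f i else 0) (σ≡⊤ i<n)

sumOver-none : ∀ n {σ} f → (∀ {i} → i < n → σ i ≡ false) → sumOver n σ f ≡ 0
sumOver-none n f σ≡⊥ = trans (sumOver-cong n f σ≡⊥) (trans (sumBelow-const n 0) (*-zeroʳ n))

sumOver-≤ : ∀ n σ f → sumOver n σ f ≤ sumBelow n f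
sumOver-≤ n σ f = subst (sumOver n σ f ≤_) (sumOver-all n {λ _ → true} f (λ _ → refl)) (sumOver-mono n f λ _ _ → refl)

record Insert (σ σ′ : ℕ → Bool) (i : ℕ) : Set where
  field
    absent  : σ i ≡ false
    present : σ′ i ≡ true
    others  : ∀ {j} → j ≢ i → σ′ j ≡ σ j

sumOver-insert : ∀ n {σ σ′ i} f → Insert σ σ′ i → i < n → sumOver n σ′ f ≡ f i + sumOver n σ f
sumOver-insert (suc n) {σ} {σ′} {i} f ins i≤n with m≤n⇒m<n∨m≡n (s≤s⁻¹ i≤n)
... | inj₂ refl rewrite Insert.present ins | Insert.absent ins =
  cong (f n +_) (sumOver-cong n f (Insert.others ins ∘ <⇒≢))
... | inj₁ i<n rewrite Insert.others ins (≢-sym (<⇒≢ i<n)) | sumOver-insert n f ins i<n =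
  shift (if σ n then f n else 0) (f i) (sumOver n σ f)
  where
  shift : ∀ a c d → a + (c + d) ≡ c + (a + d)
  shift = solve-∀

≤-sumBelow : ∀ n f {i} → i < n → f i ≤ sumBelow n f
≤-sumBelow (suc n) f i≤n with m≤n⇒m<n∨m≡n (s≤s⁻¹ i≤n)
... | inj₁ i<n  = ≤-trans (≤-sumBelow n f i<n) (m≤n+m _ (f n))
... | inj₂ refl = m≤m+n (f n) _

module _ (n : ℕ) (wt pr : ℕ → ℕ) where

  -- Required of all entries and on all tapes, also outside the windows. It excludes answers above
  -- the optimum and bounds the entries, so that adding a profit never overflows.
  Sound : (ℕ → Bool) → (ℕ → ℕ) → Set
  Sound U f = ∀ j → ∃[ σ ] (∀ {i} → i < n → σ i ≡ true → U i ≡ true)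
                         × sumOver n σ wt ≤ j × f j ≤ sumOver n σ pr

  -- Controls a single entry, the one at the exact weight of the processed part of the fixed
  -- solution `σ`. A window only has to contain that weight.
  Complete : (ℕ → Bool) → (ℕ → Bool) → (ℕ → ℕ) → Set
  Complete σ U f = sumOver n (λ i → σ i ∧ U i) pr ≤ f (sumOver n (λ i → σ i ∧ U i) wt)

  Sound-≤ : ∀ {U f} → Sound U f → ∀ j → f j ≤ sumBelow n pr
  Sound-≤ snd j with σ , _ , _ , f≤ ← snd j = ≤-trans f≤ (sumOver-≤ n σ pr)

  Sound-insert : ∀ {U U′ i f g lo cnt} → Insert U U′ i → i < n →
                 Partial lo cnt (wt i) (pr i) 0 f g → Sound U f → Sound U′ g
  Sound-insert {U} {U′} {i} {f} {g} ins i<n part snd j with Partial.sound part j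
  ... | inj₁ g≤f with σ , σ⊆U , w≤ , f≤ ← snd j = σ , (λ k<n → U⊆U′ ∘ σ⊆U k<n) , w≤ , ≤-trans g≤f f≤
    where
    U⊆U′ : ∀ {k} → U k ≡ true → U′ k ≡ true
    U⊆U′ {k} Uk with k ≟ i
    ... | yes refl = Insert.present ins
    ... | no k≢i   = trans (Insert.others ins k≢i) Uk
  ... | inj₂ (s , refl , g≤) with σ , σ⊆U , w≤ , f≤ ← snd s =
    σ′ , σ′⊆U′ ,
    subst (_≤ s + wt i) (sym (sumOver-insert n wt σ-ins i<n)) (≤-trans (+-monoʳ-≤ (wt i) w≤) (≤-reflexive (+-comm (wt i) s))) ,
    subst (g (s + wt i) ≤_) (sym (sumOver-insert n pr σ-ins i<n)) (≤-trans g≤ (≤-trans (≤-reflexive (+-comm (f s) (pr i))) (+-monoʳ-≤ (pr i) f≤)))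
    where
    σ′ : ℕ → Bool
    σ′ k with k ≟ i
    ... | yes _ = true
    ... | no  _ = σ k
    σ-ins : Insert σ σ′ i
    σ-ins .Insert.absent with σ i in σi
    ... | false = refl
    ... | true  = trans (sym (σ⊆U i<n σi)) (Insert.absent ins)
    σ-ins .Insert.present with i ≟ i
    ... | yes _ = refl
    ... | no i≢i = contradiction refl i≢i
    σ-ins .Insert.others {k} k≢i with k ≟ i
    ... | yes k≡i = contradiction k≡i k≢i
    ... | no _    = refl
    σ′⊆U′ : ∀ {k} → k < n → σ′ k ≡ true → U′ k ≡ true
    σ′⊆U′ {k} k<n σ′k with k ≟ i
    ... | yes refl = Insert.present ins
    ... | no k≢i   = trans (Insert.others ins k≢i) (σ⊆U k<n σ′k)

  -- If `i` belongs to `σ`, the source `A` lies in the window and `gains` carries the tracked entry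
  -- to `A + wt i`. Otherwise the tracked weight does not move and `keeps` suffices.
  Complete-insert : ∀ {σ U U′ i f g lo cnt} → Insert U U′ i → i < n → Partial lo cnt (wt i) (pr i) 0 f g →
                    let A = sumOver n (λ j → σ j ∧ U j) wt in lo ≤ A → A < lo + cnt →
                    Complete σ U f → Complete σ U′ g
  Complete-insert {σ} {U} {U′} {i} {f} {g} {lo} ins i<n part lo≤A A<hi cmp with σ i in σi
  ... | true = subst₂ _≤_ (sym (sumOver-insert n pr ins∧ i<n)) (cong g (trans (+-comm _ (wt i)) (sym (sumOver-insert n wt ins∧ i<n))))
      (≤-trans (≤-reflexive (+-comm (pr i) _)) (≤-trans (+-monoˡ-≤ (pr i) cmp)
        (Partial.gains part (subst (_≤ _) (sym (+-identityʳ lo)) lo≤A) A<hi)))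
    where
    ins∧ : Insert (λ j → σ j ∧ U j) (λ j → σ j ∧ U′ j) i
    ins∧ .Insert.absent rewrite Insert.absent ins = ∧-zeroʳ (σ i)
    ins∧ .Insert.present rewrite σi = Insert.present ins
    ins∧ .Insert.others {j} j≢i = cong (σ j ∧_) (Insert.others ins j≢i)
  ... | false = subst₂ _≤_ (same pr) (cong g (same wt)) (≤-trans cmp (Partial.keeps part _))
    where
    same : ∀ h → sumOver n (λ j → σ j ∧ U j) h ≡ sumOver n (λ j → σ j ∧ U′ j) h
    same h = sumOver-cong n h λ {j} _ → pointwise j
      where
      pointwise : ∀ j → σ j ∧ U j ≡ σ j ∧ U′ j
      pointwise j with j ≟ i
      ... | yes refl rewrite σi = refl
      ... | no j≢i   = cong (σ j ∧_) (sym (Insert.others ins j≢i))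

  Sound-cong : ∀ {U U′ f} → (∀ {i} → i < n → U i ≡ U′ i) → Sound U f → Sound U′ f
  Sound-cong U≗U′ snd j with σ , σ⊆U , rest ← snd j = σ , (λ i<n σi → trans (sym (U≗U′ i<n)) (σ⊆U i<n σi)) , rest

  Complete-cong : ∀ {σ U U′ f} → (∀ {i} → i < n → U i ≡ U′ i) → Complete σ U f → Complete σ U′ f
  Complete-cong {σ} {f = f} U≗U′ = subst₂ _≤_ (same pr) (cong f (same wt))
    where
    same : ∀ h → _ ≡ _
    same h = sumOver-cong n h λ {j} j<n → cong (σ j ∧_) (U≗U′ j<n)

-- The items handled when bucket t has been swept down to item i.
processed : (ℕ → ℕ) → (t i : ℕ) → ℕ → Bool
processed bk t i j = (bk j <ᵇ t) ∨ ((bk j ≡ᵇ t) ∧ (i ≤ᵇ j))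

<ᵇ-irrefl : ∀ m → (m <ᵇ m) ≡ false
<ᵇ-irrefl zero    = refl
<ᵇ-irrefl (suc m) = <ᵇ-irrefl m

≡ᵇ-refl : ∀ m → (m ≡ᵇ m) ≡ true
≡ᵇ-refl zero    = refl
≡ᵇ-refl (suc m) = ≡ᵇ-refl m

≡ᵇ-≢ : ∀ {m n} → m ≢ n → (m ≡ᵇ n) ≡ false
≡ᵇ-≢ {m} {n} m≢n with m ≡ᵇ n in eq
... | false = refl
... | true  = contradiction (≡ᵇ⇒≡ m n (subst Bool.T (sym eq) tt)) m≢n

<ᵇ-true : ∀ {m n} → m < n → (m <ᵇ n) ≡ true
<ᵇ-true {m} {n} m<n with m <ᵇ n | <⇒<ᵇ m<n
... | true | _ = refl

<ᵇ-false : ∀ {m n} → n ≤ m → (m <ᵇ n) ≡ false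
<ᵇ-false {m} {n} n≤m with m <ᵇ n in eq
... | false = refl
... | true  = contradiction (<ᵇ⇒< m n (subst Bool.T (sym eq) tt)) (≤⇒≯ n≤m)

<ᵇ-≢ : ∀ {i j} → j ≢ i → (i <ᵇ suc j) ≡ (i <ᵇ j)
<ᵇ-≢ {zero}  {zero}  j≢i = contradiction refl j≢i
<ᵇ-≢ {zero}  {suc j} j≢i = refl
<ᵇ-≢ {suc i} {zero}  j≢i = refl
<ᵇ-≢ {suc i} {suc j} j≢i = <ᵇ-≢ {i} {j} (j≢i ∘ cong suc)

≤ᵇ-≢ : ∀ {i j} → j ≢ i → (i ≤ᵇ j) ≡ (suc i ≤ᵇ j)
≤ᵇ-≢ {zero}  {zero}  j≢i = contradiction refl j≢i
≤ᵇ-≢ {zero}  {suc j} j≢i = refl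
≤ᵇ-≢ {suc i} {j}     j≢i = <ᵇ-≢ {suc i} {j} j≢i

module _ (bk : ℕ → ℕ) where

  processed-insert : ∀ {t i} → bk i ≡ t → Insert (processed bk t (suc i)) (processed bk t i) i
  processed-insert {t} {i} refl = record
    { absent  = trans (cong₂ _∨_ (<ᵇ-irrefl t) (cong ((t ≡ᵇ t) ∧_) (<ᵇ-irrefl i))) (∧-zeroʳ (t ≡ᵇ t))
    ; present = cong₂ _∨_ (<ᵇ-irrefl t) (cong₂ _∧_ (≡ᵇ-refl t) (≤ᵇ-true i))
    ; others  = λ {j} j≢i → cong (λ z → (bk j <ᵇ t) ∨ ((bk j ≡ᵇ t) ∧ z)) (≤ᵇ-≢ j≢i)
    }
    where
    ≤ᵇ-true : ∀ i → (i ≤ᵇ i) ≡ true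
    ≤ᵇ-true zero    = refl
    ≤ᵇ-true (suc i) = <ᵇ-true (n<1+n i)

  processed-skip : ∀ {t i} → bk i ≢ t → ∀ j → processed bk t (suc i) j ≡ processed bk t i j
  processed-skip {t} {i} bk≢t j with j ≟ i
  ... | yes refl rewrite ≡ᵇ-≢ bk≢t = refl
  ... | no j≢i   = cong (λ z → (bk j <ᵇ t) ∨ ((bk j ≡ᵇ t) ∧ z)) (sym (≤ᵇ-≢ j≢i))

  processed-first : ∀ {n t j} → j < n → processed bk t n j ≡ (bk j <ᵇ t)
  processed-first {suc n} {t} {j} j<n rewrite <ᵇ-false {n} {j} (s≤s⁻¹ j<n) | ∧-zeroʳ (bk j ≡ᵇ t) = ∨-identityʳ _

  processed-last : ∀ t j → processed bk t 0 j ≡ (bk j <ᵇ suc t)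
  processed-last t j rewrite ∧-identityʳ (bk j ≡ᵇ t) = go (bk j) t
    where
    go : ∀ m t → (m <ᵇ t) ∨ (m ≡ᵇ t) ≡ (m <ᵇ suc t)
    go zero    zero    = refl
    go zero    (suc t) = refl
    go (suc m) zero    = refl
    go (suc m) (suc t) = go m t

  processed-lower : ∀ {t i j} → (bk j <ᵇ t) ≡ true → processed bk t i j ≡ true
  processed-lower bk<t rewrite bk<t = refl

  processed-upper : ∀ {t i j} → processed bk t i j ≡ true → (bk j <ᵇ suc t) ≡ true
  processed-upper {t} {i} {j} eq = trans (sym (processed-last t j)) (go (bk j <ᵇ t) (bk j ≡ᵇ t) (i ≤ᵇ j) eq)
    where
    go : ∀ a c d → a ∨ (c ∧ d) ≡ true → a ∨ (c ∧ true) ≡ true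
    go true  c    d eq = refl
    go false true d eq = refl

div-≤ : ∀ x y → ⟦ div ⟧ x y ≤ x
div-≤ x zero    = z≤n
div-≤ x (suc y) = m/n≤m x (suc y)

rem-≤ : ∀ x y → ⟦ rem ⟧ x y ≤ x
rem-≤ x zero    = z≤n
rem-≤ x (suc y) = m%n≤m x (suc y)

rem-< : ∀ x {t y} → t < y → ⟦ rem ⟧ x y < y
rem-< x {y = suc y} _ = m%n<n x (suc y)

dist-zero : ∀ {x t} → x ≡ t → (x ∸ t) + (t ∸ x) ≡ 0
dist-zero {x} refl rewrite n∸n≡0 x = refl

dist-suc : ∀ {x t} → x ≢ t → ∃[ j ] (x ∸ t) + (t ∸ x) ≡ suc j
dist-suc {x} {t} x≢t with (x ∸ t) + (t ∸ x) in eq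
... | suc j = j , refl
... | zero  = contradiction (≤-antisym (m∸n≡0⇒m≤n (m+n≡0⇒m≡0 (x ∸ t) eq)) (m∸n≡0⇒m≤n (m+n≡0⇒n≡0 (x ∸ t) eq))) x≢t

dist-< : ∀ {x t m} → x < m → t < m → (x ∸ t) + (t ∸ x) < m
dist-< {x} {t} {m} x<m t<m with ≤-total x t
... | inj₁ x≤t rewrite m≤n⇒m∸n≡0 x≤t = ≤-<-trans (m∸n≤m t x) t<m
... | inj₂ t≤x rewrite m≤n⇒m∸n≡0 t≤x = subst (_< m) (sym (+-identityʳ _)) (≤-<-trans (m∸n≤m x t) x<m)

-- The sweep over all items of all buckets

module Sweep (b : ℕ) (τ : ℕ → ℕ) (Q : ℕ → Memory → Set) (n W S V M D : ℕ) (μ₀ : Memory)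
             (wt pr bk : ℕ → ℕ) (σ : ℕ → Bool) (Good : Set) (C E : ℕ) where

  open Execution b τ Q n

  lo hi cnt : ℕ → ℕ
  lo t  = ⟦ div ⟧ (t * W) M ∸ D
  hi t  = ⟦ div ⟧ (t * W + W) M + D + 1
  cnt t = hi t ∸ lo t

  captured : ℕ → ℕ → ℕ
  captured t i = sumOver n (λ j → σ j ∧ processed bk t i j) wt

  cost : ℕ
  cost = C * 12 + 6

  -- `k` is the time used so far plus the fixed cost of the loop rounds still to come. Inspecting an
  -- item is paid in advance for every bucket, whereas a pass over a window is charged to the item
  -- that becomes processed; so there are n passes in total and not n M.
  record Inv (k : ℕ) (U : ℕ → Bool) (μ : Memory) : Set where
    field
      clock    : k ≤ E + sumOver n U (λ _ → 1) * cost
      frame    : Frame μ₀ μ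
      sound    : Sound n wt pr U (dp μ)
      complete : Good → Complete n wt pr σ U (dp μ)

  Inv-cong : ∀ {k k′ U U′ μ} → k′ ≤ k → (∀ {i} → i < n → U i ≡ U′ i) → Inv k U μ → Inv k′ U′ μ
  Inv-cong {μ = μ} k′≤k U≗U′ inv = record
    { clock    = ≤-trans k′≤k (subst (λ z → _ ≤ E + z * cost) (sumOver-cong n (λ _ → 1) U≗U′) clock)
    ; frame    = frame
    ; sound    = Sound-cong n wt pr U≗U′ sound
    ; complete = Complete-cong n wt pr {f = dp μ} U≗U′ ∘ complete
    }
    where open Inv inv

  module _ (wt≡ : ∀ {j} → j < n → μ₀ (suc (suc j)) ≡ wt j) (pr≡ : ∀ {j} → j < n → μ₀ (P + suc j) ≡ pr j)
           (bk≡ : ∀ {j} → j < n → ⟦ rem ⟧ (μ₀ (B + suc j)) M ≡ bk j)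
           (wt>0 : ∀ {j} → j < n → 0 < wt j) (wt≤V : ∀ {j} → j < n → wt j ≤ V)
           (M<2^b : M < 2 ^ b) (fits : F + (M * W + D + 1 + V) < 2 ^ b)
           (profits : sumBelow n pr + sumBelow n pr < 2 ^ b)
           (narrow : ∀ {t} → t < M → cnt t ≤ C)
           (windows : Good → ∀ {t} i → t < M → lo t ≤ captured t i × captured t i < lo t + cnt t) where

    private
      below-F : ∀ {m} → m ≤ F → m < 2 ^ b
      below-F m≤F = ≤-<-trans (≤-trans m≤F (m≤m+n F _)) fits

      hi-≤ : ∀ {t} → t < M → hi t ≤ M * W + D + 1
      hi-≤ {t} t<M = +-monoˡ-≤ 1 (+-monoˡ-≤ D (≤-trans (div-≤ (t * W + W) M)
        (≤-trans (≤-reflexive (+-comm (t * W) W)) (*-monoˡ-≤ W t<M))))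

      lo-≤ : ∀ {t} → t < M → lo t ≤ M * W + D + 1
      lo-≤ {t} t<M = ≤-trans (m∸n≤m _ D) (≤-trans (div-≤ (t * W) M)
        (≤-trans (*-monoˡ-≤ W (<⇒≤ t<M)) (≤-trans (m≤m+n _ D) (m≤m+n _ 1))))

      lo+cnt-≤ : ∀ {t} → t < M → lo t + cnt t ≤ M * W + D + 1
      lo+cnt-≤ {t} t<M with ≤-total (lo t) (hi t)
      ... | inj₁ l≤h = ≤-trans (≤-reflexive (m+[n∸m]≡n l≤h)) (hi-≤ t<M)
      ... | inj₂ h≤l = ≤-trans (≤-reflexive (trans (cong (lo t +_) (m≤n⇒m∸n≡0 h≤l)) (+-identityʳ (lo t)))) (lo-≤ t<M)

      below-window : ∀ {m} → m ≤ M * W + D + 1 → m < 2 ^ b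
      below-window m≤ = ≤-<-trans (≤-trans m≤ (≤-trans (m≤m+n _ V) (m≤n+m _ F))) fits

      module _ {i} (i<n : i < n) where
        B+i<F : B + suc i < F
        B+i<F = +-monoʳ-< B (≤-trans (s≤s i<n) (≤-reflexive (+-comm 1 n)))
        P+i<F : P + suc i < F
        P+i<F = ≤-<-trans (+-monoˡ-≤ (suc i) (m≤m+n P n)) B+i<F
        1+i<F : suc (suc i) < F
        1+i<F = ≤-<-trans (≤-trans (s≤s i<n) (≤-trans (≤-reflexive (+-comm 1 n)) (m≤m+n P (suc i)))) P+i<F

    -- An inspection takes 9 steps, which the clock of the hypothesis already contains, so skipping
    -- an item leaves the clock unchanged. `R` is the time reserved for the code after the loop.
    items : ∀ i {k t g R a x y c w p μ rest} → t < M → i ≤ n →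
      Inv (suc (i * 9 + (k + R))) (processed bk t i) μ →
      (∀ {k′ a x y c w p μ′} → Inv (k′ + R) (processed bk t 0) μ′ →
        Run b τ Q k′ ⟨ rest , file W S V M D 0 a x y t g (lo t) (cnt t) c w p , μ′ ⟩) →
      Run b τ Q k ⟨ while rI itemBody ∷ rest , file W S V M D i a x y t g (lo t) (cnt t) c w p , μ ⟩
    items zero t<M i≤n inv next = while⁰ refl ▹ next inv
    items (suc i) {k} {t} {g} {R} {c = c} {w} {p} {μ} {rest} t<M i<n inv next =
      while⁺ refl ▹ arith (below-F (<⇒≤ (B+i<F i<n))) ▹ load ▹ shrink (rem-≤ _ M) ▹
      shrink (m∸n≤m (⟦ rem ⟧ r M) t) ▹ shrink (m∸n≤m t (⟦ rem ⟧ r M)) ▹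
      arith (<-trans (dist-< (rem-< r t<M) t<M) M<2^b) ▹
      branch
      where
      open Inv inv
      r : ℕ
      r = μ (B + suc i)

      bucket : ⟦ rem ⟧ r M ≡ bk i
      bucket = trans (cong (λ z → ⟦ rem ⟧ z M) (frame (B+i<F i<n))) (bk≡ i<n)

      more : Program 22
      more = arith sub rI rI r1 ∷ while rI itemBody ∷ rest

      skip-time : ∀ i k R → 1 + (i * 9 + (9 + k + R)) ≡ 1 + ((1 + i) * 9 + (k + R))
      skip-time = solve-∀

      skip : ∀ j → bk i ≢ t →
             Run b τ Q (8 + k) ⟨ more , file W S V M D (suc i) (B + suc i) (suc j) (⟦ rem ⟧ r M ∸ t) t g (lo t) (cnt t) c w p , μ ⟩
      skip j bk≢t = shrink (m∸n≤m (suc i) 1) ▹ again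
        where
        again : Run b τ Q (9 + k) ⟨ while rI itemBody ∷ rest ,
                  file W S V M D i (B + suc i) (suc j) (⟦ rem ⟧ r M ∸ t) t g (lo t) (cnt t) c w p , μ ⟩
        again = items i t<M (<⇒≤ i<n)
          (Inv-cong (≤-reflexive (skip-time i k R)) (λ {j} _ → processed-skip bk bk≢t j) inv) next

      take : ∀ {x y} → bk i ≡ t →
             Run b τ Q (13 + k) ⟨ while rK passBody ∷ more ,
               file W S V M D (suc i) (P + suc i) x y t g (lo t) (cnt t) (cnt t) (μ (suc (suc i))) (μ (P + suc i)) , μ ⟩
      take bk≡t = pass (cnt t) {E = E′} {f = dp μ}
        (subst (0 <_) (sym wtᵢ) (wt>0 i<n))
        (subst (λ z → F + (lo t + cnt t + z) < 2 ^ b) (sym wtᵢ)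
          (≤-<-trans (+-monoʳ-≤ F (+-mono-≤ (lo+cnt-≤ t<M) (wt≤V i<n))) fits))
        (λ s j → subst (λ z → dp μ s + z < 2 ^ b) (sym prᵢ)
                   (≤-<-trans (+-mono-≤ (Sound-≤ n wt pr sound s) (≤-sumBelow n pr i<n)) profits)
               , ≤-<-trans (≤-trans (Sound-≤ n wt pr sound j) (m≤m+n _ (sumBelow n pr))) profits)
        ≤-refl frame (Partial-start (lo t) (cnt t) (μ (suc (suc i))) (μ (P + suc i)) (dp μ)) ≤-refl after
        where
        E′ : ℕ
        E′ = suc (cnt t * 12 + (13 + k))
        wtᵢ : μ (suc (suc i)) ≡ wt i
        wtᵢ = trans (frame (1+i<F i<n)) (wt≡ i<n)
        prᵢ : μ (P + suc i) ≡ pr i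
        prᵢ = trans (frame (P+i<F i<n)) (pr≡ i<n)
        ins : Insert (processed bk t (suc i)) (processed bk t i) i
        ins = processed-insert bk bk≡t
        time : ∀ k i c R → 1 + (i * 9 + (2 + (c * 12 + (13 + k)) + R)) ≡ 1 + ((1 + i) * 9 + (k + R)) + (c * 12 + 6)
        time = solve-∀
        time′ : ∀ E s c → E + s * c + c ≡ E + (1 + s) * c
        time′ = solve-∀
        after : ∀ {k′ a x y μ′} → k′ ≤ E′ → Frame μ₀ μ′ →
                Partial (lo t) (cnt t) (μ (suc (suc i))) (μ (P + suc i)) 0 (dp μ) (dp μ′) →
                Run b τ Q k′ ⟨ more , file W S V M D (suc i) a x y t g (lo t) (cnt t) 0 (μ (suc (suc i))) (μ (P + suc i)) , μ′ ⟩
        after {k′} {a} {x} {y} {μ′} k′≤ frame′ part = shrink (m∸n≤m (suc i) 1) ▹ again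
          where
          part′ : Partial (lo t) (cnt t) (wt i) (pr i) 0 (dp μ) (dp μ′)
          part′ = subst₂ (λ w p → Partial (lo t) (cnt t) w p 0 (dp μ) (dp μ′)) wtᵢ prᵢ part
          inv′ : Inv (suc (i * 9 + (suc k′ + R))) (processed bk t i) μ′
          inv′ = record
            { clock    = begin
                suc (i * 9 + (suc k′ + R))                      ≤⟨ s≤s (+-monoʳ-≤ (i * 9) (+-monoˡ-≤ R (s≤s k′≤))) ⟩
                suc (i * 9 + (suc E′ + R))                      ≡⟨ time k i (cnt t) R ⟩
                suc (suc i * 9 + (k + R)) + (cnt t * 12 + 6)    ≤⟨ +-mono-≤ clock (+-monoˡ-≤ 6 (*-monoˡ-≤ 12 (narrow t<M))) ⟩
                E + sumOver n (processed bk t (suc i)) (λ _ → 1) * cost + cost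
                                                                ≡⟨ time′ E (sumOver n (processed bk t (suc i)) (λ _ → 1)) cost ⟩
                E + suc (sumOver n (processed bk t (suc i)) (λ _ → 1)) * cost
                                                                ≡⟨ cong (λ z → E + z * cost) (sumOver-insert n (λ _ → 1) ins i<n) ⟨
                E + sumOver n (processed bk t i) (λ _ → 1) * cost ∎
            ; frame    = frame′
            ; sound    = Sound-insert n wt pr ins i<n part′ sound
            ; complete = λ good → Complete-insert n wt pr ins i<n part′
                (proj₁ (windows good (suc i) t<M)) (proj₂ (windows good (suc i) t<M)) (complete good)
            }
            where open ≤-Reasoning
          again : Run b τ Q (suc k′) ⟨ while rI itemBody ∷ rest ,
                    file W S V M D i a x y t g (lo t) (cnt t) 0 (μ (suc (suc i))) (μ (P + suc i)) , μ′ ⟩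
          again = items i t<M (<⇒≤ i<n) inv′ next

      branch : Run b τ Q (7 + k) ⟨ List.drop 6 itemBody ++ while rI itemBody ∷ rest ,
                 file W S V M D (suc i) (B + suc i) ((⟦ rem ⟧ r M ∸ t) + (t ∸ ⟦ rem ⟧ r M)) (⟦ rem ⟧ r M ∸ t) t g (lo t) (cnt t) c w p , μ ⟩
      branch with bk i ≟ t
      ... | yes bk≡t = ifnz⁰ (dist-zero (trans bucket bk≡t)) ▹
                       arith (below-F (<⇒≤ (1+i<F i<n))) ▹ load ▹ arith (below-F (<⇒≤ (P+i<F i<n))) ▹ load ▹
                       shrink (m∸n≤m (cnt t) 0) ▹ take bk≡t
      ... | no bk≢t with j , eq ← dist-suc {⟦ rem ⟧ r M} {t} (bk≢t ∘ trans (sym bucket)) rewrite eq = ifnz⁺ refl ▹ skip j bk≢t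

    buckets : ∀ g {k t i a x y l h c w p μ rest} → t + g ≡ M →
      Inv (suc (g * (n * 9 + 13) + k)) (processed bk t n) μ →
      (∀ {k′ i a x y l h c w p μ′} → Inv k′ (processed bk M n) μ′ →
        Run b τ Q k′ ⟨ rest , file W S V M D i a x y M 0 l h c w p , μ′ ⟩) →
      Run b τ Q k ⟨ while rG bucketBody ∷ rest , file W S V M D i a x y t g l h c w p , μ ⟩
    buckets zero {k} {t} t+g≡M inv next with refl ← trans (sym (+-identityʳ t)) t+g≡M =
      while⁰ refl ▹ next inv
    buckets (suc g) {k} {t} {i} {a} {x} {y} {l} {h} {c} {w} {p} {μ} {rest} t+g≡M inv next =
      while⁺ refl ▹ arith (below-window tW≤) ▹ arith (below-window tW+W≤) ▹
      shrink (div-≤ (t * W) M) ▹ shrink (div-≤ (t * W + W) M) ▹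
      arith (below-window (≤-trans (m≤m+n _ 1) (hi-≤ t<M))) ▹ arith (below-window (hi-≤ t<M)) ▹
      shrink (m∸n≤m (⟦ div ⟧ (t * W) M) D) ▹ shrink (m∸n≤m (hi t) (lo t)) ▹ shrink (m∸n≤m n 0) ▹ sweep
      where
      t<M : t < M
      t<M = subst (t <_) t+g≡M (m<m+n t z<s)
      tW≤ : t * W ≤ M * W + D + 1
      tW≤ = ≤-trans (*-monoˡ-≤ W (<⇒≤ t<M)) (≤-trans (m≤m+n _ D) (m≤m+n _ 1))
      tW+W≤ : t * W + W ≤ M * W + D + 1
      tW+W≤ = ≤-trans (≤-trans (≤-reflexive (+-comm (t * W) W)) (*-monoˡ-≤ W t<M)) (≤-trans (m≤m+n _ D) (m≤m+n _ 1))
      time : ∀ m g k → 1 + (m + (10 + k + (3 + g * (m + 13)))) ≡ 1 + ((1 + g) * (m + 13) + k)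
      time = solve-∀
      time′ : ∀ A k → 1 + (A + (2 + k)) ≡ k + (3 + A)
      time′ = solve-∀
      after : ∀ {k′ a x y c w p μ′} → Inv (k′ + suc (suc (suc (g * (n * 9 + 13))))) (processed bk t 0) μ′ →
              Run b τ Q k′ ⟨ arith add rT r1 rT ∷ arith sub rG rG r1 ∷ while rG bucketBody ∷ rest ,
                             file W S V M D 0 a x y t (suc g) (lo t) (cnt t) c w p , μ′ ⟩
      after {k′} {a} {x} {y} {c} {w} {p} {μ′} inv′ = arith (≤-<-trans t<M M<2^b) ▹ shrink (m∸n≤m (suc g) 1) ▹ again
        where
        again : Run b τ Q (2 + k′) ⟨ while rG bucketBody ∷ rest , file W S V M D 0 a x y (suc t) g (lo t) (cnt t) c w p , μ′ ⟩
        again = buckets g (trans (sym (+-suc t g)) t+g≡M)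
          (Inv-cong (≤-reflexive (time′ (g * (n * 9 + 13)) k′))
            (λ {j} j<n → trans (processed-last bk t j) (sym (processed-first bk j<n))) inv′) next
      sweep : Run b τ Q (10 + k) ⟨ while rI itemBody ∷ arith add rT r1 rT ∷ arith sub rG rG r1 ∷ while rG bucketBody ∷ rest ,
                                   file W S V M D n a x y t (suc g) (lo t) (cnt t) c w p , μ ⟩
      sweep = items n t<M ≤-refl (Inv-cong (≤-reflexive (time (n * 9) g k)) (λ _ → refl) inv) after

maxBelow : ℕ → (ℕ → ℕ) → ℕ
maxBelow zero    f = 0
maxBelow (suc n) f = f n ⊔ maxBelow n f

≤-maxBelow : ∀ n f {i} → i < n → f i ≤ maxBelow n f
≤-maxBelow (suc n) f i≤n with m≤n⇒m<n∨m≡n (s≤s⁻¹ i≤n)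
... | inj₁ i<n  = ≤-trans (≤-maxBelow n f i<n) (m≤n⊔m (f n) _)
... | inj₂ refl = m≤m⊔n (f n) _

maxBelow-lub : ∀ n f {B} → (∀ {i} → i < n → f i ≤ B) → maxBelow n f ≤ B
maxBelow-lub zero    f f≤B = z≤n
maxBelow-lub (suc n) f f≤B = ⊔-lub (f≤B ≤-refl) (maxBelow-lub n f (f≤B ∘ m<n⇒m<1+n))

+∸≡⊔ : ∀ m n → m + (n ∸ m) ≡ m ⊔ n
+∸≡⊔ zero    n       = refl
+∸≡⊔ (suc m) zero    = cong suc (+-identityʳ m)
+∸≡⊔ (suc m) (suc n) = cong suc (+∸≡⊔ m n)

⊔-lub-< : ∀ {m n o} → m < o → n < o → m ⊔ n < o
⊔-lub-< m<o n<o = ⊔-lub m<o n<o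

-- The loops that draw buckets, choose M and scan the table

module Phases (b : ℕ) (τ : ℕ → ℕ) (Q : ℕ → Memory → Set) (n : ℕ) where

  open Execution b τ Q n

  -- A round takes 10 steps, in agreement with `sample`; its word is read one step after the loop
  -- test, hence `suc k`.
  draw : ∀ i (μ₀ : Memory) {k E W S V a x y μ rest} →
    let wt = λ j → μ₀ (suc (suc j)) in
    F < 2 ^ b → i ≤ n → V < 2 ^ b → S + sumBelow i wt < 2 ^ b → (∀ {a} → a ≤ B → μ a ≡ μ₀ a) → suc (i * 10 + k) ≤ E →
    (∀ {k′ S′ V′ a x y μ′} → k′ ≤ E → S′ ≡ S + sumBelow i wt → V′ ≡ V ⊔ maxBelow i wt →
      (∀ {a} → a ≤ B ⊎ B + i < a → μ′ a ≡ μ a) → (∀ {j} → j < i → μ′ (B + suc j) ≡ sample τ i (suc k) j) →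
      Run b τ Q k′ ⟨ rest , file W S′ V′ 0 0 0 a x y 0 0 0 0 0 0 0 , μ′ ⟩) →
    Run b τ Q k ⟨ while rI drawBody ∷ rest , file W S V 0 0 i a x y 0 0 0 0 0 0 0 , μ ⟩
  draw zero μ₀ {S = S} {V} F< i≤n V< S< same clock next =
    while⁰ refl ▹ next clock (sym (+-identityʳ S)) (sym (⊔-identityʳ V)) (λ _ → refl) (λ ())
  draw (suc i) μ₀ {k} {E} {W} {S} {V} {μ = μ} {rest} F< i<n V< S< same clock next =
    while⁺ refl ▹ random ▹ arith B+i< ▹ store ▹ arith 2+i< ▹ load ▹
    arith (subst (λ z → S + z < 2 ^ b) (sym wtᵢ) S+wt<) ▹ shrink (m∸n≤m (μ₁ (2 + i)) V) ▹
    arith (subst (_< 2 ^ b) (sym (+∸≡⊔ V _)) V⊔wt<) ▹ shrink (m∸n≤m (suc i) 1) ▹ again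
    where
    wt : ℕ → ℕ
    wt j = μ₀ (suc (suc j))
    μ₁ : Memory
    μ₁ = μ [ B + suc i ↦ τ (suc k) ]
    2+i≤B : 2 + i ≤ B
    2+i≤B = ≤-trans (s≤s i<n) (≤-trans (≤-reflexive (+-comm 1 n)) (m≤m+n P n))
    B+i≤F : B + suc i ≤ F
    B+i≤F = +-monoʳ-≤ B (≤-trans i<n (m≤m+n n 1))
    B+i< : B + suc i < 2 ^ b
    B+i< = ≤-<-trans B+i≤F F<
    2+i< : 2 + i < 2 ^ b
    2+i< = ≤-<-trans (≤-trans 2+i≤B (m≤m+n B P)) F<
    below : ∀ {a} → a ≤ B → a ≢ B + suc i
    below a≤B = <⇒≢ (≤-<-trans a≤B (m<m+n B z<s))
    same′ : ∀ {a} → a ≤ B → μ₁ a ≡ μ₀ a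
    same′ a≤B = trans (↦-other μ (below a≤B)) (same a≤B)
    wtᵢ : μ₁ (2 + i) ≡ wt i
    wtᵢ = same′ 2+i≤B
    sum-assoc : S + μ₁ (2 + i) + sumBelow i wt ≡ S + sumBelow (suc i) wt
    sum-assoc = trans (cong (λ z → S + z + sumBelow i wt) wtᵢ) (+-assoc S (wt i) _)
    max-assoc : V + (μ₁ (2 + i) ∸ V) ⊔ maxBelow i wt ≡ V ⊔ maxBelow (suc i) wt
    max-assoc = trans (cong (_⊔ maxBelow i wt) (trans (+∸≡⊔ V _) (cong (V ⊔_) wtᵢ))) (⊔-assoc V (wt i) _)
    S+wt< : S + wt i < 2 ^ b
    S+wt< = ≤-<-trans (+-monoʳ-≤ S (m≤m+n (wt i) _)) S<
    V⊔wt< : V ⊔ μ₁ (2 + i) < 2 ^ b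
    V⊔wt< = ⊔-lub-< V< (subst (_< 2 ^ b) (sym wtᵢ) (≤-<-trans (m≤n+m (wt i) S) S+wt<))
    shift : ∀ i k → 1 + ((1 + i) * 10 + k) ≡ 1 + (i * 10 + (10 + k))
    shift = solve-∀
    unchanged : ∀ {a} → B + suc i < a ⊎ a ≤ B → μ₁ a ≡ μ a
    unchanged (inj₁ B+i<a) = ↦-other μ (≢-sym (<⇒≢ B+i<a))
    unchanged (inj₂ a≤B)   = ↦-other μ (below a≤B)
    again : Run b τ Q (10 + k) ⟨ while rI drawBody ∷ rest ,
              file W (S + μ₁ (2 + i)) (V + (μ₁ (2 + i) ∸ V)) 0 0 i (2 + i) (μ₁ (2 + i)) (μ₁ (2 + i) ∸ V) 0 0 0 0 0 0 0 , μ₁ ⟩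
    again = draw i μ₀ F< (<⇒≤ i<n) (subst (_< 2 ^ b) (sym (+∸≡⊔ V _)) V⊔wt<) (subst (_< 2 ^ b) (sym sum-assoc) S<) same′
      (subst (_≤ E) (shift i k) clock)
      λ {_} {_} {_} {_} {_} {_} {μ′} k′≤ S′≡ V′≡ kept drawn →
        next k′≤ (trans S′≡ sum-assoc) (trans V′≡ max-assoc)
          (λ { (inj₁ a≤B) → trans (kept (inj₁ a≤B)) (unchanged (inj₂ a≤B))
             ; (inj₂ B+i<a) → trans (kept (inj₂ (<-trans (+-monoʳ-< B (n<1+n i)) B+i<a))) (unchanged (inj₁ B+i<a)) })
          (λ {j} j≤i → drawn′ μ′ kept drawn j (m≤n⇒m<n∨m≡n (s≤s⁻¹ j≤i)))
      where
      drawn′ : ∀ μ′ → (∀ {a} → a ≤ B ⊎ B + i < a → μ′ a ≡ μ₁ a) →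
               (∀ {j} → j < i → μ′ (B + suc j) ≡ sample τ i (suc (10 + k)) j) →
               ∀ j → j < i ⊎ j ≡ i → μ′ (B + suc j) ≡ sample τ (suc i) (suc k) j
      drawn′ μ′ kept drawn j (inj₁ j<i)  = trans (drawn j<i) (sym (sample-below τ i (suc k) j<i))
      drawn′ μ′ kept drawn j (inj₂ refl) = trans (kept (inj₂ (+-monoʳ-< B (n<1+n j))))
        (trans (↦-same μ (B + suc j)) (sym (sample-top τ j (suc k))))

  -- The test register holds `n ∸ M * M`. By `small` it is positive as long as the exponent is below
  -- `m*`, and by `large` it is zero at `m*`, so exactly `r` rounds remain.
  size : ∀ r m {m* k E W S V L M D i a x y μ rest} → m + r ≡ m* →
    (∀ {m} → m < m* → 2 ^ m * 2 ^ m < n) → n ≤ 2 ^ m* * 2 ^ m* → 2 ^ m* * 2 ^ m* < 2 ^ b → suc m* * L < 2 ^ b →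
    M ≡ 2 ^ m → D ≡ suc m * L → x ≡ n ∸ M * M → suc (r * 5 + k) ≤ E →
    (∀ {k′ x} → k′ ≤ E →
      Run b τ Q k′ ⟨ rest , file W S V (2 ^ m*) (suc m* * L) i a x y 0 0 L 0 0 0 0 , μ ⟩) →
    Run b τ Q k ⟨ while rX sizeBody ∷ rest , file W S V M D i a x y 0 0 L 0 0 0 0 , μ ⟩
  size zero m m≡ small large sq< D< refl refl refl clock next with refl ← trans (sym (+-identityʳ m)) m≡ =
    while⁰ (m≤n⇒m∸n≡0 large) ▹ next clock
  size (suc r) m {m*} {k} {E} {W} {S} {V} {L} {M} {D} {i} {a} {x} {y} {μ} {rest} m≡ small large sq< D< refl refl refl clock next =
    while⁺ (proj₂ positive) ▹ arith (subst (_< 2 ^ b) (sym double) 2M<) ▹ arith D′< ▹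
    arith (subst (_< 2 ^ b) (sym (cong₂ _*_ double double)) (≤-<-trans (*-mono-≤ 2^m 2^m) sq<)) ▹ shrink (m∸n≤m n ((M + M) * (M + M))) ▹ again
    where
    m<m* : m < m*
    m<m* = subst (m <_) m≡ (m<m+n m z<s)
    positive : ∃[ j ] n ∸ M * M ≡ suc j
    positive with n ∸ M * M | m<n⇒0<n∸m (small m<m*)
    ... | suc j | _ = j , refl
    double : M + M ≡ 2 ^ suc m
    double = cong (M +_) (sym (+-identityʳ M))
    2^m : 2 ^ suc m ≤ 2 ^ m*
    2^m = ^-monoʳ-≤ 2 m<m*
    2M< : 2 ^ suc m < 2 ^ b
    2M< = ≤-<-trans (≤-trans 2^m (m≤m*n (2 ^ m*) (2 ^ m*) {{m^n≢0 2 m*}})) sq<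
    D′< : L + suc m * L < 2 ^ b
    D′< = ≤-<-trans (*-monoˡ-≤ L (s≤s m<m*)) D<
    shift : ∀ r k → 1 + ((1 + r) * 5 + k) ≡ 1 + (r * 5 + (5 + k))
    shift = solve-∀
    again : Run b τ Q (5 + k) ⟨ while rX sizeBody ∷ rest ,
              file W S V (M + M) (L + suc m * L) i a (n ∸ (M + M) * (M + M)) y 0 0 L 0 0 0 0 , μ ⟩
    again = size r (suc m) (trans (sym (+-suc m r)) m≡) small large sq< D< double refl refl
      (subst (_≤ E) (shift r k) clock) next

  scan : ∀ c {k E W S V M D i a x y t g l h w p μ rest} →
    F + c < 2 ^ b → (∀ j → dp μ j < 2 ^ b) → y < 2 ^ b → suc (c * 6 + k) ≤ E →
    (∀ {k′ a x y′} → k′ ≤ E → y′ ≡ y ⊔ maxBelow c (dp μ) →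
      Run b τ Q k′ ⟨ rest , file W S V M D i a x y′ t g l h 0 w p , μ ⟩) →
    Run b τ Q k ⟨ while rK scanBody ∷ rest , file W S V M D i a x y t g l h c w p , μ ⟩
  scan zero addr val y< clock next = while⁰ refl ▹ next clock (sym (⊔-identityʳ _))
  scan (suc c) {k} {E} {W} {S} {V} {M} {D} {i} {a} {x} {y} {t} {g} {l} {h} {w} {p} {μ} {rest} addr val y< clock next =
    while⁺ refl ▹ shrink (m∸n≤m (suc c) 1) ▹ arith addr′ ▹ load ▹ shrink (m∸n≤m (dp μ c) y) ▹ arith y′< ▹ again
    where
    addr′ : F + c < 2 ^ b
    addr′ = ≤-<-trans (+-monoʳ-≤ F (n≤1+n c)) addr
    y′< : y + (dp μ c ∸ y) < 2 ^ b
    y′< = subst (_< 2 ^ b) (sym (+∸≡⊔ y _)) (⊔-lub-< y< (val c))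
    shift : ∀ r k → 1 + ((1 + r) * 6 + k) ≡ 1 + (r * 6 + (6 + k))
    shift = solve-∀
    again : Run b τ Q (6 + k) ⟨ while rK scanBody ∷ rest ,
              file W S V M D i (F + c) (dp μ c ∸ y) (y + (dp μ c ∸ y)) t g l h c w p , μ ⟩
    again = scan c addr′ val y′< (subst (_≤ E) (shift c k) clock)
      λ k′≤ y′≡ → next k′≤ (trans y′≡ (trans (cong (_⊔ maxBelow c (dp μ)) (+∸≡⊔ y _)) (⊔-assoc y (dp μ c) _)))

-- Parameters of an instance and the complete run

_∷ₘ_ : ℕ → Memory → Memory
(x ∷ₘ μ) zero    = x
(x ∷ₘ μ) (suc a) = μ a

module Parameters (c n m* : ℕ) (ν : Memory) where

  wt pr : ℕ → ℕ
  wt j = ν (suc j)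
  pr j = (n ∷ₘ ν) (n + 1 + suc j)

  -- `W` is the capped capacity. `L` is a weight, the value of register `rL` while `M` is chosen; it
  -- differs from the `L` of the tail bound, which is an exponent.
  total V W M L D : ℕ
  total = sumBelow n wt
  V = maxBelow n wt
  W = ν 0 ∸ (ν 0 ∸ total)
  M = 2 ^ m*
  L = V * c
  D = suc m* * L * M

  lo cnt : ℕ → ℕ
  lo t  = ⟦ div ⟧ (t * W) M ∸ D
  cnt t = (⟦ div ⟧ (t * W + W) M + D + 1) ∸ lo t

  -- Seven instructions and a loop test precede the first draw, which therefore reads the word at
  -- time 8.
  bucket : (ℕ → ℕ) → ℕ → ℕ
  bucket τ j = ⟦ rem ⟧ (sample τ n 8 j) M

  time₀ : ℕ
  time₀ = M * (n * 9 + 13) + (n * 10 + m* * 5 + 20)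

  time : ℕ → ℕ
  time C = time₀ + n * (C * 12 + 6) + W * 6 + 10

module Correct (c n m* : ℕ) (ν : Memory) (b : ℕ) (τ : ℕ → ℕ) (σ : ℕ → Bool) (Good : Set) (C : ℕ) where

  open Parameters c n m* ν

  μ₀ : Memory
  μ₀ = n ∷ₘ ν

  bk : ℕ → ℕ
  bk = bucket τ

  captured : ℕ → ℕ → ℕ
  captured t i = sumOver n (λ j → σ j ∧ processed bk t i j) wt

  -- `Good` guards completeness alone, so a single run yields halting in time on every tape and the
  -- right answer on the good ones.
  Result : ℕ → Memory → Set
  Result k μ = k ≤ time C × ∃[ f ] Sound n wt pr (processed bk M n) f
                                 × (Good → Complete n wt pr σ (processed bk M n) f)
                                 × μ 0 ≡ maxBelow (suc W) f

  open Execution b τ Result n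
  open Phases b τ Result n

  module _ (fits : F + (M * W + D + 1 + V) < 2 ^ b) (M²<2^b : M * M < 2 ^ b) (c<2^b : c < 2 ^ b)
           (total<2^b : total < 2 ^ b) (profits : sumBelow n pr + sumBelow n pr < 2 ^ b)
           (wt>0 : ∀ {j} → j < n → 0 < wt j) (empty : ∀ j → dp μ₀ j ≡ 0)
           (small : ∀ {m} → m < m* → 2 ^ m * 2 ^ m < n) (large : n ≤ M * M)
           (narrow : ∀ {t} → t < M → cnt t ≤ C)
           (windows : Good → ∀ {t} i → t < M → lo t ≤ captured t i × captured t i < lo t + cnt t) where

    private
      instance
        M≢0 : NonZero M
        M≢0 = m^n≢0 2 m*

      F<2^b : F < 2 ^ b
      F<2^b = ≤-<-trans (m≤m+n F _) fits

      P≤F : P ≤ F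
      P≤F = m≤n+m P B

      1<2^b : 1 < 2 ^ b
      1<2^b = ≤-<-trans (≤-trans (m≤n+m 1 n) P≤F) F<2^b

      D<2^b : D < 2 ^ b
      D<2^b = ≤-<-trans (≤-trans (m≤n+m D (M * W)) (≤-trans (m≤m+n _ 1) (≤-trans (m≤m+n _ V) (m≤n+m _ F)))) fits

      sL<2^b : suc m* * L < 2 ^ b
      sL<2^b = ≤-<-trans (m≤m*n (suc m* * L) M) D<2^b

      M<2^b : M < 2 ^ b
      M<2^b = ≤-<-trans (m≤m*n M M) M²<2^b

      W≤MW : W ≤ M * W
      W≤MW = m≤n*m W M

      1+W≤ : 1 + W ≤ M * W + D + 1 + V
      1+W≤ = ≤-trans (≤-reflexive (+-comm 1 W)) (≤-trans (+-monoˡ-≤ 1 (≤-trans W≤MW (m≤m+n _ D))) (m≤m+n _ V))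

      F+1+W< : F + suc W < 2 ^ b
      F+1+W< = ≤-<-trans (+-monoʳ-≤ F 1+W≤) fits

      module Buckets {μ₁ : Memory} (kept : ∀ {a} → a ≤ B ⊎ B + n < a → μ₁ a ≡ μ₀ a)
                     (drawn : ∀ {j} → j < n → μ₁ (B + suc j) ≡ sample τ n 8 j) where

        open Sweep b τ Result n W total V M D μ₁ wt pr bk σ Good C time₀
          using (Inv; buckets)

        finish : ∀ {k i a x y l h c′ w p μ} → Inv k (processed bk M n) μ →
                 Run b τ Result k ⟨ List.drop 20 (program c) , file W total V M D i a x y M 0 l h c′ w p , μ ⟩
        finish {k} {i} {a} {x} {l = l} {h} {c′} {w} {p} {μ} inv =
          arith (≤-<-trans (m≤n+m _ F) F+1+W<) ▹ shrink z≤n ▹ scanning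
          where
          open Inv inv
          dp< : ∀ j → dp μ j < 2 ^ b
          dp< j = ≤-<-trans (≤-trans (Sound-≤ n wt pr sound j) (m≤m+n _ (sumBelow n pr))) profits
          end : ∀ {k′ a x y′} → k′ ≤ suc (suc W * 6 + (2 + k)) → y′ ≡ maxBelow (suc W) (dp μ) →
                Run b τ Result k′ ⟨ store r0 rY ∷ [] , file W total V M D i a x y′ M 0 l h 0 w p , μ ⟩
          end {k′} {y′ = y′} k′≤ y′≡ = store ▹ halt (last , dp μ , sound , complete , trans (↦-same μ 0) y′≡)
            where
            shift : ∀ W k → 1 + (1 + ((1 + W) * 6 + (2 + k))) ≡ k + W * 6 + 10
            shift = solve-∀
            last : suc k′ ≤ time C
            last = begin
              suc k′                            ≤⟨ s≤s k′≤ ⟩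
              suc (suc (suc W * 6 + (2 + k)))   ≡⟨ shift W k ⟩
              k + W * 6 + 10                    ≤⟨ +-monoˡ-≤ 10 (+-monoˡ-≤ (W * 6) (≤-trans clock
                                                    (+-monoʳ-≤ time₀ (*-monoˡ-≤ (C * 12 + 6)
                                                      (≤-trans (sumOver-≤ n _ (λ _ → 1)) (≤-reflexive (trans (sumBelow-const n 1) (*-identityʳ n)))))))) ⟩
              time C                            ∎
              where open ≤-Reasoning
          scanning : Run b τ Result (2 + k) ⟨ while rK scanBody ∷ store r0 rY ∷ [] ,
                       file W total V M D i a x 0 M 0 l h (suc W) w p , μ ⟩
          scanning = scan (suc W) F+1+W< dp< (<-trans z<s 1<2^b) ≤-refl end

        none : ∀ {j} → j < n → processed bk 0 n j ≡ false
        none {j} j<n = processed-first bk {n} {0} {j} j<n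

        -- The table lies beyond the input and the random words, so its cells are still the zeros of
        -- the initial memory; the empty set justifies them.
        start : ∀ {k} → suc (M * (n * 9 + 13) + k) ≤ time₀ → Inv (suc (M * (n * 9 + 13) + k)) (processed bk 0 n) μ₁
        start k≤ = record
          { clock    = ≤-trans k≤ (m≤m+n _ _)
          ; frame    = λ _ → refl
          ; sound    = λ j → (λ _ → false) , (λ _ ()) , ≤-trans (≤-reflexive (sumOver-none n wt (λ _ → refl))) z≤n
                           , ≤-trans (≤-reflexive (trans (kept (inj₂ (B+n<F+ j))) (empty j))) z≤n
          ; complete = λ _ → ≤-trans (≤-reflexive (sumOver-none n pr (λ {j} j<n → trans (cong (σ j ∧_) (none j<n)) (∧-zeroʳ (σ j))))) z≤n
          }
          where
          B+n<F+ : ∀ j → B + n < F + j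
          B+n<F+ j = ≤-trans (+-monoʳ-< B (m<m+n n z<s)) (m≤m+n F j)

        process : ∀ {k i a x y μ} → μ ≡ μ₁ → k ≤ n * 10 + m* * 5 + 17 →
                  Run b τ Result k ⟨ List.drop 17 (program c) , file W total V M (suc m* * L) i a x y 0 0 L 0 0 0 0 , μ ⟩
        process {k} {i} {a} {x} {y} refl k≤ = arith D<2^b ▹ shrink (m∸n≤m M 0) ▹ loop
          where
          shift : ∀ A k → 1 + (A + (2 + k)) ≡ A + (k + 3)
          shift = solve-∀
          shift′ : ∀ A → A + 17 + 3 ≡ A + 20
          shift′ = solve-∀
          loop : Run b τ Result (2 + k) ⟨ List.drop 19 (program c) , file W total V M D i a x y 0 M L 0 0 0 0 , μ₁ ⟩
          loop = buckets
            (λ {j} j<n → kept (inj₁ (≤-trans (s≤s j<n) (≤-trans (≤-reflexive (+-comm 1 n)) (m≤m+n P n)))))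
            (λ {j} j<n → kept (inj₁ (+-monoʳ-≤ P j<n)))
            (λ j<n → cong (λ z → ⟦ rem ⟧ z M) (drawn j<n))
            wt>0 (≤-maxBelow n wt) M<2^b fits profits narrow windows M refl
            (start (≤-trans (≤-reflexive (shift (M * (n * 9 + 13)) k)) (+-monoʳ-≤ (M * (n * 9 + 13))
              (≤-trans (+-monoˡ-≤ 3 k≤) (≤-reflexive (shift′ (n * 10 + m* * 5)))))))
            finish

    execution : Run b τ Result 0 ⟨ program c , Vec.replicate 22 0 , μ₀ ⟩
    execution =
      set 1<2^b ▹ load ▹ load ▹ arith (≤-<-trans P≤F F<2^b) ▹ arith (≤-<-trans (m≤m+n B P) F<2^b) ▹
      arith F<2^b ▹ shrink (m∸n≤m n 0) ▹ drawing
      where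
      sizing : ∀ {k a x y μ₁} → k ≤ suc (n * 10 + 7) →
               (∀ {a} → a ≤ B ⊎ B + n < a → μ₁ a ≡ μ₀ a) → (∀ {j} → j < n → μ₁ (B + suc j) ≡ sample τ n 8 j) →
               Run b τ Result k ⟨ List.drop 8 (program c) , file (ν 0) total V 0 0 0 a x y 0 0 0 0 0 0 0 , μ₁ ⟩
      sizing {k} {a} {x} {y} {μ₁} k≤ kept drawn =
        shrink (m∸n≤m (ν 0) total) ▹ shrink (m∸n≤m (ν 0) (ν 0 ∸ total)) ▹ set 1<2^b ▹ set c<2^b ▹
        arith (≤-<-trans (m≤n*m L (suc m*)) sL<2^b) ▹ shrink (m∸n≤m L 0) ▹ arith 1<2^b ▹ shrink (m∸n≤m n 1) ▹ loop
        where
        shift : ∀ A B → 1 + (B * 5 + (8 + (1 + (A * 10 + 7)))) ≡ A * 10 + B * 5 + 17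
        shift = solve-∀
        loop : Run b τ Result (8 + k) ⟨ List.drop 16 (program c) , file W total V 1 L 0 a (n ∸ 1) y 0 0 L 0 0 0 0 , μ₁ ⟩
        loop = size m* 0 refl small large M²<2^b sL<2^b refl (sym (+-identityʳ L)) refl
          (≤-trans (s≤s (+-monoʳ-≤ (m* * 5) (+-monoʳ-≤ 8 k≤))) (≤-reflexive (shift n m*)))
          (Buckets.process kept drawn refl)
      drawing : Run b τ Result 7 ⟨ List.drop 7 (program c) , file (ν 0) 0 0 0 0 n 0 0 0 0 0 0 0 0 0 0 , μ₀ ⟩
      drawing = draw n μ₀ F<2^b ≤-refl (<-trans z<s 1<2^b) total<2^b (λ _ → refl) ≤-refl
        λ { k≤ refl refl kept drawn → sizing k≤ kept drawn }

-- Optimal solutions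

vsum-toℕ : ∀ n f → vsum +-0-monoid {n} (f ∘ toℕ) ≡ sumBelow n f
vsum-toℕ zero    f = refl
vsum-toℕ (suc n) f = trans (cong (f 0 +_) (vsum-toℕ n (f ∘ suc))) (sym (sumBelow-suc n f))

∈-vectors : ∀ {A : Set} {xs : List A} → (∀ x → x ∈ xs) → ∀ {n} (v : Vec A n) → v ∈ vectors xs n
∈-vectors all∈ []      = here refl
∈-vectors all∈ (x ∷ v) = ∈-cartesianProductWith⁺ _∷_ (all∈ x) (∈-vectors all∈ v)

∈⇒≤⊔ : ∀ {x xs} → x ∈ xs → x ≤ foldr _⊔_ 0 xs
∈⇒≤⊔ {xs = y ∷ xs} (here refl) = m≤m⊔n y _
∈⇒≤⊔ {xs = y ∷ xs} (there x∈)  = ≤-trans (∈⇒≤⊔ x∈) (m≤n⊔m y _)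

⊔-selective : ∀ xs → foldr _⊔_ 0 xs ∈ 0 ∷ xs
⊔-selective []       = here refl
⊔-selective (x ∷ xs) with ⊔-sel x (foldr _⊔_ 0 xs) | ⊔-selective xs
... | inj₁ eq | _         rewrite eq = there (here refl)
... | inj₂ eq | here  m≡0 rewrite eq = here m≡0
... | inj₂ eq | there m∈  rewrite eq = there (there m∈)

member : ∀ {n} → Subset n → ℕ → Bool
member []      j       = false
member (x ∷ S) zero    = x
member (x ∷ S) (suc j) = member S j

member-lookup : ∀ {n} (S : Subset n) i → member S (toℕ i) ≡ Vec.lookup S i
member-lookup (x ∷ S) zero    = refl
member-lookup (x ∷ S) (suc i) = member-lookup S i

record IsOptimum (n W : ℕ) (wt pr : ℕ → ℕ) (σ : ℕ → Bool) (opt : ℕ) : Set where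
  field
    feasible : sumOver n σ wt ≤ W
    attained : sumOver n σ pr ≡ opt
    maximal  : ∀ σ′ → sumOver n σ′ wt ≤ W → sumOver n σ′ pr ≤ opt

module _ {n} (I : Knapsack n) (wt pr : ℕ → ℕ)
         (wt≡w : ∀ i → wt (toℕ i) ≡ Knapsack.w I i) (pr≡p : ∀ i → pr (toℕ i) ≡ Knapsack.p I i) where

  open Knapsack I

  private
    vsum-over : ∀ {f : ℕ → ℕ} {g : Fin n → ℕ} (S : Subset n) σ → (∀ i → f (toℕ i) ≡ g i) → (∀ i → σ (toℕ i) ≡ Vec.lookup S i) →
                vsum +-0-monoid (λ i → if Vec.lookup S i then g i else 0) ≡ sumOver n σ f
    vsum-over {f} {g} S σ f≡g σ≡S = trans
      (sum-cong-≗ +-0-monoid λ i → sym (cong₂ (λ a x → if a then x else 0) (σ≡S i) (f≡g i)))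
      (vsum-toℕ n (λ j → if σ j then f j else 0))

    Bool-all : ∀ x → x ∈ true ∷ false ∷ []
    Bool-all true  = here refl
    Bool-all false = there (here refl)

    fits? = λ S → weight S ≤? W

  OPT-maximal : ∀ σ → sumOver n σ wt ≤ W → sumOver n σ pr ≤ OPT
  OPT-maximal σ σ≤W = subst (_≤ OPT) (vsum-over S σ pr≡p σ≡S)
    (∈⇒≤⊔ (∈-map⁺ profit (∈-filter⁺ fits? (∈-vectors Bool-all S)
      (subst (_≤ W) (sym (vsum-over S σ wt≡w σ≡S)) σ≤W))))
    where
    S : Subset n
    S = Vec.tabulate (σ ∘ toℕ)
    σ≡S : ∀ i → σ (toℕ i) ≡ Vec.lookup S i
    σ≡S i = sym (lookup∘tabulate (σ ∘ toℕ) i)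

  optimum : ∃[ σ ] IsOptimum n W wt pr σ OPT
  optimum with ⊔-selective (map profit feasible)
  -- The maximum may come from the base value of the fold instead of a listed set; the empty set
  -- then attains it.
  ... | here OPT≡0 = (λ _ → false) , record
    { feasible = ≤-trans (≤-reflexive (sumOver-none n wt (λ _ → refl))) z≤n
    ; attained = trans (sumOver-none n pr (λ _ → refl)) (sym OPT≡0)
    ; maximal  = OPT-maximal
    }
  ... | there OPT∈ with S , S∈ , OPT≡ ← ∈-map⁻ profit OPT∈ = member S , record
    { feasible = subst (_≤ W) (vsum-over S (member S) wt≡w (member-lookup S)) (proj₂ (∈-filter⁻ fits? {xs = vectors (true ∷ false ∷ []) n} S∈))
    ; attained = trans (sym (vsum-over S (member S) pr≡p (member-lookup S))) (sym OPT≡)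
    ; maximal  = OPT-maximal
    }

module _ {n W wt pr σ opt} (isOpt : IsOptimum n W wt pr σ opt) (pr>0 : ∀ {j} → j < n → 0 < pr j) where
  open IsOptimum isOpt

  private
    find-false : ∀ m → (∃[ j ] j < m × σ j ≡ false) ⊎ (∀ {j} → j < m → σ j ≡ true)
    find-false zero = inj₂ λ ()
    find-false (suc m) with σ m in σm | find-false m
    ... | false | _                    = inj₁ (m , ≤-refl , σm)
    ... | true  | inj₁ (j , j<m , σj) = inj₁ (j , m<n⇒m<1+n j<m , σj)
    ... | true  | inj₂ all = inj₂ λ {j} j≤m → go j (m≤n⇒m<n∨m≡n (s≤s⁻¹ j≤m))
      where
      go : ∀ j → j < m ⊎ j ≡ m → σ j ≡ true
      go j (inj₁ j<m)  = all j<m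
      go j (inj₂ refl) = σm

  -- An item outside an optimal set does not fit any more.
  optimum-saturated : W ⊓ sumBelow n wt ≤ sumOver n σ wt + maxBelow n wt
  optimum-saturated with find-false n
  ... | inj₂ all = ≤-trans (m⊓n≤n W _) (≤-trans (≤-reflexive (sym (sumOver-all n wt all))) (m≤m+n _ _))
  ... | inj₁ (j , j<n , σj) with wt j + sumOver n σ wt ≤? W
  ...   | no ≰W = ≤-trans (m⊓n≤m W _) (≤-trans (<⇒≤ (≰⇒> ≰W)) (≤-trans (≤-reflexive (+-comm (wt j) _))
                    (+-monoʳ-≤ (sumOver n σ wt) (≤-maxBelow n wt j<n))))
  ...   | yes ≤W = contradiction
    (≤-trans (≤-reflexive (sym (sumOver-insert n pr ins j<n)))
      (≤-trans (maximal σ′ (≤-trans (≤-reflexive (sumOver-insert n wt ins j<n)) ≤W)) (≤-reflexive (sym attained))))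
    (<⇒≱ (m<n+m _ (pr>0 j<n)))
    where
    σ′ : ℕ → Bool
    σ′ k = (k ≡ᵇ j) ∨ σ k
    ins : Insert σ σ′ j
    ins = record
      { absent  = σj
      ; present = cong (_∨ σ j) (≡ᵇ-refl j)
      ; others  = λ {k} k≢j → cong (_∨ σ k) (≡ᵇ-≢ k≢j)
      }

  -- Soundness bounds every scanned entry by the optimum. Completeness makes the entry at the weight
  -- of `σ` reach it, and the scan meets this entry because that weight is at most both the capacity
  -- and the total weight.
  optimum-computed : ∀ {U f} → (∀ {j} → j < n → U j ≡ true) → Sound n wt pr U f → Complete n wt pr σ U f →
                     maxBelow (suc (W ⊓ sumBelow n wt)) f ≡ opt
  optimum-computed {U} {f} full snd cmp = ≤-antisym
    (maxBelow-lub (suc (W ⊓ sumBelow n wt)) f λ {j} j≤ → upper j (≤-trans (s≤s⁻¹ j≤) (m⊓n≤m W _)))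
    (begin
      opt                                      ≡⟨ attained ⟨
      sumOver n σ pr                           ≡⟨ restrict pr ⟨
      sumOver n (λ j → σ j ∧ U j) pr           ≤⟨ cmp ⟩
      f (sumOver n (λ j → σ j ∧ U j) wt)       ≡⟨ cong f (restrict wt) ⟩
      f (sumOver n σ wt)                       ≤⟨ ≤-maxBelow _ f (s≤s (⊓-glb feasible (sumOver-≤ n σ wt))) ⟩
      maxBelow (suc (W ⊓ sumBelow n wt)) f     ∎)
    where
    open ≤-Reasoning
    restrict : ∀ g → sumOver n (λ j → σ j ∧ U j) g ≡ sumOver n σ g
    restrict g = sumOver-cong n g λ {j} j<n → trans (cong (σ j ∧_) (full j<n)) (∧-identityʳ (σ j))
    upper : ∀ j → j ≤ W → f j ≤ opt
    upper j j≤W with σ′ , _ , w≤ , f≤ ← snd j = ≤-trans f≤ (maximal σ′ (≤-trans w≤ j≤W))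

-- From balanced prefixes of the buckets to windows

div-upper : ∀ M .{{_ : NonZero M}} {x y} → x ≤ M * y → ⟦ div ⟧ x M ≤ y
div-upper M@(suc _) {x} {y} x≤ = ≤-trans (/-monoˡ-≤ M (≤-trans x≤ (≤-reflexive (*-comm M y)))) (≤-reflexive (m*n/n≡m y M))

div-lower : ∀ M .{{_ : NonZero M}} {x y} → M * y ≤ x → y ≤ ⟦ div ⟧ x M
div-lower M@(suc _) {x} {y} ≤x = ≤-trans (≤-reflexive (sym (m*n/n≡m y M))) (/-monoˡ-≤ M (≤-trans (≤-reflexive (*-comm y M)) ≤x))

-- The deviation is measured from the share `t * W` over `M` of the capped capacity, which the
-- program can compute, and not from the share of the weight of `σ`, which it cannot.
record Balanced (n W M D : ℕ) (wt bk : ℕ → ℕ) (σ : ℕ → Bool) (t : ℕ) : Set where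
  Aₜ : ℕ
  Aₜ = sumOver n (λ j → σ j ∧ (bk j <ᵇ t)) wt
  field
    lower : t * W ≤ M * (Aₜ + D)
    upper : M * Aₜ ≤ t * W + M * D

-- While bucket `t` is swept, the captured weight stays between its values for the first `t` and the
-- first `suc t` buckets. Balance at these two ends covers every intermediate item, so the union
-- bound ranges over M + 1 thresholds only.
window : ∀ {n W M D wt bk σ t} .{{_ : NonZero M}} → Balanced n W M D wt bk σ t → Balanced n W M D wt bk σ (suc t) →
         ∀ i → let A  = sumOver n (λ j → σ j ∧ processed bk t i j) wt
                   lo = ⟦ div ⟧ (t * W) M ∸ D
                   hi = ⟦ div ⟧ (t * W + W) M + D + 1
               in lo ≤ A × A < lo + (hi ∸ lo)
window {n} {W} {M} {D} {wt} {bk} {σ} {t} balₜ balₜ₊₁ i = lo≤A , subst (A <_) (sym (m+[n∸m]≡n (≤-trans lo≤A (<⇒≤ A<hi)))) A<hi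
  where
  module Bₜ = Balanced balₜ
  module Bₜ₊₁ = Balanced balₜ₊₁
  A lo hi : ℕ
  A  = sumOver n (λ j → σ j ∧ processed bk t i j) wt
  lo = ⟦ div ⟧ (t * W) M ∸ D
  hi = ⟦ div ⟧ (t * W + W) M + D + 1
  ∧-mono : ∀ a {c d} → (c ≡ true → d ≡ true) → a ∧ c ≡ true → a ∧ d ≡ true
  ∧-mono true c⇒d = c⇒d
  lo≤A : lo ≤ A
  lo≤A = ≤-trans (m≤n+o⇒m∸n≤o _ D (≤-trans (div-upper M Bₜ.lower) (≤-reflexive (+-comm Bₜ.Aₜ D))))
    (sumOver-mono n wt λ {j} _ → ∧-mono (σ j) (processed-lower bk {t} {i} {j}))
  A≤Aₜ₊₁ : A ≤ Bₜ₊₁.Aₜ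
  A≤Aₜ₊₁ = sumOver-mono n wt λ {j} _ → ∧-mono (σ j) (processed-upper bk {t} {i} {j})
  MA≤ : M * (A ∸ D) ≤ t * W + W
  MA≤ = ≤-trans (≤-reflexive (*-distribˡ-∸ M A D))
    (m≤n+o⇒m∸n≤o _ (M * D) (≤-trans (*-monoʳ-≤ M A≤Aₜ₊₁) (≤-trans Bₜ₊₁.upper
      (≤-reflexive (trans (+-comm (suc t * W) (M * D)) (cong (M * D +_) (+-comm W (t * W))))))))
  A<hi : A < hi
  A<hi = ≤-trans (s≤s (≤-trans (m∸n≤o⇒m≤n+o D (div-lower M MA≤)) (≤-reflexive (+-comm D _)))) (≤-reflexive (+-comm 1 _))
    where
    m∸n≤o⇒m≤n+o : ∀ {m} n {o} → m ∸ n ≤ o → m ≤ n + o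
    m∸n≤o⇒m≤n+o {m} n ≤o = ≤-trans (m≤n+m∸n m n) (+-monoʳ-≤ n ≤o)

-- The two inequalities in the assumptions bound the optimal weight inside
-- and outside the buckets below t.
balanced : ∀ {n W M V m c wt bk σ t L} → 1 + L ≡ m * c → t ≤ M →
  let w = sumOver n σ wt
      v = λ j → if σ j then wt j else 0
  in w ≤ W → W ≤ w + V →
  M * sumOver n (λ j → bk j <ᵇ t) v ≤ t * w + M * M * V * L →
  M * sumOver n (λ j → not (bk j <ᵇ t)) v ≤ (M ∸ t) * w + M * M * V * L →
  Balanced n W M (m * (V * c) * M) wt bk σ t
balanced {n} {W} {M} {V} {m} {c} {wt} {bk} {σ} {t} {L} 1+L≡ t≤M w≤W W≤w+V inside outside = record
  { upper = begin
      M * sumOver n (λ j → σ j ∧ (bk j <ᵇ t)) wt  ≡⟨ cong (M *_) (swap (λ j → bk j <ᵇ t)) ⟨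
      M * X                                       ≤⟨ inside ⟩
      t * w + M * M * V * L                       ≤⟨ +-mono-≤ (*-monoʳ-≤ t w≤W) (≤-trans (m≤n+m _ (M * M * V)) (≤-reflexive (sym MD))) ⟩
      t * W + M * D                               ∎
  ; lower = begin
      t * W                                       ≤⟨ *-monoʳ-≤ t W≤w+V ⟩
      t * (w + V)                                 ≡⟨ *-distribˡ-+ t w V ⟩
      t * w + t * V                               ≤⟨ +-mono-≤ tw≤ tV≤ ⟩
      M * X + M * M * V * L + M * M * V           ≡⟨ trans (+-assoc (M * X) _ _) (cong (M * X +_) (+-comm (M * M * V * L) _)) ⟩
      M * X + (M * M * V + M * M * V * L)         ≡⟨ cong (M * X +_) MD ⟨
      M * X + M * D                               ≡⟨ *-distribˡ-+ M X D ⟨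
      M * (X + D)                                 ≡⟨ cong (λ z → M * (z + D)) (swap (λ j → bk j <ᵇ t)) ⟩
      M * (sumOver n (λ j → σ j ∧ (bk j <ᵇ t)) wt + D) ∎
  }
  where
  open ≤-Reasoning
  v : ℕ → ℕ
  v j = if σ j then wt j else 0
  w X Y D : ℕ
  w = sumOver n σ wt
  X = sumOver n (λ j → bk j <ᵇ t) v
  Y = sumOver n (λ j → not (bk j <ᵇ t)) v
  D = m * (V * c) * M
  expand : ∀ M V L → M * M * V * (1 + L) ≡ M * M * V + M * M * V * L
  expand = solve-∀
  collect : ∀ M V m c → M * (m * (V * c) * M) ≡ M * M * V * (m * c)
  collect = solve-∀
  -- With K = M² V this is K + K L: the term K L is the permitted deviation, and the extra K absorbs
  -- `t * V`, the gap between capped capacity and optimal weight.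
  MD : M * D ≡ M * M * V + M * M * V * L
  MD = trans (collect M V m c) (trans (cong (M * M * V *_) (sym 1+L≡)) (expand M V L))
  swap : ∀ χ → sumOver n χ v ≡ sumOver n (λ j → σ j ∧ χ j) wt
  swap χ = sumBelow-cong n λ {j} _ → go (χ j) (σ j) (wt j)
    where
    go : ∀ a s x → (if a then (if s then x else 0) else 0) ≡ (if s ∧ a then x else 0)
    go true  true  x = refl
    go true  false x = refl
    go false true  x = refl
    go false false x = refl
  X+Y : X + Y ≡ w
  X+Y = trans (cong (X +_) (sumBelow-cong n λ {j} _ → go (bk j <ᵇ t) (v j))) (sumOver-compl n (λ j → bk j <ᵇ t) v)
    where
    go : ∀ a (x : ℕ) → (if not a then x else 0) ≡ (if a then 0 else x)
    go true  x = refl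
    go false x = refl
  -- The lower bound inside comes from the upper bound outside, since both parts together weigh `w`.
  tw≤ : t * w ≤ M * X + M * M * V * L
  tw≤ = +-cancelʳ-≤ ((M ∸ t) * w) _ _ (begin
    t * w + (M ∸ t) * w                      ≡⟨ *-distribʳ-+ w t (M ∸ t) ⟨
    (t + (M ∸ t)) * w                        ≡⟨ cong (_* w) (m+[n∸m]≡n t≤M) ⟩
    M * w                                    ≡⟨ cong (M *_) X+Y ⟨
    M * (X + Y)                              ≡⟨ *-distribˡ-+ M X Y ⟩
    M * X + M * Y                            ≤⟨ +-monoʳ-≤ (M * X) outside ⟩
    M * X + ((M ∸ t) * w + M * M * V * L)    ≡⟨ trans (cong (M * X +_) (+-comm ((M ∸ t) * w) _)) (sym (+-assoc (M * X) _ _)) ⟩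
    M * X + M * M * V * L + (M ∸ t) * w      ∎)
  tV≤ : t * V ≤ M * M * V
  tV≤ = *-monoˡ-≤ V (≤-trans t≤M (M≤M*M M))
    where
    M≤M*M : ∀ M → M ≤ M * M
    M≤M*M zero    = z≤n
    M≤M*M (suc M) = m≤m*n (suc M) (suc M)

-- Success probability

⟦lt⟧-zero : ∀ x y → ⟦ lt ⟧ x y ≡ 0 → y ≤ x
⟦lt⟧-zero x y eq with x <ᵇ y in x<y
... | false = ≮⇒≥ λ p → subst Bool.T x<y (<⇒<ᵇ p)

rem≡% : ∀ x M .{{_ : NonZero M}} → ⟦ rem ⟧ x M ≡ x % M
rem≡% x (suc M) = refl

count-< : ∀ m t → sumOver m (_<ᵇ t) (λ _ → 1) ≡ m ⊓ t
count-< zero    t = refl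
count-< (suc m) t with m <? t
... | yes m<t rewrite <ᵇ-true m<t | count-< m t | m≤n⇒m⊓n≡m (<⇒≤ m<t) | m≤n⇒m⊓n≡m m<t = refl
... | no  m≮t rewrite <ᵇ-false (≮⇒≥ m≮t) | count-< m t | m≥n⇒m⊓n≡n (≮⇒≥ m≮t) | m≥n⇒m⊓n≡n (m≤n⇒m≤1+n (≮⇒≥ m≮t)) = refl

count-≮ : ∀ {m t} → t ≤ m → sumOver m (λ r → not (r <ᵇ t)) (λ _ → 1) ≡ m ∸ t
count-≮ {m} {t} t≤m = +-cancelˡ-≡ t _ _ (begin
  t + sumOver m (λ r → not (r <ᵇ t)) (λ _ → 1)
    ≡⟨ cong₂ _+_ (sym (trans (count-< m t) (m≥n⇒m⊓n≡n t≤m))) (sumBelow-cong m λ {r} _ → go (r <ᵇ t)) ⟩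
  sumOver m (_<ᵇ t) (λ _ → 1) + sumBelow m (λ r → if r <ᵇ t then 0 else 1)
    ≡⟨ sumOver-compl m (_<ᵇ t) (λ _ → 1) ⟩
  sumBelow m (λ _ → 1)
    ≡⟨ trans (sumBelow-const m 1) (*-identityʳ m) ⟩
  m ≡⟨ m+[n∸m]≡n t≤m ⟨
  t + (m ∸ t) ∎)
  where
  open ≡-Reasoning
  go : ∀ a → (if not a then 1 else 0) ≡ (if a then 0 else 1)
  go true  = refl
  go false = refl

sumBelow-≤-* : ∀ m c f {B} → (∀ {t} → t < m → c * f t ≤ B) → c * sumBelow m f ≤ m * B
sumBelow-≤-* zero    c f cf≤B = ≤-reflexive (*-zeroʳ c)
sumBelow-≤-* (suc m) c f cf≤B = ≤-trans (≤-reflexive (*-distribˡ-+ c (f m) _))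
  (+-mono-≤ (cf≤B ≤-refl) (sumBelow-≤-* m c f (cf≤B ∘ m<n⇒m<1+n)))

sumBelow-zero : ∀ m f → sumBelow m f ≡ 0 → ∀ {i} → i < m → f i ≡ 0
sumBelow-zero m f eq i<m = n≤0⇒n≡0 (subst (f _ ≤_) eq (≤-sumBelow m f i<m))

∑-tapes : ∀ N T → ∑ (vectors (allFin N) T) (λ _ → 1) ≡ N ^ T
∑-tapes N zero    = refl
∑-tapes N (suc T) = begin
  ∑ (vectors (allFin N) (suc T)) (λ _ → 1)                ≡⟨ ∑-cartesianProductWith _∷_ (allFin N) (vectors (allFin N) T) (λ _ → 1) ⟩
  ∑ (allFin N) (λ _ → ∑ (vectors (allFin N) T) (λ _ → 1)) ≡⟨ ∑-cong (allFin N) (λ _ → ∑-tapes N T) ⟩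
  ∑ (allFin N) (λ _ → N ^ T)                              ≡⟨ ∑-allFin N (λ _ → N ^ T) ⟩
  sumBelow N (λ _ → N ^ T)                                ≡⟨ sumBelow-const N (N ^ T) ⟩
  N * N ^ T                                               ∎
  where open ≡-Reasoning

-- An element rejected by the filter has `f x` at least 1, so the second sum pays for it.
length-filter-≥ : ∀ {A : Set} {E : A → Set} (E? : ∀ x → Dec (E x)) (f : A → ℕ) xs → (∀ x → f x ≡ 0 → E x) →
                  ∑ xs (λ _ → 1) ≤ length (filter E? xs) + ∑ xs f
length-filter-≥ E? f []       f≡0⇒E = z≤n
length-filter-≥ E? f (x ∷ xs) f≡0⇒E with IH ← length-filter-≥ E? f xs f≡0⇒E | E? x
... | yes _ = s≤s (≤-trans IH (+-monoʳ-≤ (length (filter E? xs)) (m≤n+m _ (f x))))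
... | no ¬E with f x in fx
...   | zero  = contradiction (f≡0⇒E x fx) ¬E
...   | suc k = ≤-trans (s≤s (≤-trans IH (+-monoʳ-≤ (length (filter E? xs)) (m≤n+m _ k)))) (≤-reflexive (sym (+-suc _ _)))

module _ (n M V L T q N : ℕ) (wt : ℕ → ℕ) (σ : ℕ → Bool) .{{_ : NonZero M}} .{{_ : NonZero V}}
         (N≡q*M : N ≡ q * M) (wt≤V : ∀ {j} → j < n → wt j ≤ V) (n≤M² : n ≤ M * M)
         (tape : n * 10 + 8 ≤ T) where

  private
    w : ℕ
    w = sumOver n σ wt

    v : ℕ → ℕ
    v j = if σ j then wt j else 0

    v≤V : ∀ {j} → j < n → v j ≤ V
    v≤V {j} j<n with σ j
    ... | true  = wt≤V j<n
    ... | false = z≤n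

    weight : (ℕ → Bool) → Vec (Fin N) T → ℕ
    weight = hits N T q M V n 8 L v N≡q*M v≤V n≤M² tape

    excess : ℕ → Vec (Fin N) T → ℕ
    excess t ω = ⟦ lt ⟧ (t * w + M * M * V * L) (M * weight (_<ᵇ t) ω)
               + ⟦ lt ⟧ ((M ∸ t) * w + M * M * V * L) (M * weight (λ r → not (r <ᵇ t)) ω)

  -- The number of violated inequalities. As a sum of indicators it turns the union bound into an
  -- exchange of two sums.
  failures : Vec (Fin N) T → ℕ
  failures ω = sumBelow (suc M) (λ t → excess t ω)

  failures-zero : ∀ ω → failures ω ≡ 0 → ∀ {t} → t ≤ M →
    let bk = λ j → ⟦ rem ⟧ (sample (at ω) n 8 j) M in
    M * sumOver n (λ j → bk j <ᵇ t) v ≤ t * w + M * M * V * L ×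
    M * sumOver n (λ j → not (bk j <ᵇ t)) v ≤ (M ∸ t) * w + M * M * V * L
  failures-zero ω eq {t} t≤M =
      ≤-trans (≤-reflexive (cong (M *_) (via (_<ᵇ t)))) (⟦lt⟧-zero _ _ (m+n≡0⇒m≡0 _ none))
    , ≤-trans (≤-reflexive (cong (M *_) (via (λ r → not (r <ᵇ t))))) (⟦lt⟧-zero _ _ (m+n≡0⇒n≡0 (⟦ lt ⟧ (t * w + M * M * V * L) (M * weight (_<ᵇ t) ω)) none))
    where
    none : excess t ω ≡ 0
    none = sumBelow-zero (suc M) (λ t → excess t ω) eq (s≤s t≤M)
    via : ∀ χ → sumOver n (λ j → χ (⟦ rem ⟧ (sample (at ω) n 8 j) M)) v ≡ weight χ ω
    via χ = sumOver-cong n v λ {j} _ → cong χ (rem≡% (sample (at ω) n 8 j) M)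

  failures-rare : 2 ^ L * ∑ (vectors (allFin N) T) failures ≤ suc M * (6 * N ^ T)
  failures-rare = begin
    2 ^ L * ∑ tapes failures                                ≡⟨ cong (2 ^ L *_) (∑-sumBelow tapes (suc M) (λ ω t → excess t ω)) ⟩
    2 ^ L * sumBelow (suc M) (λ t → ∑ tapes (excess t))     ≤⟨ sumBelow-≤-* (suc M) (2 ^ L) _ (λ t≤M → both (s≤s⁻¹ t≤M)) ⟩
    suc M * (6 * N ^ T)                                     ∎
    where
    open ≤-Reasoning
    tapes : List (Vec (Fin N) T)
    tapes = vectors (allFin N) T
    double : ∀ x → 3 * x + 3 * x ≡ 6 * x
    double = solve-∀
    both : ∀ {t} → t ≤ M → 2 ^ L * ∑ tapes (excess t) ≤ 6 * N ^ T
    both {t} t≤M = begin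
      2 ^ L * ∑ tapes (excess t)
        ≡⟨ trans (cong (2 ^ L *_) (∑-+ tapes _ _)) (*-distribˡ-+ (2 ^ L) _ _) ⟩
      2 ^ L * ∑ tapes (λ ω → ⟦ lt ⟧ (t * w + M * M * V * L) (M * weight (_<ᵇ t) ω))
        + 2 ^ L * ∑ tapes (λ ω → ⟦ lt ⟧ ((M ∸ t) * w + M * M * V * L) (M * weight (λ r → not (r <ᵇ t)) ω))
        ≤⟨ +-mono-≤
             (tail-bound N T q M V n 8 L v N≡q*M v≤V n≤M² tape (_<ᵇ t) t (M ∸ t)
               (trans (count-< M t) (m≥n⇒m⊓n≡n t≤M)) (m+[n∸m]≡n t≤M))
             (tail-bound N T q M V n 8 L v N≡q*M v≤V n≤M² tape (λ r → not (r <ᵇ t)) (M ∸ t) t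
               (count-≮ t≤M) (m∸n+n≡m t≤M)) ⟩
      3 * N ^ T + 3 * N ^ T
        ≡⟨ double (N ^ T) ⟩
      6 * N ^ T ∎

  -- After division by `d * N ^ T` this is a success probability of at least 1 - 1 / d; it is used
  -- with `d = n ^ c`.
  success-often : ∀ {E : Vec (Fin N) T → Set} (E? : ∀ ω → Dec (E ω)) → (∀ ω → failures ω ≡ 0 → E ω) →
                  ∀ {d} → d * (6 * suc M) ≤ 2 ^ L →
                  N ^ T * d ≤ length (filter E? (vectors (allFin N) T)) * d + N ^ T
  success-often E? zero⇒E {d} d≤ = *-cancelˡ-≤ (2 ^ L) {{m^n≢0 2 L}} (begin
    2 ^ L * (N ^ T * d)                                   ≡⟨ cong (λ z → 2 ^ L * (z * d)) (∑-tapes N T) ⟨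
    2 ^ L * (∑ tapes (λ _ → 1) * d)                       ≤⟨ *-monoʳ-≤ (2 ^ L) (*-monoˡ-≤ d (length-filter-≥ E? failures tapes zero⇒E)) ⟩
    2 ^ L * ((hit + ∑ tapes failures) * d)                ≡⟨ step₁ (2 ^ L) hit (∑ tapes failures) d ⟩
    2 ^ L * (hit * d) + 2 ^ L * ∑ tapes failures * d      ≤⟨ +-monoʳ-≤ (2 ^ L * (hit * d)) (*-monoˡ-≤ d failures-rare) ⟩
    2 ^ L * (hit * d) + suc M * (6 * N ^ T) * d           ≡⟨ cong (2 ^ L * (hit * d) +_) (step₂ (suc M) (N ^ T) d) ⟩
    2 ^ L * (hit * d) + d * (6 * suc M) * N ^ T           ≤⟨ +-monoʳ-≤ (2 ^ L * (hit * d)) (*-monoˡ-≤ (N ^ T) d≤) ⟩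
    2 ^ L * (hit * d) + 2 ^ L * N ^ T                     ≡⟨ *-distribˡ-+ (2 ^ L) (hit * d) (N ^ T) ⟨
    2 ^ L * (hit * d + N ^ T)                             ∎)
    where
    open ≤-Reasoning
    tapes : List (Vec (Fin N) T)
    tapes = vectors (allFin N) T
    hit : ℕ
    hit = length (filter E? tapes)
    step₁ : ∀ a h f d → a * ((h + f) * d) ≡ a * (h * d) + a * f * d
    step₁ = solve-∀
    step₂ : ∀ m x d → m * (6 * x) * d ≡ d * (6 * m) * x
    step₂ = solve-∀

1-1/d≤a/e : ∀ a d e .{{_ : NonZero d}} .{{_ : NonZero e}} → e * d ≤ a * d + e →
            1ℚᵘ ℚᵘ.- (ℤ.+ 1 ℚᵘ./ d) ℚᵘ.≤ ℤ.+ a ℚᵘ./ e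
1-1/d≤a/e a (suc d) (suc e) ed≤ = *≤* (subst₂ ℤ._≤_ (sym left) (ℤ.pos-* a (1 * suc d)) (ℤ.+≤+ bound))
  where
  left : (ℤ.+ 1 ℤ.* ℤ.+ suc d ℤ.+ -[1+ 0 ] ℤ.* ℤ.+ 1) ℤ.* ℤ.+ suc e ≡ ℤ.+ (d * suc e)
  left = trans (cong (λ z → (z ℤ.+ -[1+ 0 ]) ℤ.* ℤ.+ suc e) (ℤ.*-identityˡ (ℤ.+ suc d))) (sym (ℤ.pos-* d (suc e)))
  swap : ∀ d e → (1 + e) * (1 + d) ≡ d * (1 + e) + (1 + e)
  swap = solve-∀
  bound : d * suc e ≤ a * (1 * suc d)
  bound = +-cancelʳ-≤ (suc e) _ _ (≤-trans (≤-reflexive (sym (swap d e)))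
    (≤-trans ed≤ (≤-reflexive (cong (λ z → a * z + suc e) (sym (*-identityˡ (suc d)))))))

-- Arithmetic of the parameters

2^n>n : ∀ n → n < 2 ^ n
2^n>n zero    = z<s
2^n>n (suc n) = ≤-trans (+-mono-≤ (m^n>0 2 n) (2^n>n n)) (≤-reflexive (cong (2 ^ n +_) (sym (+-identityʳ (2 ^ n)))))

n<2^bitLength : ∀ n → n < 2 ^ bitLength n
n<2^bitLength n = ≰⇒> λ 2^≤n → <⇒≱ (n<1+n ⌊log₂ n ⌋)
  (subst (_≤ ⌊log₂ n ⌋) (⌊log₂[2^n]⌋≡n (bitLength n)) (⌊log₂⌋-mono-≤ 2^≤n))

m<bitLength : ∀ {m n} → 2 ^ m ≤ n → m < bitLength n
m<bitLength {m} {n} 2^m≤n = s≤s (subst (_≤ ⌊log₂ n ⌋) (⌊log₂[2^n]⌋≡n m) (⌊log₂⌋-mono-≤ 2^m≤n))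

-- Both halves are needed: `n ≤ M * M` keeps the accumulated moment error bounded, and minimality
-- gives `M * M ≤ 4 * n` for the running time. The search goes upwards from 0 with fuel `n`.
exponent : ∀ n → ∃[ m ] (∀ {k} → k < m → 2 ^ k * 2 ^ k < n) × n ≤ 2 ^ m * 2 ^ m
exponent n = go n 0 (λ ()) (≤-trans (<⇒≤ (2^n>n n)) (subst (λ z → 2 ^ n ≤ 2 ^ z * 2 ^ z) (sym (+-identityʳ n)) (m≤m*n (2 ^ n) (2 ^ n) {{m^n≢0 2 n}})))
  where
  go : ∀ r m → (∀ {k} → k < m → 2 ^ k * 2 ^ k < n) → n ≤ 2 ^ (r + m) * 2 ^ (r + m) →
       ∃[ m ] (∀ {k} → k < m → 2 ^ k * 2 ^ k < n) × n ≤ 2 ^ m * 2 ^ m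
  go zero    m small large = m , small , large
  go (suc r) m small large with n ≤? 2 ^ m * 2 ^ m
  ... | yes n≤ = m , small , n≤
  ... | no n≰ = go r (suc m) small′ (subst (λ z → n ≤ 2 ^ z * 2 ^ z) (sym (+-suc r m)) large)
    where
    small′ : ∀ {k} → k < suc m → 2 ^ k * 2 ^ k < n
    small′ k≤m with m≤n⇒m<n∨m≡n (s≤s⁻¹ k≤m)
    ... | inj₁ k<m  = small k<m
    ... | inj₂ refl = ≰⇒> n≰

module _ {n m : ℕ} .{{_ : NonZero n}} (small : ∀ {k} → k < m → 2 ^ k * 2 ^ k < n) where

  square-≤ : 2 ^ m * 2 ^ m ≤ 4 * n
  square-≤ = go m small
    where
    double : ∀ x → 2 * x * (2 * x) ≡ 4 * (x * x)
    double = solve-∀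
    go : ∀ m → (∀ {k} → k < m → 2 ^ k * 2 ^ k < n) → 2 ^ m * 2 ^ m ≤ 4 * n
    go zero    small = ≤-trans (>-nonZero⁻¹ n) (m≤n*m n 4)
    go (suc m) small = ≤-trans (≤-reflexive (double (2 ^ m))) (*-monoʳ-≤ 4 (<⇒≤ (small ≤-refl)))

  exponent-≤-bitLength : ∀ {V} → .{{NonZero V}} → suc m ≤ 2 * bitLength (n * V)
  exponent-≤-bitLength {V} = go m small
    where
    go : ∀ m → (∀ {k} → k < m → 2 ^ k * 2 ^ k < n) → suc m ≤ 2 * bitLength (n * V)
    go zero    small = s≤s z≤n
    go (suc m) small = ≤-trans (s≤s (s≤s (m≤m+n m m))) (≤-trans (≤-reflexive (cong suc (sym (+-suc m m))))
      (≤-trans (+-mono-≤ m< m<) (≤-reflexive (cong (bitLength (n * V) +_) (sym (+-identityʳ _))))))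
      where
      m< : m < bitLength (n * V)
      m< = m<bitLength (≤-trans (m≤m*n (2 ^ m) (2 ^ m) {{m^n≢0 2 m}}) (≤-trans (<⇒≤ (small ≤-refl)) (m≤m*n n V)))

  -- Here `n ^ c` is at most M^(2c), and the two tails at M + 1 thresholds, each of weight 3,
  -- contribute at most 12 M. The exponent is rounded up generously so that one more than it is (m +
  -- 1)(5 + 2c), a multiple of m + 1 that the program builds up by repeated addition.
  few-failures : ∀ c → n ≤ 2 ^ m * 2 ^ m → n ^ c * (6 * suc (2 ^ m)) ≤ 2 ^ (4 + 2 * c + m * (5 + 2 * c))
  few-failures c large = begin
    n ^ c * (6 * suc M)                 ≤⟨ *-mono-≤ (^-monoˡ-≤ c large) (*-monoʳ-≤ 6 (+-monoˡ-≤ M (m^n>0 2 m))) ⟩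
    (M * M) ^ c * (6 * (M + M))         ≡⟨ cong (_* (6 * (M + M))) (^-distribʳ-* c M M) ⟩
    M ^ c * M ^ c * (6 * (M + M))       ≡⟨ step₁ (M ^ c) M ⟩
    12 * (M * (M ^ c * M ^ c))          ≤⟨ *-mono-≤ (m≤m+n 12 4) (*-monoˡ-≤ (M ^ c * M ^ c) (m≤m^5 M)) ⟩
    16 * (M ^ 5 * (M ^ c * M ^ c))      ≤⟨ *-monoˡ-≤ _ (m≤m*n 16 (2 ^ (2 * c)) {{m^n≢0 2 (2 * c)}}) ⟩
    16 * 2 ^ (2 * c) * (M ^ 5 * (M ^ c * M ^ c)) ≡⟨ cong₂ _*_ (sym (^-distribˡ-+-* 2 4 (2 * c))) (sym M^) ⟩
    2 ^ (4 + 2 * c) * M ^ (5 + 2 * c)   ≡⟨ cong (2 ^ (4 + 2 * c) *_) (^-*-assoc 2 m (5 + 2 * c)) ⟩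
    2 ^ (4 + 2 * c) * 2 ^ (m * (5 + 2 * c)) ≡⟨ ^-distribˡ-+-* 2 (4 + 2 * c) (m * (5 + 2 * c)) ⟨
    2 ^ (4 + 2 * c + m * (5 + 2 * c))   ∎
    where
    open ≤-Reasoning
    M : ℕ
    M = 2 ^ m
    instance
      M≢0 : NonZero M
      M≢0 = m^n≢0 2 m
    step₁ : ∀ a M → a * a * (6 * (M + M)) ≡ 12 * (M * (a * a))
    step₁ = solve-∀
    m≤m^5 : ∀ M .{{_ : NonZero M}} → M ≤ M ^ 5
    m≤m^5 M = m≤m*n M (M ^ 4) {{m^n≢0 M 4}}
    M^ : M ^ (5 + 2 * c) ≡ M ^ 5 * (M ^ c * M ^ c)
    M^ = trans (^-distribˡ-+-* M 5 (2 * c)) (cong (M ^ 5 *_)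
      (trans (cong (M ^_) (cong (c +_) (+-identityʳ c))) (^-distribˡ-+-* M c c)))

sumBelow-≤ : ∀ n f {B} → (∀ {j} → j < n → f j ≤ B) → sumBelow n f ≤ n * B
sumBelow-≤ n f {B} f≤B = ≤-trans (sumBelow-mono n f≤B) (≤-reflexive (sumBelow-const n B))

∸∸≡⊓ : ∀ m n → m ∸ (m ∸ n) ≡ m ⊓ n
∸∸≡⊓ m n with ≤-total m n
... | inj₁ m≤n rewrite m≤n⇒m∸n≡0 m≤n | m≤n⇒m⊓n≡m m≤n = refl
... | inj₂ n≤m rewrite m≥n⇒m⊓n≡n n≤m = m∸[m∸n]≡n n≤m

-- Y bounds the inputs; the largest register value, an address beyond the
-- window of half-width D, is then O(Y^(5 + e)).
module Overflow (e n m : ℕ) (ν : Memory) where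

  open Parameters e n m ν

  module Fits {b Y : ℕ} (2≤Y : 2 ≤ Y) (n≤Y : n ≤ Y) (wt≤Y : ∀ {j} → j < n → wt j ≤ Y) (pr≤Y : ∀ {j} → j < n → pr j ≤ Y)
              (square : M * M ≤ 4 * n) (Y^ : Y ^ (10 + e) ≤ 2 ^ b) where

    private
      instance
        Y≢0 : NonZero Y
        Y≢0 = >-nonZero (≤-trans (s≤s z≤n) 2≤Y)
        M≢0 : NonZero M
        M≢0 = m^n≢0 2 m

      Z : ℕ
      Z = Y ^ (5 + e)

      power : ∀ k → k ≤ 5 → Y ^ k ≤ Z
      power k k≤5 = ^-monoʳ-≤ Y (≤-trans k≤5 (m≤m+n 5 e))

      16Z<2^b : 16 * Z < 2 ^ b
      16Z<2^b = begin-strict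
        16 * Z            ≤⟨ *-monoˡ-≤ Z (^-monoˡ-≤ 4 2≤Y) ⟩
        Y ^ 4 * Z         ≡⟨ ^-distribˡ-+-* Y 4 (5 + e) ⟨
        Y ^ (9 + e)       <⟨ m<n*m _ Y (m^n>0 Y (9 + e)) 2≤Y ⟩
        Y * Y ^ (9 + e)   ≤⟨ Y^ ⟩
        2 ^ b             ∎
        where
        open ≤-Reasoning
        m<n*m : ∀ m n → 0 < m → 2 ≤ n → m < n * m
        m<n*m m n 0<m 2≤n = ≤-trans (m<m+n m 0<m) (≤-trans (≤-reflexive (cong (m +_) (sym (+-identityʳ m)))) (*-monoˡ-≤ m 2≤n))

      below : ∀ {x} → x ≤ Z → x < 2 ^ b
      below x≤Z = ≤-<-trans (≤-trans x≤Z (m≤n*m Z 16)) 16Z<2^b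

      Y^1 : Y ^ 1 ≡ Y
      Y^1 = *-identityʳ Y

      product : ∀ {x y} k l → x ≤ Y ^ k → y ≤ Y ^ l → x * y ≤ Y ^ (k + l)
      product k l x≤ y≤ = ≤-trans (*-mono-≤ x≤ y≤) (≤-reflexive (sym (^-distribˡ-+-* Y k l)))

      ≤Y^1 : ∀ {x} → x ≤ Y → x ≤ Y ^ 1
      ≤Y^1 = subst (_ ≤_) (sym Y^1)

      M²≤ : M * M ≤ Y ^ 3
      M²≤ = ≤-trans square (product 2 1 (^-monoˡ-≤ 2 2≤Y) (≤Y^1 n≤Y))

      V≤Y : V ≤ Y
      V≤Y = maxBelow-lub n wt wt≤Y

      total≤ : total ≤ Y ^ 2
      total≤ = ≤-trans (sumBelow-≤ n wt wt≤Y) (product 1 1 (≤Y^1 n≤Y) (≤Y^1 ≤-refl))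

    total-fits : total < 2 ^ b
    total-fits = below (≤-trans total≤ (power 2 (s≤s (s≤s z≤n))))

    M²-fits : M * M < 2 ^ b
    M²-fits = below (≤-trans M²≤ (power 3 (s≤s (s≤s (s≤s z≤n)))))

    -- The window constant `e` is not bounded by the input. Absorbing it into `Y ^ e` is what brings
    -- `e` into the required word size.
    e<Y^ : e ≤ Y ^ e
    e<Y^ = ≤-trans (<⇒≤ (2^n>n e)) (^-monoˡ-≤ e 2≤Y)

    e-fits : e < 2 ^ b
    e-fits = below (≤-trans e<Y^ (^-monoʳ-≤ Y (m≤n+m e 5)))

    profits-fit : sumBelow n pr + sumBelow n pr < 2 ^ b
    profits-fit = below (≤-trans (+-mono-≤ pr≤ (≤-trans pr≤ (≤-reflexive (sym (+-identityʳ (Y ^ 2))))))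
      (≤-trans (*-monoˡ-≤ (Y ^ 2) 2≤Y) (power 3 (s≤s (s≤s (s≤s z≤n))))))
      where
      pr≤ : sumBelow n pr ≤ Y ^ 2
      pr≤ = ≤-trans (sumBelow-≤ n pr pr≤Y) (product 1 1 (≤Y^1 n≤Y) (≤Y^1 ≤-refl))

    addresses-fit : n + 1 + n + (n + 1) + (M * W + D + 1 + V) < 2 ^ b
    addresses-fit = ≤-<-trans (begin
      n + 1 + n + (n + 1) + (M * W + D + 1 + V)
        ≤⟨ +-mono-≤ (+-mono-≤ (+-mono-≤ (+-mono-≤ n≤Z 1≤Z) n≤Z) (+-mono-≤ n≤Z 1≤Z))
                    (+-mono-≤ (+-mono-≤ (+-mono-≤ MW≤ D≤) 1≤Z) (≤-trans V≤Y Y≤Z)) ⟩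
      Z + Z + Z + (Z + Z) + (Z + Z + Z + Z)  ≡⟨ nine Z ⟩
      9 * Z                                  ≤⟨ *-monoˡ-≤ Z (m≤m+n 9 7) ⟩
      16 * Z                                 ∎) 16Z<2^b
      where
      open ≤-Reasoning
      nine : ∀ Z → Z + Z + Z + (Z + Z) + (Z + Z + Z + Z) ≡ 9 * Z
      nine = solve-∀
      Y≤Z : Y ≤ Z
      Y≤Z = ≤-trans (≤-reflexive (sym Y^1)) (power 1 (s≤s z≤n))
      1≤Z : 1 ≤ Z
      1≤Z = m^n>0 Y (5 + e)
      n≤Z : n ≤ Z
      n≤Z = ≤-trans n≤Y Y≤Z
      W≤ : W ≤ Y ^ 2
      W≤ = ≤-trans (≤-trans (≤-reflexive (∸∸≡⊓ (ν 0) total)) (m⊓n≤n (ν 0) total)) total≤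
      MW≤ : M * W ≤ Z
      MW≤ = ≤-trans (product 3 2 (≤-trans (m≤m*n M M) M²≤) W≤) (power 5 ≤-refl)
      D≤ : D ≤ Z
      D≤ = begin
        suc m * (V * e) * M     ≤⟨ *-monoˡ-≤ M (*-mono-≤ (2^n>n m) (*-mono-≤ V≤Y e<Y^)) ⟩
        M * (Y * Y ^ e) * M     ≡⟨ rearrange M (Y * Y ^ e) ⟩
        M * M * (Y * Y ^ e)     ≤⟨ product 3 (suc e) M²≤ ≤-refl ⟩
        Y ^ (3 + suc e)         ≤⟨ ^-monoʳ-≤ Y (≤-trans (≤-reflexive (+-suc 3 e)) (n≤1+n (4 + e))) ⟩
        Z                       ∎
        where
        rearrange : ∀ M A → M * A * M ≡ M * M * A
        rearrange = solve-∀

div-remainder : ∀ M .{{_ : NonZero M}} x → x ≤ M * (⟦ div ⟧ x M + 1)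
div-remainder M@(suc _) x = begin
  x                       ≡⟨ m≡m%n+[m/n]*n x M ⟩
  x % M + x / M * M       ≤⟨ +-monoˡ-≤ _ (<⇒≤ (m%n<n x M)) ⟩
  M + x / M * M           ≡⟨ +-comm M _ ⟩
  x / M * M + M           ≡⟨ cong₂ _+_ (*-comm (x / M) M) (sym (*-identityʳ M)) ⟩
  M * (x / M) + M * 1     ≡⟨ *-distribˡ-+ M (x / M) 1 ⟨
  M * (x / M + 1)         ∎
  where open ≤-Reasoning

module Duration (e n m : ℕ) (ν : Memory)
                .{{_ : NonZero n}} .{{_ : NonZero (Parameters.V e n m ν)}} where

  open Parameters e n m ν

  private
    instance
      M≢0 : NonZero M
      M≢0 = m^n≢0 2 m

    W≤nV : W ≤ n * V
    W≤nV = ≤-trans (≤-reflexive (∸∸≡⊓ (ν 0) total)) (≤-trans (m⊓n≤n (ν 0) total) (sumBelow-≤ n wt (≤-maxBelow n wt)))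

  -- `M * V` covers a bucket's share W / M of the capped capacity, because `W ≤ n * V` and
  -- `n ≤ M * M`; `D + D` is the slack at both ends and 2 is due to rounding and the exclusive upper
  -- end.
  width : ℕ
  width = M * V + (D + D) + 2

  cnt-≤-width : n ≤ M * M → ∀ {t} → t < M → cnt t ≤ width
  cnt-≤-width n≤M² {t} t<M = m≤n+o⇒m∸n≤o _ (lo t) (begin
    ⟦ div ⟧ (t * W + W) M + D + 1          ≤⟨ +-monoˡ-≤ 1 (+-monoˡ-≤ D (div-upper M next)) ⟩
    q + 1 + M * V + D + 1                  ≤⟨ +-monoˡ-≤ 1 (+-monoˡ-≤ D (+-monoˡ-≤ (M * V) (+-monoˡ-≤ 1 (m≤n+m∸n q D)))) ⟩
    D + lo t + 1 + M * V + D + 1           ≡⟨ rearrange (lo t) D (M * V) ⟩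
    lo t + width                           ∎)
    where
    open ≤-Reasoning
    q : ℕ
    q = ⟦ div ⟧ (t * W) M
    rearrange : ∀ l D x → D + l + 1 + x + D + 1 ≡ l + (x + (D + D) + 2)
    rearrange = solve-∀
    next : t * W + W ≤ M * (q + 1 + M * V)
    next = begin
      t * W + W                        ≤⟨ +-mono-≤ (div-remainder M (t * W)) (≤-trans W≤nV (*-monoˡ-≤ V n≤M²)) ⟩
      M * (q + 1) + M * M * V          ≡⟨ cong (M * (q + 1) +_) (*-assoc M M V) ⟩
      M * (q + 1) + M * (M * V)        ≡⟨ *-distribˡ-+ M (q + 1) (M * V) ⟨
      M * (q + 1 + M * V)              ∎

  private
    S : ℕ
    S = n * M * V * suc m

    instance
      nM≢0 : NonZero (n * M)
      nM≢0 = m*n≢0 n M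
      nMV≢0 : NonZero (n * M * V)
      nMV≢0 = m*n≢0 (n * M) V

    nMV≤S : n * M * V ≤ S
    nMV≤S = m≤m*n (n * M * V) (suc m)
    nM≤S : n * M ≤ S
    nM≤S = ≤-trans (m≤m*n (n * M) V) nMV≤S
    n≤S : n ≤ S
    n≤S = ≤-trans (m≤m*n n M) nM≤S
    M≤S : M ≤ S
    M≤S = ≤-trans (m≤n*m M n) nM≤S
    1≤S : 1 ≤ S
    1≤S = ≤-trans (>-nonZero⁻¹ n) n≤S
    m≤S : m ≤ S
    m≤S = ≤-trans (n≤1+n m) (m≤n*m (suc m) (n * M * V))
    W≤S : W ≤ S
    W≤S = ≤-trans W≤nV (≤-trans (*-monoˡ-≤ V (m≤m*n n M)) nMV≤S)

  time-width-≤ : time width ≤ (115 + 24 * e) * S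
  time-width-≤ = begin
    time width
      ≡⟨ expand M n m V e W ⟩
    9 * (n * M) + 13 * M + 40 * n + 5 * m + 30 * 1 + 12 * (n * M * V) + 24 * e * S + 6 * W
      ≤⟨ +-mono-≤ (+-monoˡ-≤ (24 * e * S) (+-mono-≤ (+-mono-≤ (+-mono-≤ (+-mono-≤ (+-mono-≤ (*-monoʳ-≤ 9 nM≤S) (*-monoʳ-≤ 13 M≤S))
           (*-monoʳ-≤ 40 n≤S)) (*-monoʳ-≤ 5 m≤S)) (*-monoʳ-≤ 30 1≤S)) (*-monoʳ-≤ 12 nMV≤S))) (*-monoʳ-≤ 6 W≤S) ⟩
    9 * S + 13 * S + 40 * S + 5 * S + 30 * S + 12 * S + 24 * e * S + 6 * S
      ≡⟨ collect S e ⟩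
    (115 + 24 * e) * S ∎
    where
    open ≤-Reasoning
    expand : ∀ M n m V e W →
      M * (n * 9 + 13) + (n * 10 + m * 5 + 20)
        + n * ((M * V + ((1 + m) * (V * e) * M + (1 + m) * (V * e) * M) + 2) * 12 + 6) + W * 6 + 10
      ≡ 9 * (n * M) + 13 * M + 40 * n + 5 * m + 30 * 1 + 12 * (n * M * V) + 24 * e * (n * M * V * (1 + m)) + 6 * W
    expand = solve-∀
    collect : ∀ S e → 9 * S + 13 * S + 40 * S + 5 * S + 30 * S + 12 * S + 24 * e * S + 6 * S ≡ (115 + 24 * e) * S
    collect = solve-∀

  -- In squared form `M` occurs as `M * M ≤ 4 * n`, so no square root is formed. The factor `suc m`
  -- from the window width is the only logarithm, whence the exponent 1.
  timeBound : ∀ {wmax} → V ≤ wmax → M * M ≤ 4 * n → suc m ≤ 2 * bitLength (n * wmax) →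
              TimeBound (4 * (115 + 24 * e)) 1 n wmax (time width)
  timeBound {wmax} V≤ M²≤ m≤ = begin
    time width ^ 2                                          ≤⟨ ^-monoˡ-≤ 2 (≤-trans time-width-≤ (*-monoʳ-≤ K (*-mono-≤ (*-monoʳ-≤ (n * M) V≤) m≤))) ⟩
    (K * (n * M * wmax * (2 * bl))) ^ 2                     ≡⟨ step₁ K n M wmax bl ⟩
    (2 * K * wmax * bl) * (2 * K * wmax * bl) * (n * n) * (M * M)   ≤⟨ *-monoʳ-≤ ((2 * K * wmax * bl) * (2 * K * wmax * bl) * (n * n)) M²≤ ⟩
    (2 * K * wmax * bl) * (2 * K * wmax * bl) * (n * n) * (4 * n)   ≡⟨ step₂ K n wmax bl ⟩
    (4 * K * wmax * bl ^ 1) ^ 2 * n ^ 3                     ∎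
    where
    open ≤-Reasoning
    K bl : ℕ
    K  = 115 + 24 * e
    bl = bitLength (n * wmax)
    step₁ : ∀ K n M w b → K * (n * M * w * (2 * b)) * (K * (n * M * w * (2 * b)) * 1)
                        ≡ (2 * K * w * b) * (2 * K * w * b) * (n * n) * (M * M)
    step₁ = solve-∀
    step₂ : ∀ K n w b → (2 * K * w * b) * (2 * K * w * b) * (n * n) * (4 * n)
                      ≡ 4 * K * w * (b * 1) * (4 * K * w * (b * 1) * 1) * (n * (n * (n * 1)))
    step₂ = solve-∀

-- Assembly

open Knapsack

cell : List ℕ → ℕ → ℕ
cell xs a = fromMaybe 0 (head (drop a xs))

cell-beyond : ∀ xs {a} → length xs ≤ a → cell xs a ≡ 0
cell-beyond []       {zero}  _   = refl
cell-beyond []       {suc a} _   = refl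
cell-beyond (x ∷ xs) {suc a} l≤a = cell-beyond xs (s≤s⁻¹ l≤a)

cell-≤ : ∀ {xs B} → All (_≤ B) xs → ∀ a → cell xs a ≤ B
cell-≤ []         zero    = z≤n
cell-≤ []         (suc a) = z≤n
cell-≤ (x≤ ∷ xs≤) zero    = x≤
cell-≤ (x≤ ∷ xs≤) (suc a) = cell-≤ xs≤ a

cell-tabulate : ∀ {n} (f : Vector ℕ n) ys i → cell (tabulate f ++ ys) (toℕ i) ≡ f i
cell-tabulate f ys zero    = refl
cell-tabulate f ys (suc i) = cell-tabulate (f ∘ suc) ys i

cell-++ : ∀ {n} (f : Vector ℕ n) ys j → cell (tabulate f ++ ys) (n + j) ≡ cell ys j
cell-++ {zero}  f ys j = refl
cell-++ {suc n} f ys j = cell-++ (f ∘ suc) ys j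

≤-maximum : ∀ {n} (f : Vector ℕ n) i → f i ≤ maximum f
≤-maximum f zero    = m≤m⊔n (f zero) _
≤-maximum f (suc i) = ≤-trans (≤-maximum (f ∘ suc) i) (m≤n⊔m (f zero) _)

below-toℕ : ∀ {n} (P : ℕ → Set) → (∀ (i : Fin n) → P (toℕ i)) → ∀ {j} → j < n → P j
below-toℕ P all j<n = subst P (Fin.toℕ-fromℕ< j<n) (all (fromℕ< j<n))

module Solve (c n : ℕ) .{{_ : NonZero n}} (I : Knapsack n) (b : ℕ)
             (wide : (10 + (5 + 2 * c)) * bitLength (largestInput I) ≤ b)
             (m : ℕ) (small : ∀ {k} → k < m → 2 ^ k * 2 ^ k < n) (large : n ≤ 2 ^ m * 2 ^ m) where

  private
    e X Y : ℕ
    e = 5 + 2 * c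
    X = largestInput I
    Y = 2 ^ bitLength X

    square : 2 ^ m * 2 ^ m ≤ 4 * n
    square = square-≤ small

    ν : Memory
    ν = cell (W I ∷ tabulate (w I) ++ tabulate (p I))

    open Parameters e n m ν using (wt; pr; V; M)

    wt≡w : ∀ i → wt (toℕ i) ≡ w I i
    wt≡w = cell-tabulate (w I) (tabulate (p I))

    pr≡p : ∀ i → pr (toℕ i) ≡ p I i
    pr≡p i = trans (cong (n ∷ₘ ν) (shift n (toℕ i))) (trans (cell-++ (w I) (tabulate (p I)) (toℕ i))
      (trans (cong (λ xs → cell xs (toℕ i)) (sym (++-identityʳ (tabulate (p I))))) (cell-tabulate (p I) [] i)))
      where
      shift : ∀ n j → n + 1 + (1 + j) ≡ 2 + (n + j)
      shift = solve-∀

    n≤X : n ≤ X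
    n≤X = ≤-trans (m≤m⊔n n (W I)) (≤-trans (m≤m⊔n _ (wmax I)) (m≤m⊔n _ (pmax I)))
    W≤X : W I ≤ X
    W≤X = ≤-trans (m≤n⊔m n (W I)) (≤-trans (m≤m⊔n _ (wmax I)) (m≤m⊔n _ (pmax I)))
    w≤X : ∀ i → w I i ≤ X
    w≤X i = ≤-trans (≤-maximum (w I) i) (≤-trans (m≤n⊔m (n ⊔ W I) (wmax I)) (m≤m⊔n _ (pmax I)))
    p≤X : ∀ i → p I i ≤ X
    p≤X i = ≤-trans (≤-maximum (p I) i) (m≤n⊔m _ (pmax I))

    X<Y : X < Y
    X<Y = n<2^bitLength X

    2≤Y : 2 ≤ Y
    2≤Y = ^-monoʳ-≤ 2 {1} {bitLength X} (s≤s z≤n)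

    -- `Y` is the inputs' bound rounded up to a power of two, so the hypothesis on the word size
    -- becomes an inequality of exponents.
    Y^ : Y ^ (10 + e) ≤ 2 ^ b
    Y^ = ≤-trans (≤-reflexive (trans (^-*-assoc 2 (bitLength X) (10 + e)) (cong (2 ^_) (*-comm (bitLength X) (10 + e)))))
      (^-monoʳ-≤ 2 wide)

    X<2^b : X < 2 ^ b
    X<2^b = <-≤-trans X<Y (≤-trans (m≤m*n Y (Y ^ (9 + e)) {{m^n≢0 Y (9 + e) {{m^n≢0 2 (bitLength X)}}}}) Y^)

    n≤Y : n ≤ Y
    n≤Y = ≤-trans n≤X (<⇒≤ X<Y)

    wt≤Y : ∀ {j} → j < n → wt j ≤ Y
    wt≤Y = below-toℕ (λ j → wt j ≤ Y) λ i → ≤-trans (≤-reflexive (wt≡w i)) (≤-trans (w≤X i) (<⇒≤ X<Y))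

    pr≤Y : ∀ {j} → j < n → pr j ≤ Y
    pr≤Y = below-toℕ (λ j → pr j ≤ Y) λ i → ≤-trans (≤-reflexive (pr≡p i)) (≤-trans (p≤X i) (<⇒≤ X<Y))

    open Overflow.Fits e n m ν {b} {Y} 2≤Y n≤Y wt≤Y pr≤Y square Y^

    wt>0 : ∀ {j} → j < n → 0 < wt j
    wt>0 = below-toℕ (λ j → 0 < wt j) λ i → subst (0 <_) (sym (wt≡w i)) (w>0 I i)

    pr>0 : ∀ {j} → j < n → 0 < pr j
    pr>0 = below-toℕ (λ j → 0 < pr j) λ i → subst (0 <_) (sym (pr≡p i)) (p>0 I i)

    instance
      V≢0 : NonZero V
      V≢0 = >-nonZero (≤-trans (wt>0 (>-nonZero⁻¹ n)) (≤-maxBelow n wt (>-nonZero⁻¹ n)))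
      M≢0 : NonZero M
      M≢0 = m^n≢0 2 m

    V≤wmax : V ≤ wmax I
    V≤wmax = maxBelow-lub n wt (below-toℕ (λ j → wt j ≤ wmax I) λ i → ≤-trans (≤-reflexive (wt≡w i)) (≤-maximum (w I) i))

    open Duration e n m ν

    σ : ℕ → Bool
    σ = proj₁ (optimum I wt pr wt≡w pr≡p)

    isOpt : IsOptimum n (W I) wt pr σ (OPT I)
    isOpt = proj₂ (optimum I wt pr wt≡w pr≡p)

    inputs-≤ : All (_≤ X) (encoding I)
    inputs-≤ = n≤X ∷ W≤X ∷ All.++⁺ (All.tabulate⁺ w≤X) (All.tabulate⁺ p≤X)

    start : Config 22 b
    start = initial b (program e) (encoding I)

  -- A time bound that depends on the instance alone, so that one tape length serves all tapes;
  -- shorter runs idle until `T`.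
  T : ℕ
  T = Parameters.time e n m ν width

  T-bound : TimeBound (4 * (115 + 24 * e)) 1 n (wmax I) T
  T-bound = timeBound V≤wmax square (exponent-≤-bitLength small {{wmax≢0}})
    where
    wmax≢0 : NonZero (wmax I)
    wmax≢0 = >-nonZero (≤-trans (>-nonZero⁻¹ V) V≤wmax)

  private
    tape : n * 10 + 8 ≤ T
    tape = ≤-trans (≤-trans (+-mono-≤ (m≤m+n (n * 10) (m * 5)) (m≤m+n 8 12)) (m≤n+m _ (M * (n * 9 + 13))))
      (≤-trans (m≤m+n _ (n * (width * 12 + 6))) (≤-trans (m≤m+n _ _) (m≤m+n _ 10)))

    L q : ℕ
    L = 4 + 2 * c + m * e
    q = 2 ^ (b ∸ m)

    m≤b : m ≤ b
    m≤b = ≮⇒≥ λ b<m → <⇒≱ M²-fits (≤-trans (^-monoʳ-≤ 2 (<⇒≤ b<m)) (m≤m*n M M))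

    words : 2 ^ b ≡ q * M
    words = trans (cong (2 ^_) (sym (m∸n+n≡m m≤b))) (^-distribˡ-+-* 2 (b ∸ m) m)

    failed : Vec (Word b) T → ℕ
    failed = failures n M V L T q (2 ^ b) wt σ words (≤-maxBelow n wt) large tape

    module Outcome (ω : Vec (Word b) T) where
      -- The tape is fixed, and `Good` becomes the statement that this particular tape has no
      -- failures.
      open Correct e n m ν b (at ω) σ (failed ω ≡ 0) width
      open Parameters e n m ν using () renaming (W to W′)

      W′≡ : W′ ≡ W I ⊓ sumBelow n wt
      W′≡ = ∸∸≡⊓ (W I) (sumBelow n wt)

      bk<M : ∀ j → bk j < M
      bk<M j = rem-< _ (>-nonZero⁻¹ M)

      balance : failed ω ≡ 0 → ∀ {t} → t ≤ M → Balanced n W′ M (Parameters.D e n m ν) wt bk σ t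
      balance good {t} t≤M = balanced {V = V} {m = suc m} {c = e} {L = L} refl t≤M
        (subst (sumOver n σ wt ≤_) (sym W′≡) (⊓-glb (IsOptimum.feasible isOpt) (sumOver-≤ n σ wt)))
        (subst (_≤ sumOver n σ wt + V) (sym W′≡) (optimum-saturated isOpt pr>0))
        (proj₁ both) (proj₂ both)
        where
        both = failures-zero n M V L T q (2 ^ b) wt σ words (≤-maxBelow n wt) large tape ω good t≤M

      empty : ∀ j → cell (encoding I) (n + 1 + n + (n + 1) + j) ≡ 0
      empty j = cell-beyond (encoding I) (begin
        2 + length (tabulate (w I) ++ tabulate (p I))
          ≡⟨ cong (2 +_) (trans (length-++ (tabulate (w I))) (cong₂ _+_ (length-tabulate (w I)) (length-tabulate (p I)))) ⟩
        2 + (n + n)               ≤⟨ m≤m+n _ (n + j) ⟩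
        2 + (n + n) + (n + j)     ≡⟨ rearrange n j ⟩
        n + 1 + n + (n + 1) + j   ∎)
        where
        open ≤-Reasoning
        rearrange : ∀ n j → 2 + (n + n) + (n + j) ≡ n + 1 + n + (n + 1) + j
        rearrange = solve-∀

      ∷ₘ-cell : ∀ a → μ₀ a ≡ cell (encoding I) a
      ∷ₘ-cell zero    = refl
      ∷ₘ-cell (suc a) = refl

      outcome : Halted (run ω start) × ∃[ k ] ∃[ μ ] Result k μ × (∀ a → toℕ (mem (run ω start) a) ≡ μ (toℕ a))
      outcome = adequate ω (λ i → cong (at ω) (+-identityʳ i)) (λ {k′} (k≤T , _) → ≤-trans k≤T (m≤m+n T 0))
        (refl , (λ r → trans (toℕ-word b {0} (m^n>0 2 b)) (sym (lookup-replicate r 0)))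
              , (λ a → trans (toℕ-word b (≤-<-trans (cell-≤ inputs-≤ (toℕ a)) X<2^b)) (sym (∷ₘ-cell (toℕ a)))))
        (execution addresses-fit M²-fits e-fits total-fits profits-fit wt>0
          (λ j → trans (∷ₘ-cell (n + 1 + n + (n + 1) + j)) (empty j)) small large (cnt-≤-width large)
          (λ good {t} i t<M → window (balance good (<⇒≤ t<M)) (balance good t<M) i))

      correct : failed ω ≡ 0 → output (run ω start) ≡ OPT I
      correct good = let _ , _ , μ , (_ , f , sound , complete , result) , mem~μ = outcome in begin
        output (run ω start)                         ≡⟨ mem~μ (word b 0) ⟩
        μ (toℕ (word b 0))                           ≡⟨ cong μ (toℕ-word b {0} (m^n>0 2 b)) ⟩
        μ 0                                          ≡⟨ result ⟩
        maxBelow (suc W′) f                          ≡⟨ cong (λ z → maxBelow (suc z) f) W′≡ ⟩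
        maxBelow (suc (W I ⊓ sumBelow n wt)) f       ≡⟨ optimum-computed isOpt pr>0 (λ {j} j<n →
                                                          trans (processed-first bk j<n) (<ᵇ-true (bk<M j))) sound (complete good) ⟩
        OPT I                                        ∎
        where open ≡-Reasoning

  halts : ∀ ω → Halted (run ω start)
  halts ω = proj₁ (Outcome.outcome ω)

  succeeds : (1ℚᵘ ℚᵘ.- inversePower n c) ℚᵘ.≤ Pr b T (λ ω → output (run ω start) ≟ OPT I)
  succeeds = 1-1/d≤a/e _ (n ^ c) ((2 ^ b) ^ T) {{m^n≢0 n c}} {{m^n≢0 (2 ^ b) T {{m^n≢0 2 b}}}}
    (success-often n M V L T q (2 ^ b) wt σ words (≤-maxBelow n wt) large tape
      (λ ω → output (run ω start) ≟ OPT I) Outcome.correct {n ^ c} (few-failures small c large))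

  solved : ∃[ T ] TimeBound (4 * (115 + 24 * e)) 1 n (wmax I) T
                  × (∀ (ω : Vec (Word b) T) → Halted (run ω start))
                  × (1ℚᵘ ℚᵘ.- inversePower n c) ℚᵘ.≤ Pr b T (λ ω → output (run ω start) ≟ OPT I)
  solved = T , T-bound , halts , succeeds

theorem1 : ∀ (c : ℕ) →
    ∃[ R ] ∃[ P ] ∃[ κ ] ∃[ C ] ∃[ d ]
    ∀ (n : ℕ) .{{_ : NonZero n}} (I : Knapsack n) (b : ℕ) →
    κ * bitLength (largestInput I) ≤ b →
    let start = initial {R} b P (encoding I) in
    ∃[ T ]
    TimeBound C d n (wmax I) T
    × (∀ (ω : Vec (Word b) T) → Halted (run ω start))
    × (1ℚᵘ ℚᵘ.- inversePower n c) ℚᵘ.≤ Pr b T (λ ω → output (run ω start) ≟ OPT I)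
-- The failure exponent `c` enters the program text only through the window constant `5 + 2 * c`.
theorem1 c = 22 , program (5 + 2 * c) , 10 + (5 + 2 * c) , 4 * (115 + 24 * (5 + 2 * c)) , 1 ,
  λ n I b wide → Solve.solved c n I b wide (proj₁ (exponent n)) (proj₁ (proj₂ (exponent n))) (proj₂ (proj₂ (exponent n)))
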